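{- Let $K$ be a quadratic field and $c \in K$. Then the directed graph $G(f_c,K)$ does not contain a subgraph isomorphic to the graph $G_6$.
   Context: For $f_c(z) = z^2 + c$ and a number field $K$, $G(f_c,K)$ is the directed graph whose vertices are the points of $K$ (the point at infinity excluded) that are preperiodic for $f_c$, with an edge $x \to y$ iff $f_c(x) = y$. The graph $G_6$ has twelve vertices $a, a', b, b', s, \bar s, p, q, \bar p, \bar q, r, \bar r$ and edges $a \to a$, $b \to a$, $a' \to a'$, $b' \to a'$, $s \to b$, $\bar s \to b$, $p \to q$, $q \to p$, $\bar p \to q$, $\bar q \to p$, $r \to \bar p$, $\bar r \to \bar p$ (equivalently: two distinct fixed points, a point of preperiodic type $1_2$, and a point of type $2_2$, i.e. preperiod $2$ and eventual period $2$, together with the preimages these force). -}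

module Defs where

open import Data.Nat using (ℕ; zero; suc; _*_; _<_)
open import Data.Nat.Divisibility using (_∣_)
open import Data.Nat.Primality using (Prime)
open import Data.Integer using (ℤ; ∣_∣)
open import Data.Rational as ℚ using (ℚ; _/_)
open import Data.Product using (Σ; _×_; ∃)
open import Relation.Binary.PropositionalEquality using (_≡_)
open import Relation.Nullary using (¬_)

SquareFree : ℤ → Set
SquareFree d = ∀ (p : ℕ) → Prime p → ¬ (p * p ∣ ∣ d ∣)

-- The quadratic field ℚ(√d): elements re + im √d with re, im ∈ ℚ.
-- Every quadratic field is ℚ(√d) for a unique squarefree integer d ≠ 1.
record QF (d : ℤ) : Set where
  constructor mk
  field
    re : ℚ
    im : ℚ
open QF public

module _ {d : ℤ} where
  _⊕_ : QF d → QF d → QF d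
  mk a b ⊕ mk a′ b′ = mk (a ℚ.+ a′) (b ℚ.+ b′)

  _⊗_ : QF d → QF d → QF d
  mk a b ⊗ mk a′ b′ =
    mk (a ℚ.* a′ ℚ.+ (d / 1) ℚ.* (b ℚ.* b′)) (a ℚ.* b′ ℚ.+ b ℚ.* a′)

fc : {d : ℤ} → QF d → QF d → QF d
fc c z = (z ⊗ z) ⊕ c

iter : {A : Set} → (A → A) → ℕ → A → A
iter f zero x = x
iter f (suc n) x = f (iter f n x)

Preperiodic : {A : Set} → (A → A) → A → Set
Preperiodic f x = Σ ℕ λ m → Σ ℕ λ n → m < n × iter f m x ≡ iter f n x

-- Vertices of G₆ (sb = s̄, pb = p̄, qb = q̄, rb = r̄).
data V6 : Set where
  a a′ b b′ s sb p q pb qb r rb : V6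

data E6 : V6 → V6 → Set where
  a→a   : E6 a a
  b→a   : E6 b a
  a′→a′ : E6 a′ a′
  b′→a′ : E6 b′ a′
  s→b   : E6 s b
  sb→b  : E6 sb b
  p→q   : E6 p q
  q→p   : E6 q p
  pb→q  : E6 pb q
  qb→p  : E6 qb p
  r→pb  : E6 r pb
  rb→pb : E6 rb pb

-- G(f_c, K) contains a subgraph isomorphic to G₆: an injective map from the
-- vertices of G₆ to preperiodic points of K sending every edge u → v of G₆
-- to an edge of G(f_c,K), i.e. f_c(φ u) = φ v.
ContainsG6 : {d : ℤ} → QF d → Set
ContainsG6 {d} c =
  Σ (V6 → QF d) λ φ →
    (∀ u v → φ u ≡ φ v → u ≡ v) ×
    (∀ u → Preperiodic (fc c) (φ u)) ×
    (∀ u v → E6 u v → fc c (φ u) ≡ φ v)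

{-# OPTIONS --safe #-}
-- Let a be the given fixed point, p a point of the 2-cycle, and t = a + p. Then c is a rational function of t,
-- and the points s and r of types 1₂ and 2₂ give y = 2 t s and z = 2 t r in K with y² = f₁(t) and z² = f₋₁(t),
-- where f_ε = T⁴ - 2 T³ + (1 - 2 ε) T² - 2 ε T + 1. By infinite descent, f₁ and f₋₁ take rational square values
-- at no rational number except 0 (the two curves have rank 0 and conductors 15 and 17).
--
-- If t is not rational, the parabola y = -(T² + a T + b) through (t, y) and its conjugate meets the curve y² =
-- f_ε in one more point, which is rational and hence known. So the trace A and the norm B of t satisfy B = ε or
-- A (B + ε) = B. The relations for ε = 1 and ε = -1 contradict each other.
--
-- If t is rational, then f₁(t) = d y² and f₋₁(t) = d z² for rational y and z. Comparing prime factors gives d =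
-- 5, and a third descent (conductor 75) gives t = -1, where the 2-cycle degenerates.
module Submission where

open import Defs using (SquareFree; QF; mk; re; im; _⊕_; _⊗_; fc; ContainsG6; V6; E6)
open import Level using (0ℓ)
open import Function using (_∘_)
open import Relation.Nullary
open import Relation.Nullary.Decidable using (True; toWitness; decidable-stable; dec⇒maybe; _→-dec_; _⊎-dec_)
open import Relation.Binary.Definitions using (Tri; tri<; tri≈; tri>)
open import Relation.Binary.PropositionalEquality
open import Relation.Binary.PropositionalEquality.Properties using (isEquivalence)
open import Induction.WellFounded using (Acc; acc)
open import Data.Empty using (⊥; ⊥-elim)
open import Data.Product using (∃; _×_; _,_; proj₁; proj₂)
open import Data.Sum using (_⊎_; inj₁; inj₂; map; reduce)
open import Data.Maybe.Base as Maybe using (Maybe)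
open import Data.List.Base using ([]; _∷_)
import Data.List.Relation.Unary.All as All
open import Data.Vec as Vec using (Vec; []; _∷_; lookup)
open import Data.Fin using (Fin; zero; suc; toℕ; fromℕ<)
open import Data.Fin.Properties using (all?; toℕ-fromℕ<)
open import Data.Nat
open import Data.Nat.Properties
open import Data.Nat.DivMod
open import Data.Nat.Divisibility
open import Data.Nat.GCD using (gcd; gcd[m,n]∣m; gcd[m,n]∣n; gcd-greatest; gcd[m,n]≡0⇒n≡0)
open import Data.Nat.Coprimality as Coprimality using (Coprime; coprime-divisor; coprime-factors)
open import Data.Nat.Induction using (<-wellFounded)
open import Data.Nat.Primality
open import Data.Nat.Primality.Factorisation using (factorise)
open import Data.Nat.Tactic.RingSolver using (solve-∀)
import Data.Integer.Base as Z
import Data.Integer.Properties as Z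
import Data.Integer.Divisibility.Signed as ℤ∣
import Data.Integer.Tactic.RingSolver as ℤ-Solver
open import Data.Rational.Base as ℚ using (ℚ; mkℚ; 0ℚ; 1ℚ; ↥_; ↧_)
import Data.Rational.Properties as ℚ
import Data.Rational.Solver as ℚ-Solver
open import Data.Rational.Unnormalised.Base as ℚᵘ using (mkℚᵘ; *≡*)
import Data.Rational.Unnormalised.Properties as ℚᵘ
open import Algebra.Bundles using (CommutativeRing)
open import Algebra.Structures using (IsCommutativeRing)
open import Algebra.Properties.Group using (x∙y⁻¹≈ε⇒x≈y)
import Algebra.Solver.Ring as RingSolver
open import Algebra.Solver.Ring.AlmostCommutativeRing using (fromCommutativeRing; _-Raw-AlmostCommutative⟶_)

-- Congruences between polynomials in n variables modulo m, decided on residues.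

-- With `t′ = a - p - 1`, the relations of the fixed point and of the 2-cycle give t t′ = 1, so that
-- 2 a = t + 1/t + 1 and 2 p = t - 1/t - 1. Since s² = (a - 1)² - 1 and r² = p² + 1, clearing
-- denominators yields f₁ = (T² - T + 1)² - 4 T² = (T² + T + 1) (T² - 3 T + 1) and f₋₁ = (T² - T -
-- 1)² + 4 T². The factorisation of the one and the sum of squares of the other are where the
-- descents start.
--
-- Neither quartic suffices alone: for every rational t, the value f₁(t) has a square root in ℚ or
-- in some quadratic field. Only the two together, over the same d, are restrictive.
--
-- The three descents have one shape. Two coprime factorisations x y = r s of the same number split
-- into four pairwise coprime numbers, the remaining equation becomes a proportion between two
-- quadratic forms, and the common multiplier κ of the forms divides a small constant (15, 17 or
-- 75), which leaves few cases.

infixl 7 _⊛_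
infixl 6 _⊞_
infix 5 _≐_
infixr 4 _∨_
infixr 3 _⇒_

data Poly (n : ℕ) : Set where
  $_ : Fin n → Poly n
  #_ : ℕ → Poly n
  _⊞_ _⊛_ : Poly n → Poly n → Poly n

-- Implication and disjunction belong to the syntax, so that one finite check settles a deduction
-- from several congruences and not only an identity.
data Formula (n : ℕ) : Set where
  _≐_ : Poly n → Poly n → Formula n
  _⇒_ _∨_ : Formula n → Formula n → Formula n
  false : Formula n

value : ∀ {n} → Poly n → Vec ℕ n → ℕ
value ($ i) ρ = lookup ρ i
value (# c) ρ = c
value (e ⊞ f) ρ = value e ρ + value f ρ
value (e ⊛ f) ρ = value e ρ * value f ρ

module Modular (m : ℕ) .{{_ : NonZero m}} where

  Holds : ∀ {n} → Formula n → Vec ℕ n → Set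
  Holds (e ≐ f) ρ = value e ρ % m ≡ value f ρ % m
  Holds (F ⇒ G) ρ = Holds F ρ → Holds G ρ
  Holds (F ∨ G) ρ = Holds F ρ ⊎ Holds G ρ
  Holds false ρ = ⊥

  holds? : ∀ {n} (F : Formula n) ρ → Dec (Holds F ρ)
  holds? (e ≐ f) ρ = (value e ρ % m) ≟ (value f ρ % m)
  holds? (F ⇒ G) ρ = holds? F ρ →-dec holds? G ρ
  holds? (F ∨ G) ρ = holds? F ρ ⊎-dec holds? G ρ
  holds? false ρ = no λ ()

  OnResidues : ∀ n → (Vec ℕ n → Set) → Set
  OnResidues zero P = P []
  OnResidues (suc n) P = ∀ (i : Fin m) → OnResidues n (λ ρ → P (toℕ i ∷ ρ))

  onResidues? : ∀ n {P} → (∀ ρ → Dec (P ρ)) → Dec (OnResidues n P)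
  onResidues? zero P? = P? []
  onResidues? (suc n) P? = all? λ i → onResidues? n (λ ρ → P? (toℕ i ∷ ρ))

  residues : ∀ {n} → Vec ℕ n → Vec ℕ n
  residues = Vec.map (_% m)

  atResidues : ∀ n {P} → OnResidues n P → ∀ ρ → P (residues ρ)
  atResidues zero h [] = h
  atResidues (suc n) {P} h (x ∷ ρ) = subst (λ r → P (r ∷ residues ρ)) (toℕ-fromℕ< (m%n<n x m))
    (atResidues n (h (x mod m)) ρ)

  value-residues : ∀ {n} (e : Poly n) ρ → value e (residues ρ) % m ≡ value e ρ % m
  value-residues ($ i) ρ = lookup-residues i ρ
    where
    lookup-residues : ∀ {n} (i : Fin n) ρ → lookup (residues ρ) i % m ≡ lookup ρ i % m
    lookup-residues zero (x ∷ ρ) = m%n%n≡m%n x m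
    lookup-residues (suc i) (x ∷ ρ) = lookup-residues i ρ
  value-residues (# c) ρ = refl
  value-residues (e ⊞ f) ρ = trans (%-distribˡ-+ (value e (residues ρ)) _ m)
    (trans (cong₂ (λ x y → (x + y) % m) (value-residues e ρ) (value-residues f ρ))
      (sym (%-distribˡ-+ (value e ρ) _ m)))
  value-residues (e ⊛ f) ρ = trans (%-distribˡ-* (value e (residues ρ)) _ m)
    (trans (cong₂ (λ x y → (x * y) % m) (value-residues e ρ) (value-residues f ρ))
      (sym (%-distribˡ-* (value e ρ) _ m)))

  -- The two directions are mutual because the premise of an implication travels the opposite way.
  lift : ∀ {n} (F : Formula n) ρ → Holds F (residues ρ) → Holds F ρ
  lower : ∀ {n} (F : Formula n) ρ → Holds F ρ → Holds F (residues ρ)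
  lift (e ≐ f) ρ h = trans (sym (value-residues e ρ)) (trans h (value-residues f ρ))
  lift (F ⇒ G) ρ h x = lift G ρ (h (lower F ρ x))
  lift (F ∨ G) ρ = map (lift F ρ) (lift G ρ)
  lower (e ≐ f) ρ h = trans (value-residues e ρ) (trans h (sym (value-residues f ρ)))
  lower (F ⇒ G) ρ h x = lower G ρ (h (lift F ρ x))
  lower (F ∨ G) ρ = map (lower F ρ) (lower G ρ)

  valid : ∀ n (F : Formula n) {_ : True (onResidues? n (holds? F))} ρ → Holds F ρ
  valid n F {t} ρ = lift F ρ (atResidues n (toWitness t) ρ)

module Mod8 = Modular 8
module Mod3 = Modular 3

pattern v0 = $ zero
pattern v1 = $ (suc zero)
pattern v2 = $ (suc (suc zero))
pattern v3 = $ (suc (suc (suc zero)))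

-- Parity is always used through squares modulo 8.
Odd : ℕ → Set
Odd n = n * n % 8 ≡ 1

isOdd : ∀ {n} → Fin n → Formula n
isOdd i = $ i ⊛ $ i ≐ # 1

even-or-odd : ∀ n → Odd n ⊎ ∃ λ k → n ≡ 2 * k
even-or-odd n with n % 2 | m%n<n n 2 | m≡m%n+[m/n]*n n 2
... | 0 | _ | e = inj₂ (n / 2 , trans e (*-comm (n / 2) 2))
... | 1 | _ | e = inj₁ (trans (cong (λ x → x * x % 8) e)
  (Mod8.valid 1 ((# 1 ⊞ v0 ⊛ # 2) ⊛ (# 1 ⊞ v0 ⊛ # 2) ≐ # 1) (n / 2 ∷ [])))
... | suc (suc _) | s≤s (s≤s ()) | _

odd-*ˡ : ∀ m n → Odd (m * n) → Odd m
odd-*ˡ m n = Mod8.valid 2 ((v0 ⊛ v1) ⊛ (v0 ⊛ v1) ≐ # 1 ⇒ isOdd zero) (m ∷ n ∷ [])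

odd-*ʳ : ∀ m n → Odd (m * n) → Odd n
odd-*ʳ m n o = odd-*ˡ n m (subst Odd (*-comm m n) o)

¬odd-double : ∀ k → ¬ Odd (2 * k)
¬odd-double k = Mod8.valid 1 ((# 2 ⊛ v0) ⊛ (# 2 ⊛ v0) ≐ # 1 ⇒ false) (k ∷ [])

-- Coprimality.

coprime-∣ : ∀ {m n m′ n′} → Coprime m n → m′ ∣ m → n′ ∣ n → Coprime m′ n′
coprime-∣ c p q (u , v) = c (∣-trans u p , ∣-trans v q)

coprime-*ʳ : ∀ {k m n} → Coprime k m → Coprime k n → Coprime k (m * n)
coprime-*ʳ c c′ {i} (i∣k , i∣mn) = c′ (i∣k , coprime-divisor (coprime-∣ c i∣k ∣-refl) i∣mn)

coprime-*ˡ : ∀ {k m n} → Coprime m k → Coprime n k → Coprime (m * n) k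
coprime-*ˡ c c′ = Coprimality.sym (coprime-*ʳ (Coprimality.sym c) (Coprimality.sym c′))

coprime-sq : ∀ {m n} → Coprime m n → Coprime (m * m) (n * n)
coprime-sq c = coprime-*ʳ (coprime-*ˡ c c) (coprime-*ˡ c c)

prime-coprime : ∀ {p} n → Prime p → ¬ p ∣ n → Coprime p n
prime-coprime n pp p∤n (i∣p , i∣n) with prime⇒irreducible pp i∣p
... | inj₁ i≡1 = i≡1
... | inj₂ refl = contradiction i∣n p∤n

∣-square : ∀ {p} n → Prime p → p ∣ n * n → p ∣ n
∣-square n pp h = reduce (euclidsLemma n n pp h)

cofactors-coprime : ∀ {m n b c} .{{_ : NonZero (gcd m n)}} → m ≡ b * gcd m n → n ≡ c * gcd m n → Coprime b c
cofactors-coprime {m} {n} {b} {c} m≡ n≡ {i} (divides u ui , divides w wi) =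
  ∣1⇒≡1 (*-cancelˡ-∣ g (subst (g * i ∣_) (sym (*-identityʳ g))
    (gcd-greatest (divides u (trans m≡ (trans (cong (_* g) ui) (l u i g))))
                  (divides w (trans n≡ (trans (cong (_* g) wi) (l w i g)))))))
  where
  g = gcd m n
  l : ∀ u i g → u * i * g ≡ u * (g * i)
  l = solve-∀

-- If mn = rs, take a = gcd(m, r).
record FourFactors (m n r s : ℕ) : Set where
  constructor four
  field
    a b c d : ℕ
    m≡ : m ≡ a * b
    n≡ : n ≡ c * d
    r≡ : r ≡ a * c
    s≡ : s ≡ b * d
    a⊥b : Coprime a b
    a⊥c : Coprime a c
    a⊥d : Coprime a d
    b⊥c : Coprime b c
    b⊥d : Coprime b d
    c⊥d : Coprime c d

-- Dividing by the gcd leaves b n = c s with b and c coprime, so c divides n, and the quotient is d.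
-- Each pair of factors is coprime because its members divide m and n, or r and s, or are the
-- cofactors b and c.
four-factors : ∀ {m n r s} → r ≢ 0 → m * n ≡ r * s → Coprime m n → Coprime r s → FourFactors m n r s
four-factors {m} {n} {r} {s} r≢0 eq m⊥n r⊥s = go (gcd[m,n]∣m m r) (gcd[m,n]∣n m r)
  where
  g = gcd m r
  g≢0 : g ≢ 0
  g≢0 e = r≢0 (gcd[m,n]≡0⇒n≡0 m e)
  instance
    g-nonZero : NonZero g
    g-nonZero = ≢-nonZero g≢0
  go : g ∣ m → g ∣ r → FourFactors m n r s
  go (divides b m≡) (divides c r≡) = go′ (coprime-divisor (Coprimality.sym b⊥c)
      (divides s (trans bn≡cs (*-comm c s))))
    where
    b⊥c : Coprime b c
    b⊥c = cofactors-coprime m≡ r≡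
    bn≡cs : b * n ≡ c * s
    bn≡cs = *-cancelˡ-≡ _ _ g (trans (sym (*-assoc g b n)) (trans (cong (_* n) (trans (*-comm g b) (sym m≡)))
      (trans eq (trans (cong (_* s) (trans r≡ (*-comm c g))) (*-assoc g c s)))))
    go′ : c ∣ n → FourFactors m n r s
    go′ (divides d n≡) = record
      { a = g ; b = b ; c = c ; d = d
      ; m≡ = trans m≡ (*-comm b g) ; n≡ = trans n≡ (*-comm d c) ; r≡ = trans r≡ (*-comm c g) ; s≡ = s≡
      ; a⊥b = coprime-∣ r⊥s g∣r b∣s ; a⊥c = coprime-∣ m⊥n g∣m c∣n ; a⊥d = coprime-∣ m⊥n g∣m d∣n
      ; b⊥c = b⊥c ; b⊥d = coprime-∣ m⊥n b∣m d∣n ; c⊥d = coprime-∣ r⊥s c∣r d∣s }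
      where
      l : ∀ b d c → b * (d * c) ≡ c * (b * d)
      l = solve-∀
      g∣m = divides b m≡
      g∣r = divides c r≡
      b∣m = divides g (trans m≡ (*-comm b g))
      c∣r = divides g (trans r≡ (*-comm c g))
      c∣n = divides d n≡
      d∣n = divides c (trans n≡ (*-comm d c))
      s≡ : s ≡ b * d
      s≡ = *-cancelˡ-≡ _ _ c {{≢-nonZero λ { refl → r≢0 r≡ }}} (trans (sym bn≡cs) (trans (cong (b *_) n≡) (l b d c)))
      b∣s = divides d (trans s≡ (*-comm b d))
      d∣s = divides b s≡

-- With g = gcd(x, z), x = b g and z = c g, the equation becomes b y = g c². Here b divides g
-- because it is coprime to c, and g divides b because it divides x and so is coprime to y. Hence b
-- = g.
square-split : ∀ {x y z} → z ≢ 0 → Coprime x y → x * y ≡ z * z →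
  ∃ λ m → ∃ λ n → x ≡ m * m × y ≡ n * n × z ≡ m * n
square-split {x} {y} {z} z≢0 x⊥y eq = go (gcd[m,n]∣m x z) (gcd[m,n]∣n x z)
  where
  g = gcd x z
  instance
    g-nonZero : NonZero g
    g-nonZero = ≢-nonZero λ e → z≢0 (gcd[m,n]≡0⇒n≡0 x e)
  go : g ∣ x → g ∣ z → ∃ λ m → ∃ λ n → x ≡ m * m × y ≡ n * n × z ≡ m * n
  go (divides b x≡) (divides c z≡) = g , c , trans x≡ (cong (_* g) b≡g) , y≡ , trans z≡ (*-comm c g)
    where
    b⊥c : Coprime b c
    b⊥c = cofactors-coprime x≡ z≡
    by≡ : b * y ≡ g * (c * c)
    by≡ = *-cancelˡ-≡ _ _ g (trans (l₁ g b y) (trans (cong (_* y) (sym x≡))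
        (trans eq (trans (cong₂ _*_ z≡ z≡) (l₂ c g)))))
      where
      l₁ : ∀ g b y → g * (b * y) ≡ b * g * y
      l₁ = solve-∀
      l₂ : ∀ c g → c * g * (c * g) ≡ g * (g * (c * c))
      l₂ = solve-∀
    b∣g : b ∣ g
    b∣g = coprime-divisor (coprime-*ʳ b⊥c b⊥c) (divides y (trans (*-comm (c * c) g) (trans (sym by≡) (*-comm b y))))
    g∣b : g ∣ b
    g∣b = coprime-divisor (coprime-∣ x⊥y (divides b x≡) ∣-refl)
      (divides (c * c) (trans (*-comm y b) (trans by≡ (*-comm g (c * c)))))
    b≡g : b ≡ g
    b≡g = ∣-antisym b∣g g∣b
    y≡ : y ≡ c * c
    y≡ = *-cancelˡ-≡ _ _ g (trans (cong (_* y) (sym b≡g)) by≡)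

-- Coprime factors of a prime times a square, and Pythagorean equations.

OneOrPrime : ℕ → Set
OneOrPrime k = k ≡ 1 ⊎ Prime k

data Split (k x y z : ℕ) : Set where
  left  : ∀ m n → z ≡ m * n → x ≡ k * (m * m) → y ≡ n * n → Split k x y z
  right : ∀ m n → z ≡ m * n → x ≡ n * n → y ≡ k * (m * m) → Split k x y z

prime-split : ∀ {k x y z} → OneOrPrime k → z ≢ 0 → Coprime x y → x * y ≡ k * (z * z) → Split k x y z
prime-split (inj₁ refl) z≢0 x⊥y eq =
  let m , n , x≡ , y≡ , z≡ = square-split z≢0 x⊥y (trans eq (*-identityˡ _))
  in left m n z≡ (trans x≡ (sym (*-identityˡ _))) y≡
prime-split {k} {x} {y} {z} (inj₂ pk) z≢0 x⊥y eq
  with euclidsLemma x y pk (divides (z * z) (trans eq (*-comm k _)))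
... | inj₁ (divides w refl) =
  let m , n , x≡ , y≡ , z≡ = square-split z≢0 (coprime-∣ x⊥y (divides k (*-comm w k)) ∣-refl)
        (*-cancelˡ-≡ _ _ k {{prime⇒nonZero pk}} (trans (l k w y) eq))
  in left m n z≡ (trans (*-comm w k) (cong (k *_) x≡)) y≡
  where
  l : ∀ k w y → k * (w * y) ≡ w * k * y
  l = solve-∀
... | inj₂ (divides w refl) =
  let n , m , x≡ , y≡ , z≡ = square-split z≢0 (coprime-∣ x⊥y ∣-refl (divides k (*-comm w k)))
        (*-cancelˡ-≡ _ _ k {{prime⇒nonZero pk}} (trans (l k x w) eq))
  in right m n (trans z≡ (*-comm n m)) x≡ (trans (*-comm w k) (cong (k *_) y≡))
  where
  l : ∀ k x w → k * (x * w) ≡ x * (w * k)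
  l = solve-∀

-- The shape of the solutions of z² = u² + 4 k w². The factor k always stays with m, so it is
-- unknown which of k m² and n² is the larger; hence the alternative in `u±`.
record Pythagorean (k u w z : ℕ) : Set where
  constructor pythagorean
  field
    m n : ℕ
    w≡ : w ≡ m * n
    z≡ : z ≡ k * (m * m) + n * n
    m⊥n : Coprime m n
    u± : u + k * (m * m) ≡ n * n ⊎ u + n * n ≡ k * (m * m)

excess : ∀ u {z c} → z * z ≡ u * u + c → ∃ λ e → z ≡ u + e × e * (2 * u + e) ≡ c
excess u {z} {c} eq = z ∸ u , sym z≡ ,
  +-cancelˡ-≡ (u * u) _ _ (trans (l u (z ∸ u)) (trans (cong (λ x → x * x) z≡) eq))
  where
  z≡ : u + (z ∸ u) ≡ z
  z≡ = m+[n∸m]≡n {u} (≮⇒≥ λ z<u → <⇒≱ (*-mono-< z<u z<u) (subst (u * u ≤_) (sym eq) (m≤m+n _ _)))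
  l : ∀ u e → u * u + e * (2 * u + e) ≡ (u + e) * (u + e)
  l = solve-∀

-- Modulo 8 the difference z - u is even. Its half x satisfies x (u + x) = k w² with coprime
-- factors, to which `prime-split` applies.
pythagorean-param : ∀ {k u w z} → OneOrPrime k → Odd u → w ≢ 0 → Coprime u w → Coprime u k →
  z * z ≡ u * u + 4 * (k * (w * w)) → Pythagorean k u w z
pythagorean-param {k} {u} {w} {z} k-ok odd w≢0 u⊥w u⊥k eq = go (excess u eq)
  where
  go : (∃ λ e → z ≡ u + e × e * (2 * u + e) ≡ 4 * (k * (w * w))) → Pythagorean k u w z
  go (e , z≡ , eq) with even-or-odd e
  ... | inj₁ e-odd = ⊥-elim (Mod8.valid 3 (isOdd zero ⇒ v0 ⊛ (# 2 ⊛ v1 ⊞ v0) ≐ # 4 ⊛ v2 ⇒ false)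
    (e ∷ u ∷ k * (w * w) ∷ []) e-odd (cong (_% 8) eq))
  ... | inj₂ (x , refl) = finish (prime-split k-ok w≢0 x⊥y xy≡)
    where
    xy≡ : x * (u + x) ≡ k * (w * w)
    xy≡ = *-cancelˡ-≡ _ _ 4 (trans (l x u) eq)
      where
      l : ∀ x u → 4 * (x * (u + x)) ≡ 2 * x * (2 * u + 2 * x)
      l = solve-∀
    x⊥y : Coprime x (u + x)
    x⊥y {i} (i∣x , i∣y) = coprime-*ʳ u⊥k (coprime-*ʳ u⊥w u⊥w)
      (∣m+n∣m⇒∣n (subst (i ∣_) (+-comm u x) i∣y) i∣x , subst (i ∣_) xy≡ (∣m⇒∣m*n (u + x) i∣x))
    finish : Split k x (u + x) w → Pythagorean k u w z
    finish (left m n w≡ refl y≡) = pythagorean m n w≡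
      (trans z≡ (trans (l u (k * (m * m))) (cong (k * (m * m) +_) y≡)))
      (λ {i} (p , q) → x⊥y (∣n⇒∣m*n k (∣m⇒∣m*n m p) , subst (i ∣_) (sym y≡) (∣m⇒∣m*n n q))) (inj₁ y≡)
      where
      l : ∀ u x → u + 2 * x ≡ x + (u + x)
      l = solve-∀
    finish (right m n w≡ refl y≡) = pythagorean m n w≡
      (trans z≡ (trans (l u (n * n)) (cong (_+ n * n) y≡)))
      (λ {i} (p , q) → x⊥y (∣m⇒∣m*n n q , subst (i ∣_) (sym y≡) (∣n⇒∣m*n k (∣m⇒∣m*n m p)))) (inj₂ y≡)
      where
      l : ∀ u x → u + 2 * x ≡ u + x + x
      l = solve-∀

-- In the descents p and q are quadratic forms in two coprime variables. Combinations that eliminate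
-- one variable then show that κ divides a constant.
proportional : ∀ {b c p q} → c ≢ 0 → Coprime b c → b * b * p ≡ c * c * q →
  ∃ λ κ → p ≡ κ * (c * c) × q ≡ κ * (b * b)
proportional {b} {c} {p} {q} c≢0 b⊥c eq
  with coprime-divisor (Coprimality.sym (coprime-sq b⊥c)) (divides q (trans eq (*-comm (c * c) q)))
... | divides κ p≡ = κ , p≡ , sym (*-cancelˡ-≡ _ _ c {{≢-nonZero c≢0}} (*-cancelˡ-≡ _ _ c {{≢-nonZero c≢0}}
  (trans (l b c κ) (trans (trans (cong (b * b *_) (sym p≡)) eq) (*-assoc c c q)))))
  where
  l : ∀ b c κ → c * (c * (κ * (b * b))) ≡ b * b * (κ * (c * c))
  l = solve-∀

cancel : ∀ {x y p q} → p ≡ q → x + p ≡ y + q → x ≡ y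
cancel {x} {y} {p} refl = +-cancelʳ-≡ p x y

divisor-check : ∀ n .{{_ : NonZero n}} {P : ℕ → Set} (P? : ∀ i → Dec (P i))
  {_ : True (all? {suc n} λ i → (toℕ i ∣? n) →-dec P? (toℕ i))} → ∀ {κ} → κ ∣ n → P κ
divisor-check n {P} P? {t} κ∣n = subst P eq (toWitness t (fromℕ< κ<) (subst (_∣ n) (sym eq) κ∣n))
  where
  κ< = s≤s (∣⇒≤ κ∣n)
  eq = toℕ-fromℕ< κ<

-- The measure of the descents: the old variable is an even number 2 w, and the new one divides w.
proper-divisor : ∀ {d w} → 2 * w ≢ 0 → d ∣ w → d < 2 * w
proper-divisor {d} {zero} ne _ = ⊥-elim (ne refl)
proper-divisor {d} {suc w} _ d∣w = ≤-<-trans (∣⇒≤ d∣w) (m<m+n (suc w) (s≤s z≤n))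

odd⇒coprime-4 : ∀ {n} → Odd n → Coprime 4 n
odd⇒coprime-4 {n} o {i} (i∣4 , divides q refl) = cases (divisor-check 4 (λ i → (i % 2 ≟ 0) ⊎-dec (i ≟ 1)) i∣4)
  where
  cases : i % 2 ≡ 0 ⊎ i ≡ 1 → i ≡ 1
  cases (inj₁ e) = ⊥-elim (¬odd-double (i / 2) (subst Odd
    (trans (m≡m%n+[m/n]*n i 2) (trans (cong (_+ i / 2 * 2) e) (*-comm (i / 2) 2))) (odd-*ʳ q i o)))
  cases (inj₂ e) = e

coprime-summand : ∀ {u x y z} → Coprime z u → z * z ≡ x + u * y → ∀ {i} → i ∣ x → i ∣ u → i ≡ 1
coprime-summand {u} {x} {y} {z} z⊥u eq {i} i∣x i∣u =
  coprime-*ˡ z⊥u z⊥u (subst (i ∣_) (sym eq) (∣m∣n⇒∣m+n i∣x (∣m⇒∣m*n y i∣u)) , i∣u)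

-- For k = 1 the two alternatives of `u±` differ by an exchange of m and n, so n² may be taken as
-- the larger square.
pythagorean-triple : ∀ {u w z} → Odd u → w ≢ 0 → Coprime u w → z * z ≡ u * u + 4 * (w * w) →
  ∃ λ m → ∃ λ n → w ≡ m * n × z ≡ m * m + n * n × Coprime m n × u + m * m ≡ n * n
pythagorean-triple {u} {w} odd w≢0 u⊥w eq
  with pythagorean-param {1} (inj₁ refl) odd w≢0 u⊥w (λ (_ , d) → ∣1⇒≡1 d) (trans eq (l u w))
  where
  l : ∀ u w → u * u + 4 * (w * w) ≡ u * u + 4 * (1 * (w * w))
  l = solve-∀
... | pythagorean m n w≡ z≡ m⊥n (inj₁ e) = m , n , w≡ , trans z≡ (cong (_+ n * n) (*-identityˡ _)) , m⊥n ,
  trans (cong (u +_) (sym (*-identityˡ _))) e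
... | pythagorean m n w≡ z≡ m⊥n (inj₂ e) = n , m , trans w≡ (*-comm m n) ,
  trans z≡ (trans (cong (_+ n * n) (*-identityˡ _)) (+-comm (m * m) _)) , Coprimality.sym m⊥n ,
  trans e (*-identityˡ _)

quarter : ∀ {h} x y → 4 * h ≡ x * y → Odd x → ∃ λ q → y ≡ q * 4 × h ≡ x * q
quarter {h} x y e x-odd with coprime-divisor {4} {x} {y} (odd⇒coprime-4 x-odd) (subst (4 ∣_) e (m∣m*n h))
... | divides q refl = q , refl , *-cancelˡ-≡ _ _ 4 (trans e (l x q))
  where
  l : ∀ x q → x * (q * 4) ≡ 4 * (x * q)
  l = solve-∀

-- Descent for t² + w² and 16 t² + w².

record Smaller-1-4 (y : ℕ) : Set where
  constructor smaller
  field
    a b c d : ℕ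
    d∣y : d ∣ y
    a-odd : Odd a
    d⊥a : Coprime d a
    c² : c * c ≡ a * a + d * d
    b² : b * b ≡ a * a + 16 * (d * d)

-- With x = a b, y = c d, n = a c and m = b d the equation reads b² (a² + d²) = c² (a² + 16 d²). So
-- a² + d² = κ c² and a² + 16 d² = κ b². Here κ divides 15 a² and 15 d², hence 15, and 1 is the only
-- divisor of 15 that is 1 modulo 8.
legs-1-4-step : ∀ {m n x y} → m * n ≢ 0 → m * n ≡ x * y → Odd x → Coprime m n → Coprime x y →
  x * x + m * m ≡ n * n + 16 * (y * y) → Smaller-1-4 y
legs-1-4-step {m} {n} {x} {y} mn≢0 mn≡xy x-odd m⊥n x⊥y eq =
  step (four-factors {x} {y} {n} {m} (λ n≡0 → mn≢0 (trans (cong (m *_) n≡0) (*-zeroʳ m)))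
    (trans (sym mn≡xy) (*-comm m n)) x⊥y (Coprimality.sym m⊥n))
  where
  step : FourFactors x y n m → Smaller-1-4 y
  step (four a b c d refl refl refl refl a⊥b a⊥c a⊥d b⊥c b⊥d c⊥d) =
    scale (proportional {b} {c} {a * a + d * d} {a * a + 16 * (d * d)} c≢0 b⊥c
      (trans (l₁ a b d) (trans eq (l₂ a c d))))
    where
    l₁ : ∀ a b d → b * b * (a * a + d * d) ≡ a * b * (a * b) + b * d * (b * d)
    l₁ = solve-∀
    l₂ : ∀ a c d → a * c * (a * c) + 16 * (c * d * (c * d)) ≡ c * c * (a * a + 16 * (d * d))
    l₂ = solve-∀
    c≢0 : c ≢ 0
    c≢0 refl = mn≢0 (trans mn≡xy (*-zeroʳ (a * b)))
    a-odd = odd-*ˡ a b x-odd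
    b-odd = odd-*ʳ a b x-odd
    scale : (∃ λ κ → a * a + d * d ≡ κ * (c * c) × a * a + 16 * (d * d) ≡ κ * (b * b)) → Smaller-1-4 (c * d)
    scale (κ , p , q) = smaller a b c d (n∣m*n c) a-odd (Coprimality.sym a⊥d) (unscale c p) (unscale b q)
      where
      κ∣p : κ ∣ a * a + d * d
      κ∣p = divides (c * c) (trans p (*-comm κ _))
      κ∣q : κ ∣ a * a + 16 * (d * d)
      κ∣q = divides (b * b) (trans q (*-comm κ _))
      κ∣15 : κ ∣ 15
      κ∣15 = coprime-factors (coprime-sq a⊥d)
        ( ∣m+n∣m⇒∣n (subst (κ ∣_) (l a d) (∣n⇒∣m*n 16 κ∣p)) κ∣q
        , ∣m+n∣m⇒∣n (subst (κ ∣_) (l′ a d) κ∣q) κ∣p )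
        where
        l : ∀ a d → 16 * (a * a + d * d) ≡ a * a + 16 * (d * d) + a * a * 15
        l = solve-∀
        l′ : ∀ a d → a * a + 16 * (d * d) ≡ a * a + d * d + d * d * 15
        l′ = solve-∀
      κ≡1 : κ ≡ 1
      κ≡1 = divisor-check 15 (λ i → (i % 8 ≟ 1) →-dec (i ≟ 1)) κ∣15
        (Mod8.valid 4 (isOdd zero ⇒ isOdd (suc zero) ⇒ v0 ⊛ v0 ⊞ # 16 ⊛ v2 ≐ v3 ⊛ (v1 ⊛ v1) ⇒ v3 ≐ # 1)
          (a ∷ b ∷ d * d ∷ κ ∷ []) a-odd b-odd (cong (_% 8) q))
      unscale : ∀ x {y} → y ≡ κ * (x * x) → x * x ≡ y
      unscale x e = sym (trans e (trans (cong (_* (x * x)) κ≡1) (*-identityˡ _)))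

-- Modulo 8, t is even; put t = 2 h. The two triples give h = m n, 4 h = x y and n² - m² = w = y² -
-- x². One of x and y is odd, so 4 divides the other, and replacing that one by its quarter leads to
-- `legs-1-4-step`.
no-legs-1-4 : ∀ {t} → Acc _<_ t → ∀ {w r s} → t ≢ 0 → Odd w → Coprime t w →
  r * r ≡ w * w + t * t → s * s ≡ w * w + 16 * (t * t) → ⊥
no-legs-1-4 {t} (acc rec) {w} {r} {s} t≢0 w-odd t⊥w r² s² = by-parity (even-or-odd t)
  where
  by-parity : Odd t ⊎ (∃ λ h → t ≡ 2 * h) → ⊥
  by-parity (inj₁ t-odd) = Mod8.valid 3 (isOdd (suc zero) ⇒ isOdd (suc (suc zero)) ⇒ v0 ⊛ v0 ≐ v1 ⊛ v1 ⊞ v2 ⊛ v2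
      ⇒ false)
    (r ∷ w ∷ t ∷ []) w-odd t-odd (cong (_% 8) r²)
  by-parity (inj₂ (h , refl)) = split (pythagorean-triple w-odd h≢0 w⊥h (trans r² (l₁ w h)))
    (pythagorean-triple w-odd 4h≢0 (coprime-*ʳ (Coprimality.sym (odd⇒coprime-4 w-odd)) w⊥h) (trans s² (l₂ w h)))
    where
    l₁ : ∀ w h → w * w + 2 * h * (2 * h) ≡ w * w + 4 * (h * h)
    l₁ = solve-∀
    l₂ : ∀ w h → w * w + 16 * (2 * h * (2 * h)) ≡ w * w + 4 * (4 * h * (4 * h))
    l₂ = solve-∀
    h≢0 : h ≢ 0
    h≢0 refl = t≢0 refl
    4h≢0 : 4 * h ≢ 0
    4h≢0 e = h≢0 (m*n≡0⇒m≡0 h 4 (trans (*-comm h 4) e))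
    w⊥h : Coprime w h
    w⊥h = Coprimality.sym (coprime-∣ t⊥w (n∣m*n 2) ∣-refl)
    descend : ∀ {m n x y} → h ≡ m * n → h ≡ x * y → Odd x → Coprime m n → Coprime x y →
      x * x + m * m ≡ n * n + 16 * (y * y) → ⊥
    descend {m} {n} {x} {y} h≡mn h≡xy x-odd m⊥n x⊥y eq =
      again (legs-1-4-step {m} {n} {x} {y} (h≢0 ∘ trans h≡mn) (trans (sym h≡mn) h≡xy) x-odd m⊥n x⊥y eq)
      where
      again : Smaller-1-4 y → ⊥
      again (smaller a b c d d∣y a-odd d⊥a c² b²) =
        no-legs-1-4 (rec (proper-divisor t≢0 d∣h)) {a} {c} {b} d≢0 a-odd d⊥a c² b²
        where
        d∣h : d ∣ h
        d∣h = subst (d ∣_) (sym h≡xy) (∣n⇒∣m*n x d∣y)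
        d≢0 : d ≢ 0
        d≢0 refl = h≢0 (0∣⇒≡0 d∣h)
    split : (∃ λ m → ∃ λ n → h ≡ m * n × r ≡ m * m + n * n × Coprime m n × w + m * m ≡ n * n) →
      (∃ λ x → ∃ λ y → 4 * h ≡ x * y × s ≡ x * x + y * y × Coprime x y × w + x * x ≡ y * y) → ⊥
    split (m , n , h≡ , _ , m⊥n , mn) (x , y , 4h≡ , _ , x⊥y , xy) = cases (even-or-odd x)
      where
      eq : n * n + x * x ≡ m * m + y * y
      eq = cancel {p = w + m * m + (y * y)} (cong₂ _+_ mn (sym xy)) (l w (m * m) (n * n) (x * x) (y * y))
        where
        l : ∀ w m n x y → n + x + (w + m + y) ≡ m + y + (n + (w + x))
        l = solve-∀
      l₅ : ∀ q → q * 4 * (q * 4) ≡ 16 * (q * q)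
      l₅ = solve-∀
      cases : Odd x ⊎ (∃ λ k → x ≡ 2 * k) → ⊥
      cases (inj₁ x-odd) with quarter {h} x y 4h≡ x-odd
      ... | q , refl , h≡xq = descend {n} {m} {x} {q} (trans h≡ (*-comm m n)) h≡xq x-odd (Coprimality.sym m⊥n)
        (coprime-∣ x⊥y ∣-refl (m∣m*n 4)) (trans (+-comm (x * x) _) (trans eq (cong (m * m +_) (l₅ q))))
      cases (inj₂ (k , x≡)) = cases′ (quarter {h} y x (trans 4h≡ (*-comm x y)) y-odd)
        where
        y-odd : Odd y
        y-odd = Mod8.valid 3 (isOdd zero ⇒ v0 ⊞ (# 2 ⊛ v1) ⊛ (# 2 ⊛ v1) ≐ v2 ⊛ v2 ⇒ isOdd (suc (suc zero)))
          (w ∷ k ∷ y ∷ []) w-odd (cong (_% 8) (trans (cong (λ x → w + x * x) (sym x≡)) xy))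
        cases′ : (∃ λ q → x ≡ q * 4 × h ≡ y * q) → ⊥
        cases′ (q , refl , h≡yq) = descend {m} {n} {y} {q} h≡ h≡yq y-odd m⊥n
            (Coprimality.sym (coprime-∣ x⊥y (m∣m*n 4) ∣-refl))
          (trans (+-comm (y * y) _) (trans (sym eq) (cong (n * n +_) (l₅ q))))

-- Descent for w² + t² and w² - 16 t².

-- Such an x is an odd square or 17 times an odd square, and 17 is 1 modulo 8.
odd-split-17 : ∀ {x y z} → z ≢ 0 → Odd x → Coprime x y → x * y ≡ 17 * (z * z) → x % 8 ≡ 1
odd-split-17 {x} {y} {z} z≢0 x-odd x⊥y eq = residue (prime-split (inj₂ (toWitness {a? = prime? 17} _)) z≢0 x⊥y eq)
  where
  residue : Split 17 x y z → x % 8 ≡ 1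
  residue (left m n _ refl _) = Mod8.valid 1 ((# 17 ⊛ (v0 ⊛ v0)) ⊛ (# 17 ⊛ (v0 ⊛ v0)) ≐ # 1 ⇒ # 17 ⊛ (v0 ⊛ v0) ≐
      # 1) (m ∷ []) x-odd
  residue (right m n _ refl _) = Mod8.valid 1 ((v0 ⊛ v0) ⊛ (v0 ⊛ v0) ≐ # 1 ⇒ v0 ⊛ v0 ≐ # 1) (n ∷ []) x-odd

-- Two residues of a modulo 8 collide. Substitution gives c² = b² + d², so d is even, and a² = b² +
-- 16 c². On the one hand a - 4 d and a + 4 d are coprime with product 17 b², so a - 4 d and hence a
-- are 1 modulo 8. On the other hand the triple (b, 4 c, a) gives a = m² + n² with m n = 2 c and c
-- odd, so a is 5 modulo 8.
no-17-multiples : ∀ {a b c d} → b ≢ 0 → Odd a → Odd b → Coprime a b → Coprime a d → Coprime b c →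
  a * a + d * d ≡ 17 * (c * c) → a * a ≡ 17 * (b * b) + 16 * (d * d) → ⊥
no-17-multiples {a} {b} {c} {d} b≢0 a-odd b-odd a⊥b a⊥d b⊥c p q = by-parity (even-or-odd d)
  where
  c² : c * c ≡ b * b + d * d
  c² = *-cancelˡ-≡ _ _ 17 (trans (sym p) (trans (cong (_+ d * d) q) (l (b * b) (d * d))))
    where
    l : ∀ b d → 17 * b + 16 * d + d ≡ 17 * (b + d)
    l = solve-∀
  a² : a * a ≡ b * b + 4 * (2 * c * (2 * c))
  a² = trans q (trans (l₁ (b * b) (d * d)) (trans (cong (λ x → b * b + 16 * x) (sym c²)) (l₂ b c)))
    where
    l₁ : ∀ b d → 17 * b + 16 * d ≡ b + 16 * (b + d)
    l₁ = solve-∀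
    l₂ : ∀ b c → b * b + 16 * (c * c) ≡ b * b + 4 * (2 * c * (2 * c))
    l₂ = solve-∀
  a⊥4 : Coprime a 4
  a⊥4 = Coprimality.sym (odd⇒coprime-4 a-odd)
  by-parity : Odd d ⊎ (∃ λ h → d ≡ 2 * h) → ⊥
  by-parity (inj₁ d-odd) = Mod8.valid 3 (isOdd (suc zero) ⇒ isOdd (suc (suc zero)) ⇒ v0 ⊛ v0 ≐ v1 ⊛ v1 ⊞ v2 ⊛ v2
      ⇒ false)
    (c ∷ b ∷ d ∷ []) b-odd d-odd (cong (_% 8) c²)
  by-parity (inj₂ (h , refl)) = contrast (pythagorean-triple b-odd 2c≢0 b⊥2c a²)
      (excess (4 * (2 * h)) (trans q (l (b * b) h)))
    where
    l : ∀ b h → 17 * b + 16 * (2 * h * (2 * h)) ≡ 4 * (2 * h) * (4 * (2 * h)) + 17 * b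
    l = solve-∀
    c-odd : Odd c
    c-odd = Mod8.valid 4 (isOdd (suc zero) ⇒ isOdd (suc (suc zero)) ⇒ v0 ⊛ v0 ≐ v1 ⊛ v1 ⊞ (# 2 ⊛ v3) ⊛ (# 2 ⊛ v3) ⇒
        v2 ⊛ v2 ⊞ (# 2 ⊛ v3) ⊛ (# 2 ⊛ v3) ≐ # 17 ⊛ (v0 ⊛ v0) ⇒ isOdd zero)
      (c ∷ b ∷ a ∷ h ∷ []) b-odd a-odd (cong (_% 8) c²) (cong (_% 8) p)
    2c≢0 : 2 * c ≢ 0
    2c≢0 e = ¬odd-double 0 (subst Odd (m*n≡0⇒m≡0 c 2 (trans (*-comm c 2) e)) c-odd)
    b⊥2c : Coprime b (2 * c)
    b⊥2c = coprime-*ʳ {m = 2} (coprime-∣ (Coprimality.sym (odd⇒coprime-4 b-odd)) ∣-refl (divides 2 refl)) b⊥c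
    contrast : (∃ λ m → ∃ λ n → 2 * c ≡ m * n × a ≡ m * m + n * n × Coprime m n × b + m * m ≡ n * n) →
      (∃ λ e → a ≡ 4 * (2 * h) + e × e * (2 * (4 * (2 * h)) + e) ≡ 17 * (b * b)) → ⊥
    contrast (m , n , 2c≡ , a≡ , _) (e , a≡′ , e-eq) = contradiction (trans (sym a≡5) a≡1) λ ()
      where
      e⊥ : Coprime e (4 * (2 * h))
      e⊥ (i∣e , i∣) = coprime-*ʳ a⊥4 a⊥d (subst (_ ∣_) (sym a≡′) (∣m∣n⇒∣m+n i∣ i∣e) , i∣)
      e-odd : Odd e
      e-odd = Mod8.valid 3 (isOdd zero ⇒ v0 ≐ # 4 ⊛ (# 2 ⊛ v1) ⊞ v2 ⇒ isOdd (suc (suc zero))) (a ∷ h ∷ e ∷ [])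
          a-odd (cong (_% 8) a≡′)
      e≡1 : e % 8 ≡ 1
      e≡1 = odd-split-17 b≢0 e-odd (λ {i} (i∣e , i∣) → coprime-*ʳ {m = 2}
          (coprime-∣ (Coprimality.sym (odd⇒coprime-4 e-odd)) ∣-refl (divides 2 refl)) e⊥
        (i∣e , ∣m+n∣m⇒∣n (subst (i ∣_) (+-comm (2 * (4 * (2 * h))) e) i∣) i∣e)) e-eq
      a≡1 : a % 8 ≡ 1
      a≡1 = Mod8.valid 3 (v0 ≐ # 4 ⊛ (# 2 ⊛ v1) ⊞ v2 ⇒ v2 ≐ # 1 ⇒ v0 ≐ # 1) (a ∷ h ∷ e ∷ []) (cong (_% 8) a≡′) e≡1
      a≡5 : a % 8 ≡ 5
      a≡5 = Mod8.valid 4 (v0 ≐ v1 ⊛ v1 ⊞ v2 ⊛ v2 ⇒ # 2 ⊛ v3 ≐ v1 ⊛ v2 ⇒ isOdd (suc (suc (suc zero))) ⇒ isOdd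
          zero ⇒ v0 ≐ # 5)
        (a ∷ m ∷ n ∷ c ∷ []) (cong (_% 8) a≡) (cong (_% 8) 2c≡) c-odd a-odd

record Smaller-17 (y : ℕ) : Set where
  constructor smaller
  field
    a b c d : ℕ
    d∣y : d ∣ y
    a-odd : Odd a
    d⊥a : Coprime d a
    c² : c * c ≡ a * a + d * d
    a² : a * a ≡ b * b + 16 * (d * d)

-- The four factors turn the equation into c² (a² - 16 d²) = b² (a² + d²), and κ divides 17.
-- Residues modulo 8 cannot tell κ = 17 from κ = 1, so the former needs `no-17-multiples`.
legs-17-step : ∀ {m n x y} → m * n ≢ 0 → m * n ≡ x * y → Odd x → Coprime m n → Coprime x y →
  n * n ≡ m * m + (x * x + 16 * (y * y)) → Smaller-17 y
legs-17-step {m} {n} {x} {y} mn≢0 mn≡xy x-odd m⊥n x⊥y eq =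
  step (four-factors {x} {y} {n} {m} (λ n≡0 → mn≢0 (trans (cong (m *_) n≡0) (*-zeroʳ m)))
    (trans (sym mn≡xy) (*-comm m n)) x⊥y (Coprimality.sym m⊥n))
  where
  step : FourFactors x y n m → Smaller-17 y
  step (four a b c d refl refl refl refl a⊥b a⊥c a⊥d b⊥c b⊥d c⊥d) =
    scale (proportional {b} {c} {a * a + d * d} {e} c≢0 b⊥c be)
    where
    c≢0 : c ≢ 0
    c≢0 refl = mn≢0 (trans mn≡xy (*-zeroʳ (a * b)))
    b≢0 : b ≢ 0
    b≢0 refl = mn≢0 (*-zeroˡ (a * c))
    a-odd = odd-*ˡ a b x-odd
    b-odd = odd-*ʳ a b x-odd
    instance
      cc-nonZero : NonZero (c * c)
      cc-nonZero = m*n≢0 c c {{≢-nonZero c≢0}} {{≢-nonZero c≢0}}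
    l : ∀ a b c d → b * d * (b * d) + (a * b * (a * b) + 16 * (c * d * (c * d))) ≡ c * c * (16 * (d * d)) + b *
        b * (a * a + d * d)
    l = solve-∀
    eq′ : c * c * (a * a) ≡ c * c * (16 * (d * d)) + b * b * (a * a + d * d)
    eq′ = trans (l′ a c) (trans eq (l a b c d))
      where
      l′ : ∀ a c → c * c * (a * a) ≡ a * c * (a * c)
      l′ = solve-∀
    -- This makes the truncated subtraction in `e` exact.
    16d²≤a² : 16 * (d * d) ≤ a * a
    16d²≤a² = *-cancelˡ-≤ (c * c) (subst (c * c * (16 * (d * d)) ≤_) (sym eq′) (m≤m+n _ _))
    e = a * a ∸ 16 * (d * d)
    a²≡ : 16 * (d * d) + e ≡ a * a
    a²≡ = m+[n∸m]≡n 16d²≤a²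
    be : b * b * (a * a + d * d) ≡ c * c * e
    be = +-cancelˡ-≡ (c * c * (16 * (d * d))) _ _ (trans (sym eq′) (trans (cong (c * c *_) (sym a²≡))
        (*-distribˡ-+ (c * c) _ e)))
    scale : (∃ λ κ → a * a + d * d ≡ κ * (c * c) × e ≡ κ * (b * b)) → Smaller-17 (c * d)
    scale (κ , p , q) = cases (prime⇒irreducible (toWitness {a? = prime? 17} _) κ∣17)
      where
      κ∣p : κ ∣ a * a + d * d
      κ∣p = divides (c * c) (trans p (*-comm κ _))
      κ∣q : κ ∣ e
      κ∣q = divides (b * b) (trans q (*-comm κ _))
      κ∣17 : κ ∣ 17
      κ∣17 = coprime-factors (coprime-sq a⊥d)
        ( subst (κ ∣_) (trans (l₁ (d * d) (a * a) e) (trans (cong (a * a * 16 +_) a²≡) (l₂ (a * a))))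
            (∣m∣n⇒∣m+n (∣n⇒∣m*n 16 κ∣p) κ∣q)
        , ∣m+n∣m⇒∣n (subst (κ ∣_) (trans (cong (_+ d * d) (sym a²≡)) (l₃ (d * d) e)) κ∣p) κ∣q )
        where
        l₁ : ∀ d a e → 16 * (a + d) + e ≡ a * 16 + (16 * d + e)
        l₁ = solve-∀
        l₂ : ∀ a → a * 16 + a ≡ a * 17
        l₂ = solve-∀
        l₃ : ∀ d e → 16 * d + e + d ≡ e + d * 17
        l₃ = solve-∀
      cases : κ ≡ 1 ⊎ κ ≡ 17 → Smaller-17 (c * d)
      cases (inj₁ refl) = smaller a b c d (n∣m*n c) a-odd (Coprimality.sym a⊥d) (trans (sym (*-identityˡ _)) (sym p))
        (trans (sym a²≡) (trans (+-comm _ e) (cong (_+ 16 * (d * d)) (trans q (*-identityˡ _)))))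
      cases (inj₂ refl) = ⊥-elim (no-17-multiples {a} {b} {c} {d} b≢0 a-odd b-odd a⊥b a⊥d b⊥c p
        (trans (sym a²≡) (trans (+-comm _ e) (cong (_+ 16 * (d * d)) q))))

-- Here w is a leg of one triple and the hypotenuse of the other: with t = 2 h, h = m n and 4 h = x
-- y, one gets n² - m² = w = x² + y². Again 4 divides the even one of x and y.
no-legs-17 : ∀ {t} → Acc _<_ t → ∀ {w r s} → t ≢ 0 → Odd w → Coprime t w →
  r * r ≡ w * w + t * t → w * w ≡ s * s + 16 * (t * t) → ⊥
no-legs-17 {t} (acc rec) {w} {r} {s} t≢0 w-odd t⊥w r² w² = by-parity (even-or-odd t)
  where
  s-odd : Odd s
  s-odd = Mod8.valid 3 (isOdd zero ⇒ v0 ⊛ v0 ≐ v1 ⊛ v1 ⊞ # 16 ⊛ v2 ⇒ isOdd (suc zero))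
    (w ∷ s ∷ t * t ∷ []) w-odd (cong (_% 8) w²)
  s⊥t : Coprime s t
  s⊥t {i} (i∣s , i∣t) = coprime-summand (Coprimality.sym t⊥w) (trans w² (cong (s * s +_) (l t))) (∣m⇒∣m*n s i∣s) i∣t
    where
    l : ∀ t → 16 * (t * t) ≡ t * (16 * t)
    l = solve-∀
  by-parity : Odd t ⊎ (∃ λ h → t ≡ 2 * h) → ⊥
  by-parity (inj₁ t-odd) = Mod8.valid 3 (isOdd (suc zero) ⇒ isOdd (suc (suc zero)) ⇒ v0 ⊛ v0 ≐ v1 ⊛ v1 ⊞ v2 ⊛ v2
      ⇒ false)
    (r ∷ w ∷ t ∷ []) w-odd t-odd (cong (_% 8) r²)
  by-parity (inj₂ (h , refl)) = split (pythagorean-triple w-odd h≢0 w⊥h (trans r² (l₁ w h)))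
    (pythagorean-triple s-odd 4h≢0 (coprime-*ʳ (Coprimality.sym (odd⇒coprime-4 s-odd)) s⊥h) (trans w² (l₂ s h)))
    where
    l₁ : ∀ w h → w * w + 2 * h * (2 * h) ≡ w * w + 4 * (h * h)
    l₁ = solve-∀
    l₂ : ∀ w h → w * w + 16 * (2 * h * (2 * h)) ≡ w * w + 4 * (4 * h * (4 * h))
    l₂ = solve-∀
    h≢0 : h ≢ 0
    h≢0 refl = t≢0 refl
    4h≢0 : 4 * h ≢ 0
    4h≢0 e = h≢0 (m*n≡0⇒m≡0 h 4 (trans (*-comm h 4) e))
    w⊥h : Coprime w h
    w⊥h = Coprimality.sym (coprime-∣ t⊥w (n∣m*n 2) ∣-refl)
    s⊥h : Coprime s h
    s⊥h = coprime-∣ s⊥t ∣-refl (n∣m*n 2)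
    descend : ∀ {m n x y} → h ≡ m * n → h ≡ x * y → Odd x → Coprime m n → Coprime x y →
      n * n ≡ m * m + (x * x + 16 * (y * y)) → ⊥
    descend {m} {n} {x} {y} h≡mn h≡xy x-odd m⊥n x⊥y eq =
      again (legs-17-step {m} {n} {x} {y} (h≢0 ∘ trans h≡mn) (trans (sym h≡mn) h≡xy) x-odd m⊥n x⊥y eq)
      where
      again : Smaller-17 y → ⊥
      again (smaller a b c d d∣y a-odd d⊥a c² a²) =
        no-legs-17 (rec (proper-divisor t≢0 d∣h)) {a} {c} {b} d≢0 a-odd d⊥a c² a²
        where
        d∣h : d ∣ h
        d∣h = subst (d ∣_) (sym h≡xy) (∣n⇒∣m*n x d∣y)
        d≢0 : d ≢ 0
        d≢0 refl = h≢0 (0∣⇒≡0 d∣h)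
    split : (∃ λ m → ∃ λ n → h ≡ m * n × r ≡ m * m + n * n × Coprime m n × w + m * m ≡ n * n) →
      (∃ λ x → ∃ λ y → 4 * h ≡ x * y × w ≡ x * x + y * y × Coprime x y × s + x * x ≡ y * y) → ⊥
    split (m , n , h≡ , _ , m⊥n , mn) (x , y , 4h≡ , w≡ , x⊥y , xy) = cases (even-or-odd x)
      where
      l₅ : ∀ q → q * 4 * (q * 4) ≡ 16 * (q * q)
      l₅ = solve-∀
      eq : n * n ≡ m * m + (x * x + y * y)
      eq = trans (sym mn) (trans (+-comm w _) (cong (m * m +_) w≡))
      cases : Odd x ⊎ (∃ λ k → x ≡ 2 * k) → ⊥
      cases (inj₁ x-odd) with quarter {h} x y 4h≡ x-odd
      ... | q , refl , h≡xq = descend {m} {n} {x} {q} h≡ h≡xq x-odd m⊥n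
        (coprime-∣ x⊥y ∣-refl (m∣m*n 4)) (trans eq (cong (λ y → m * m + (x * x + y)) (l₅ q)))
      cases (inj₂ (k , x≡)) = cases′ (quarter {h} y x (trans 4h≡ (*-comm x y)) y-odd)
        where
        y-odd : Odd y
        y-odd = Mod8.valid 3 (isOdd zero ⇒ v0 ⊞ (# 2 ⊛ v1) ⊛ (# 2 ⊛ v1) ≐ v2 ⊛ v2 ⇒ isOdd (suc (suc zero)))
          (s ∷ k ∷ y ∷ []) s-odd (cong (_% 8) (trans (cong (λ x → s + x * x) (sym x≡)) xy))
        cases′ : (∃ λ q → x ≡ q * 4 × h ≡ y * q) → ⊥
        cases′ (q , refl , h≡yq) = descend {m} {n} {y} {q} h≡ h≡yq y-odd m⊥n
            (Coprimality.sym (coprime-∣ x⊥y (m∣m*n 4) ∣-refl))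
          (trans eq (cong (m * m +_) (trans (+-comm _ (y * y)) (cong (y * y +_) (l₅ q)))))

-- Descent for u² + 5 v² and u² + 80 v².

5-prime : Prime 5
5-prime = toWitness {a? = prime? 5} _

record Smaller-5 (x : ℕ) : Set where
  constructor smaller
  field
    a b c d : ℕ
    a∣x : a ∣ x
    d-odd : Odd d
    a⊥d : Coprime a d
    5∤d : ¬ 5 ∣ d
    c² : c * c ≡ d * d + 5 * (a * a)
    b² : b * b ≡ d * d + 80 * (a * a)

-- The proportion is b² (5 a² + d²) = c² (80 a² + d²), and κ divides 75. Modulo 8 only κ = 1 and κ =
-- 25 remain, and the latter would make 5 divide d, hence n.
legs-5-step : ∀ {m n x y} → m * n ≢ 0 → m * n ≡ x * y → Odd y → ¬ 5 ∣ n → Coprime m n → Coprime x y →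
  5 * (m * m) + y * y ≡ 80 * (x * x) + n * n → Smaller-5 x
legs-5-step {m} {n} {x} {y} mn≢0 mn≡xy y-odd 5∤n m⊥n x⊥y eq =
  step (four-factors {m} {n} {x} {y} (λ x≡0 → mn≢0 (trans mn≡xy (cong (_* y) x≡0))) mn≡xy m⊥n x⊥y)
  where
  step : FourFactors m n x y → Smaller-5 x
  step (four a b c d refl refl refl refl a⊥b a⊥c a⊥d b⊥c b⊥d c⊥d) =
    scale (proportional {b} {c} {5 * (a * a) + d * d} {80 * (a * a) + d * d} c≢0 b⊥c
      (trans (l₁ a b d) (trans eq (l₂ a c d))))
    where
    l₁ : ∀ a b d → b * b * (5 * (a * a) + d * d) ≡ 5 * (a * b * (a * b)) + b * d * (b * d)
    l₁ = solve-∀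
    l₂ : ∀ a c d → 80 * (a * c * (a * c)) + c * d * (c * d) ≡ c * c * (80 * (a * a) + d * d)
    l₂ = solve-∀
    c≢0 : c ≢ 0
    c≢0 refl = mn≢0 (*-zeroʳ (a * b))
    b-odd = odd-*ˡ b d y-odd
    d-odd = odd-*ʳ b d y-odd
    5∤d : ¬ 5 ∣ d
    5∤d = 5∤n ∘ ∣n⇒∣m*n c
    scale : (∃ λ κ → 5 * (a * a) + d * d ≡ κ * (c * c) × 80 * (a * a) + d * d ≡ κ * (b * b)) → Smaller-5 (a * c)
    scale (κ , p , q) = cases (divisor-check 75 (λ i → (i % 8 ≟ 1) →-dec ((i ≟ 1) ⊎-dec (i ≟ 25))) κ∣75
        (Mod8.valid 4 (isOdd zero ⇒ isOdd (suc zero) ⇒ # 80 ⊛ v2 ⊞ v0 ⊛ v0 ≐ v3 ⊛ (v1 ⊛ v1) ⇒ v3 ≐ # 1)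
          (d ∷ b ∷ a * a ∷ κ ∷ []) d-odd b-odd (cong (_% 8) q)))
      where
      κ∣p : κ ∣ 5 * (a * a) + d * d
      κ∣p = divides (c * c) (trans p (*-comm κ _))
      κ∣q : κ ∣ 80 * (a * a) + d * d
      κ∣q = divides (b * b) (trans q (*-comm κ _))
      κ∣75 : κ ∣ 75
      κ∣75 = coprime-factors (coprime-sq a⊥d)
        ( ∣m+n∣m⇒∣n (subst (κ ∣_) (l (a * a) (d * d)) κ∣q) κ∣p
        , ∣m+n∣m⇒∣n (subst (κ ∣_) (l′ (a * a) (d * d)) (∣n⇒∣m*n 80 κ∣p)) (∣n⇒∣m*n 5 κ∣q) )
        where
        l : ∀ a d → 80 * a + d ≡ 5 * a + d + a * 75
        l = solve-∀
        l′ : ∀ a d → 80 * (5 * a + d) ≡ 5 * (80 * a + d) + d * 75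
        l′ = solve-∀
      cases : κ ≡ 1 ⊎ κ ≡ 25 → Smaller-5 (a * c)
      cases (inj₁ refl) = smaller a b c d (m∣m*n c) d-odd a⊥d 5∤d (unscale p) (unscale q)
        where
        unscale : ∀ {x y} → x + d * d ≡ 1 * y → y ≡ d * d + x
        unscale {x} e = trans (sym (*-identityˡ _)) (trans (sym e) (+-comm x _))
      cases (inj₂ refl) = ⊥-elim (5∤d (∣-square d 5-prime (∣m+n∣m⇒∣n
        (subst (5 ∣_) (sym p) (∣m⇒∣m*n (c * c) (divides {5} {25} 5 refl))) (m∣m*n (a * a)))))

-- The proportion is b² (5 a² + 16 d²) = c² (5 a² + d²), now with a and c odd. So κ is 5 modulo 8,
-- which among the divisors of 75 leaves only 5, and then 5 divides d and n.
legs-5-step-impossible : ∀ {m n x y} → m * n ≢ 0 → m * n ≡ x * y → Odd x → ¬ 5 ∣ n → Coprime m n → Coprime x y →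
  5 * (m * m) + 16 * (y * y) ≡ 5 * (x * x) + n * n → ⊥
legs-5-step-impossible {m} {n} {x} {y} mn≢0 mn≡xy x-odd 5∤n m⊥n x⊥y eq =
  step (four-factors {m} {n} {x} {y} (λ x≡0 → mn≢0 (trans mn≡xy (cong (_* y) x≡0))) mn≡xy m⊥n x⊥y)
  where
  step : FourFactors m n x y → ⊥
  step (four a b c d refl refl refl refl a⊥b a⊥c a⊥d b⊥c b⊥d c⊥d) =
    scale (proportional {b} {c} {5 * (a * a) + 16 * (d * d)} {5 * (a * a) + d * d} c≢0 b⊥c
      (trans (l₁ a b d) (trans eq (l₂ a c d))))
    where
    l₁ : ∀ a b d → b * b * (5 * (a * a) + 16 * (d * d)) ≡ 5 * (a * b * (a * b)) + 16 * (b * d * (b * d))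
    l₁ = solve-∀
    l₂ : ∀ a c d → 5 * (a * c * (a * c)) + c * d * (c * d) ≡ c * c * (5 * (a * a) + d * d)
    l₂ = solve-∀
    c≢0 : c ≢ 0
    c≢0 refl = mn≢0 (*-zeroʳ (a * b))
    scale : (∃ λ κ → 5 * (a * a) + 16 * (d * d) ≡ κ * (c * c) × 5 * (a * a) + d * d ≡ κ * (b * b)) → ⊥
    scale (κ , p , q) = 5∤n (∣n⇒∣m*n c (∣-square d 5-prime (∣m+n∣m⇒∣n
        (subst (5 ∣_) (sym q) (∣m⇒∣m*n (b * b) (subst (5 ∣_) (sym κ≡5) ∣-refl))) (m∣m*n (a * a)))))
      where
      κ∣p : κ ∣ 5 * (a * a) + 16 * (d * d)
      κ∣p = divides (c * c) (trans p (*-comm κ _))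
      κ∣q : κ ∣ 5 * (a * a) + d * d
      κ∣q = divides (b * b) (trans q (*-comm κ _))
      κ∣75 : κ ∣ 75
      κ∣75 = coprime-factors (coprime-sq a⊥d)
        ( ∣m+n∣m⇒∣n (subst (κ ∣_) (l (a * a) (d * d)) (∣n⇒∣m*n 16 κ∣q)) κ∣p
        , ∣m+n∣m⇒∣n (subst (κ ∣_) (l′ (a * a) (d * d)) (∣n⇒∣m*n 5 κ∣p)) (∣n⇒∣m*n 5 κ∣q) )
        where
        l : ∀ a d → 16 * (5 * a + d) ≡ 5 * a + 16 * d + a * 75
        l = solve-∀
        l′ : ∀ a d → 5 * (5 * a + 16 * d) ≡ 5 * (5 * a + d) + d * 75
        l′ = solve-∀
      κ≡5 : κ ≡ 5
      κ≡5 = divisor-check 75 (λ i → (i % 8 ≟ 5) →-dec (i ≟ 5)) κ∣75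
        (Mod8.valid 4 (isOdd zero ⇒ isOdd (suc zero) ⇒ # 5 ⊛ (v0 ⊛ v0) ⊞ # 16 ⊛ v2 ≐ v3 ⊛ (v1 ⊛ v1) ⇒ v3 ≐ # 5)
          (a ∷ c ∷ d * d ∷ κ ∷ []) (odd-*ˡ a c x-odd) (odd-*ʳ a c x-odd) (cong (_% 8) p))

-- Each parametrisation carries a sign. Opposite signs fail modulo 3; equal signs give 5 m² + y² = 5
-- x² + n² with 4 m n = x y, and only an x divisible by 4 leads to a smaller solution. The condition
-- that 5 does not divide u passes to n and from there to the new solution.
no-legs-5 : ∀ {v} → Acc _<_ v → ∀ {u r s} → v ≢ 0 → Odd u → Coprime v u → ¬ 5 ∣ u →
  r * r ≡ u * u + 5 * (v * v) → s * s ≡ u * u + 80 * (v * v) → ⊥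
no-legs-5 {v} (acc rec) {u} {r} {s} v≢0 u-odd v⊥u 5∤u r² s² = by-parity (even-or-odd v)
  where
  by-parity : Odd v ⊎ (∃ λ h → v ≡ 2 * h) → ⊥
  by-parity (inj₁ v-odd) = Mod8.valid 3 (isOdd (suc zero) ⇒ isOdd (suc (suc zero)) ⇒ v0 ⊛ v0 ≐ v1 ⊛ v1 ⊞ # 5 ⊛
      (v2 ⊛ v2) ⇒ false)
    (r ∷ u ∷ v ∷ []) u-odd v-odd (cong (_% 8) r²)
  by-parity (inj₂ (h , refl)) = split (pythagorean-param (inj₂ 5-prime) u-odd h≢0 u⊥h u⊥5 (trans r² (l₁ u h)))
    (pythagorean-param (inj₂ 5-prime) u-odd 4h≢0 (coprime-*ʳ (Coprimality.sym (odd⇒coprime-4 u-odd)) u⊥h) u⊥5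
        (trans s² (l₂ u h)))
    where
    l₁ : ∀ u h → u * u + 5 * (2 * h * (2 * h)) ≡ u * u + 4 * (5 * (h * h))
    l₁ = solve-∀
    l₂ : ∀ u h → u * u + 80 * (2 * h * (2 * h)) ≡ u * u + 4 * (5 * (4 * h * (4 * h)))
    l₂ = solve-∀
    h≢0 : h ≢ 0
    h≢0 refl = v≢0 refl
    4h≢0 : 4 * h ≢ 0
    4h≢0 e = h≢0 (m*n≡0⇒m≡0 h 4 (trans (*-comm h 4) e))
    u⊥h : Coprime u h
    u⊥h = Coprimality.sym (coprime-∣ v⊥u (n∣m*n 2) ∣-refl)
    u⊥5 : Coprime u 5
    u⊥5 = Coprimality.sym (prime-coprime u 5-prime 5∤u)
    split : Pythagorean 5 u h r → Pythagorean 5 u (4 * h) s → ⊥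
    split (pythagorean m n h≡ _ m⊥n ±₁) (pythagorean x y 4h≡ _ x⊥y ±₂) = signs ±₁ ±₂
      where
      mn≢0 : m * n ≢ 0
      mn≢0 = h≢0 ∘ trans h≡
      5∤n : ¬ 5 ∣ n
      5∤n 5∣n = 5∤u (5∣u ±₁)
        where
        5∣u : u + 5 * (m * m) ≡ n * n ⊎ u + n * n ≡ 5 * (m * m) → 5 ∣ u
        5∣u (inj₁ e) = ∣m+n∣m⇒∣n (subst (5 ∣_) (trans (sym e) (+-comm u _)) (∣m⇒∣m*n n 5∣n)) (m∣m*n (m * m))
        5∣u (inj₂ e) = ∣m+n∣m⇒∣n (subst (5 ∣_) (trans (sym e) (+-comm u _)) (m∣m*n (m * m))) (∣m⇒∣m*n n 5∣n)
      opposite : n * n + y * y ≡ 5 * (x * x) + 5 * (m * m) → ⊥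
      -- The four squares add up to 0 modulo 3, so none or exactly three of m, n, x, y are nonzero.
      -- Coprimality excludes the first case, and m n ≡ x y the second.
      opposite e = Mod3.valid 4 ((v0 ≐ # 0 ⇒ v1 ≐ # 0 ⇒ false) ⇒ (v2 ≐ # 0 ⇒ v3 ≐ # 0 ⇒ false) ⇒
          # 4 ⊛ (v0 ⊛ v1) ≐ v2 ⊛ v3 ⇒ v1 ⊛ v1 ⊞ v3 ⊛ v3 ≐ # 5 ⊛ (v2 ⊛ v2) ⊞ # 5 ⊛ (v0 ⊛ v0) ⇒ false)
        (m ∷ n ∷ x ∷ y ∷ []) (not-both m⊥n) (not-both x⊥y) (cong (_% 3) (trans (cong (4 *_) (sym h≡)) 4h≡))
            (cong (_% 3) e)
        where
        not-both : ∀ {m n} → Coprime m n → m % 3 ≡ 0 → n % 3 ≡ 0 → ⊥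
        not-both {m} {n} m⊥n p q = contradiction (m⊥n (m%n≡0⇒n∣m m 3 p , m%n≡0⇒n∣m n 3 q)) λ ()
      agree : 5 * (m * m) + y * y ≡ 5 * (x * x) + n * n → ⊥
      agree eq = cases (even-or-odd x)
        where
        cases : Odd x ⊎ (∃ λ k → x ≡ 2 * k) → ⊥
        cases (inj₁ x-odd) with quarter {h} x y 4h≡ x-odd
        ... | q , refl , h≡xq = legs-5-step-impossible {m} {n} {x} {q} mn≢0 (trans (sym h≡) h≡xq) x-odd 5∤n m⊥n
          (coprime-∣ x⊥y ∣-refl (m∣m*n 4)) (trans (cong (5 * (m * m) +_) (l q)) eq)
          where
          l : ∀ q → 16 * (q * q) ≡ q * 4 * (q * 4)
          l = solve-∀
        cases (inj₂ (k , x≡)) = cases′ (quarter {h} y x (trans 4h≡ (*-comm x y)) y-odd)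
          where
          y-odd : Odd y
          y-odd = ±⇒odd ±₂
            where
            ±⇒odd : u + 5 * (x * x) ≡ y * y ⊎ u + y * y ≡ 5 * (x * x) → Odd y
            ±⇒odd (inj₁ e) = Mod8.valid 3 (isOdd zero ⇒ v0 ⊞ # 5 ⊛ ((# 2 ⊛ v1) ⊛ (# 2 ⊛ v1)) ≐ v2 ⊛ v2 ⇒ isOdd
                (suc (suc zero)))
              (u ∷ k ∷ y ∷ []) u-odd (cong (_% 8) (trans (cong (λ x → u + 5 * (x * x)) (sym x≡)) e))
            ±⇒odd (inj₂ e) = Mod8.valid 3 (isOdd zero ⇒ v0 ⊞ v2 ⊛ v2 ≐ # 5 ⊛ ((# 2 ⊛ v1) ⊛ (# 2 ⊛ v1)) ⇒ isOdd
                (suc (suc zero)))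
              (u ∷ k ∷ y ∷ []) u-odd (cong (_% 8) (trans e (cong (λ x → 5 * (x * x)) x≡)))
          cases′ : (∃ λ q → x ≡ q * 4 × h ≡ y * q) → ⊥
          cases′ (q , refl , h≡yq) = again (legs-5-step {m} {n} {q} {y} mn≢0
              (trans (sym h≡) (trans h≡yq (*-comm y q))) y-odd 5∤n m⊥n
              (coprime-∣ x⊥y (m∣m*n 4) ∣-refl) (trans eq (cong (_+ n * n) (l q))))
            where
            l : ∀ q → 5 * (q * 4 * (q * 4)) ≡ 80 * (q * q)
            l = solve-∀
            again : Smaller-5 q → ⊥
            again (smaller a b c d a∣q d-odd a⊥d 5∤d c² b²) =
              no-legs-5 (rec (proper-divisor v≢0 a∣h)) {d} {c} {b} a≢0 d-odd a⊥d 5∤d c² b²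
              where
              a∣h : a ∣ h
              a∣h = subst (a ∣_) (sym h≡yq) (∣n⇒∣m*n y a∣q)
              a≢0 : a ≢ 0
              a≢0 refl = h≢0 (0∣⇒≡0 a∣h)
      signs : u + 5 * (m * m) ≡ n * n ⊎ u + n * n ≡ 5 * (m * m) → u + 5 * (x * x) ≡ y * y ⊎ u + y * y ≡ 5 *
          (x * x) → ⊥
      signs (inj₁ p) (inj₁ q) = agree (cancel {p = u + 5 * (x * x) + n * n} (cong₂ _+_ q (sym p))
          (l u (5 * (m * m)) (n * n) (5 * (x * x)) (y * y)))
        where
        l : ∀ u m n x y → m + y + (u + x + n) ≡ x + n + (y + (u + m))
        l = solve-∀
      signs (inj₂ p) (inj₂ q) = agree (cancel {p = u + n * n + 5 * (x * x)} (cong₂ _+_ p (sym q))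
          (l u (5 * (m * m)) (n * n) (5 * (x * x)) (y * y)))
        where
        l : ∀ u m n x y → m + y + (u + n + x) ≡ x + n + (m + (u + y))
        l = solve-∀
      signs (inj₁ p) (inj₂ q) = opposite (cancel {p = u + 5 * (m * m)} p
          (trans (l u (5 * (m * m)) (n * n) (y * y)) (cong (λ z → z + 5 * (m * m) + n * n) q)))
        where
        l : ∀ u m n y → n + y + (u + m) ≡ u + y + m + n
        l = solve-∀
      signs (inj₂ p) (inj₁ q) = opposite (cancel {p = u + 5 * (x * x)} q
          (trans (l u (5 * (x * x)) (n * n) (y * y)) (cong (λ z → 5 * (x * x) + z + y * y) p)))
        where
        l : ∀ u x n y → n + y + (u + x) ≡ x + (u + n) + y
        l = solve-∀

-- Two quartics in natural numbers.

halve-square : ∀ {p k} → p * p ≡ 4 * k → ∃ λ q → p ≡ 2 * q × q * q ≡ k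
halve-square {p} {k} e = by-parity (even-or-odd p)
  where
  by-parity : Odd p ⊎ (∃ λ q → p ≡ 2 * q) → ∃ λ q → p ≡ 2 * q × q * q ≡ k
  by-parity (inj₁ o) = ⊥-elim (Mod8.valid 2 (isOdd zero ⇒ v0 ⊛ v0 ≐ # 4 ⊛ v1 ⇒ false) (p ∷ k ∷ []) o (cong (_% 8) e))
  by-parity (inj₂ (q , refl)) = q , refl , *-cancelˡ-≡ _ _ 4 (trans (l q) e)
    where
    l : ∀ q → 4 * (q * q) ≡ 2 * q * (2 * q)
    l = solve-∀

coprime-odd : ∀ {m n} → Coprime m n → Odd m ⊎ Odd n
coprime-odd {m} {n} c with even-or-odd m | even-or-odd n
... | inj₁ o | _ = inj₁ o
... | _ | inj₁ o = inj₂ o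
... | inj₂ (h , m≡) | inj₂ (k , n≡) = contradiction (c (divides h (trans m≡ (*-comm 2 h)) , divides k
    (trans n≡ (*-comm 2 k)))) λ ()

coprime-difference : ∀ {a d e} → a * a ≡ d * d + e → Coprime a d → Coprime e (a * d)
coprime-difference {a} {d} {e} eq a⊥d = coprime-*ʳ e⊥a e⊥d
  where
  e⊥a : Coprime e a
  e⊥a {i} (i∣e , i∣a) = coprime-*ʳ a⊥d a⊥d (i∣a , ∣m+n∣m⇒∣n (subst (i ∣_) (trans eq (+-comm (d * d) e))
      (∣m⇒∣m*n a i∣a)) i∣e)
  e⊥d : Coprime e d
  e⊥d {i} (i∣e , i∣d) = coprime-*ˡ a⊥d a⊥d (subst (i ∣_) (sym eq) (∣m∣n⇒∣m+n (∣m⇒∣m*n d i∣d) i∣e) , i∣d)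

coprime-sum : ∀ {a d} → Coprime a d → Coprime (a * a + d * d) (a * d)
coprime-sum {a} {d} a⊥d = coprime-*ʳ s⊥a s⊥d
  where
  s⊥a : Coprime (a * a + d * d) a
  s⊥a (i∣s , i∣a) = coprime-*ʳ a⊥d a⊥d (i∣a , ∣m+n∣m⇒∣n i∣s (∣m⇒∣m*n a i∣a))
  s⊥d : Coprime (a * a + d * d) d
  s⊥d {i} (i∣s , i∣d) = coprime-*ˡ a⊥d a⊥d (∣m+n∣m⇒∣n (subst (i ∣_) (+-comm (a * a) _) i∣s) (∣m⇒∣m*n d i∣d) , i∣d)

-- Being coprime to v, e divides w; being coprime to f, w divides e.
exchange : ∀ {e f v w} → w ≢ 0 → e * f ≡ v * w → Coprime e v → Coprime f w → e ≡ w × f ≡ v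
exchange {e} {f} {v} {w} w≢0 eq e⊥v f⊥w = e≡w , f≡v
  where
  e≡w : e ≡ w
  e≡w = ∣-antisym (coprime-divisor e⊥v (subst (e ∣_) eq (m∣m*n f)))
    (coprime-divisor (Coprimality.sym f⊥w) (subst (w ∣_) (trans (sym eq) (*-comm e f)) (n∣m*n v)))
  f≡v : f ≡ v
  f≡v = *-cancelˡ-≡ _ _ w {{≢-nonZero w≢0}} (trans (cong (_* f) (sym e≡w)) (trans eq (*-comm v w)))

-- Exactly one of v and w is even, by residues modulo 8 and coprimality. If it is v = 2 t, then w² +
-- t² and w² + 16 t² are squares, which the first descent forbids.
no-legs-2-2 : ∀ {v w p q} → v * w ≢ 0 → Coprime v w →
  p * p ≡ v * v + 4 * (w * w) → q * q ≡ w * w + 4 * (v * v) → ⊥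
no-legs-2-2 {v} {w} {p} {q} vw≢0 v⊥w p² q² = by-parity (even-or-odd v) (even-or-odd w)
  where
  even : ∀ {t w p q} → t ≢ 0 → Odd w → Coprime (2 * t) w →
    p * p ≡ 2 * t * (2 * t) + 4 * (w * w) → q * q ≡ w * w + 4 * (2 * t * (2 * t)) → ⊥
  even {t} {w} {p} {q} t≢0 w-odd c p² q² = go (halve-square {p} {w * w + t * t} (trans p² (l t w)))
    where
    l : ∀ t w → 2 * t * (2 * t) + 4 * (w * w) ≡ 4 * (w * w + t * t)
    l = solve-∀
    l′ : ∀ t w → w * w + 4 * (2 * t * (2 * t)) ≡ w * w + 16 * (t * t)
    l′ = solve-∀
    go : (∃ λ r → p ≡ 2 * r × r * r ≡ w * w + t * t) → ⊥
    go (r , _ , r²) = no-legs-1-4 (<-wellFounded t) {w} {r} {q} t≢0 w-odd (coprime-∣ c (n∣m*n 2) ∣-refl) r²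
        (trans q² (l′ t w))
  by-parity : Odd v ⊎ (∃ λ h → v ≡ 2 * h) → Odd w ⊎ (∃ λ h → w ≡ 2 * h) → ⊥
  by-parity (inj₁ v-odd) (inj₁ w-odd) = Mod8.valid 3 (isOdd (suc zero) ⇒ isOdd (suc (suc zero)) ⇒ v0 ⊛ v0 ≐ v1 ⊛
      v1 ⊞ # 4 ⊛ (v2 ⊛ v2) ⇒ false)
    (p ∷ v ∷ w ∷ []) v-odd w-odd (cong (_% 8) p²)
  by-parity (inj₁ v-odd) (inj₂ (t , refl)) = even {t} {v} {q} {p} (λ { refl → vw≢0 (*-zeroʳ v) }) v-odd
      (Coprimality.sym v⊥w) q² p²
  by-parity (inj₂ (t , refl)) (inj₁ w-odd) = even {t} {w} {p} {q} (λ { refl → vw≢0 refl }) w-odd v⊥w p² q²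
  by-parity (inj₂ (t , refl)) (inj₂ (h , refl)) with coprime-odd v⊥w
  ... | inj₁ o = ¬odd-double t o
  ... | inj₂ o = ¬odd-double h o

-- The four factors turn the equation into (a² - d²) (c² - b²) = (a d) (b c). For d < a, coprimality
-- forces a² - d² = b c and c² - b² = a d. With v = a d and w = b c this gives (b² + c²)² = v² + 4
-- w² and (a² + d²)² = w² + 4 v². The case a < d is the same after exchanging a with d and b with c.
no-quartic-15 : ∀ {x y r s} → x * y ≢ 0 → Coprime x y → Coprime r s → x * y ≡ r * s →
  x * x + y * y + x * y ≡ r * r + s * s → ⊥
no-quartic-15 {x} {y} {r} {s} xy≢0 x⊥y r⊥s xy≡rs eq =
  step (four-factors {x} {y} {r} {s} (λ r≡0 → xy≢0 (trans xy≡rs (cong (_* s) r≡0))) xy≡rs x⊥y r⊥s)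
  where
  unequal : ∀ a b c d → d < a → a * d * (b * c) ≢ 0 → Coprime a d → Coprime c b → Coprime (a * d) (b * c) →
    a * b * (a * b) + c * d * (c * d) + a * d * (b * c) ≡ a * c * (a * c) + b * d * (b * d) → ⊥
  unequal a b c d d<a ne a⊥d c⊥b v⊥w eq = finish (exchange {e} {f} {a * d} {b * c} w≢0 ef
      (coprime-difference a² a⊥d) f⊥)
    where
    w≢0 : b * c ≢ 0
    w≢0 z = ne (trans (cong (a * d *_) z) (*-zeroʳ (a * d)))
    d²<a² = *-mono-< d<a d<a
    e = a * a ∸ d * d
    f = c * c ∸ b * b
    a² : a * a ≡ d * d + e
    a² = sym (m+[n∸m]≡n (<⇒≤ d²<a²))
    instance
      e-nonZero : NonZero e
      e-nonZero = >-nonZero (m<n⇒0<n∸m d²<a²)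
    eq′ : e * (b * b) + a * d * (b * c) ≡ e * (c * c)
    eq′ = cancel {p = d * d * (b * b) + d * d * (c * c)} refl
      (trans (l₁ (a * d * (b * c)) (b * b) (c * c) (d * d) e)
        (trans (cong (λ A → A * (b * b) + d * d * (c * c) + a * d * (b * c)) (sym a²))
          (trans (l₂ a b c d) (trans eq (trans (l₃ a b c d) (trans (cong (λ A → A * (c * c) + d * d * (b * b))
              a²) (l₄ (b * b) (c * c) (d * d) e)))))))
      where
      l₁ : ∀ k b c d e → e * b + k + (d * b + d * c) ≡ (d + e) * b + d * c + k
      l₁ = solve-∀
      l₂ : ∀ a b c d → a * a * (b * b) + d * d * (c * c) + a * d * (b * c) ≡ a * b * (a * b) + c * d * (c * d) +
          a * d * (b * c)
      l₂ = solve-∀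
      l₃ : ∀ a b c d → a * c * (a * c) + b * d * (b * d) ≡ a * a * (c * c) + d * d * (b * b)
      l₃ = solve-∀
      l₄ : ∀ b c d e → (d + e) * c + d * b ≡ e * c + (d * b + d * c)
      l₄ = solve-∀
    c² : c * c ≡ b * b + f
    c² = sym (m+[n∸m]≡n (*-cancelˡ-≤ e (subst (e * (b * b) ≤_) eq′ (m≤m+n _ _))))
    ef : e * f ≡ a * d * (b * c)
    ef = sym (+-cancelˡ-≡ (e * (b * b)) _ _ (trans eq′ (trans (cong (e *_) c²) (*-distribˡ-+ e _ f))))
    f⊥ : Coprime f (b * c)
    f⊥ = subst (Coprime f) (*-comm c b) (coprime-difference c² c⊥b)
    finish : e ≡ b * c × f ≡ a * d → ⊥
    finish (e≡ , f≡) = no-legs-2-2 {a * d} {b * c} {b * b + c * c} {a * a + d * d} ne v⊥w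
      (trans (cong (λ C → (b * b + C) * (b * b + C)) c²)
          (trans (l₁ (b * b) f) (trans (cong₂ (λ F C → F * F + 4 * (b * b * C)) f≡ (sym c²)) (l₂ (a * d) b c))))
      (trans (cong (λ A → (A + d * d) * (A + d * d)) a²)
          (trans (l₃ (d * d) e) (trans (cong₂ (λ E A → E * E + 4 * (d * d * A)) e≡ (sym a²))
          (trans (l₂ (b * c) d a) (cong (λ v → b * c * (b * c) + 4 * (v * v)) (*-comm d a))))))
      where
      l₁ : ∀ b f → (b + (b + f)) * (b + (b + f)) ≡ f * f + 4 * (b * (b + f))
      l₁ = solve-∀
      l₂ : ∀ v b c → v * v + 4 * (b * b * (c * c)) ≡ v * v + 4 * (b * c * (b * c))
      l₂ = solve-∀
      l₃ : ∀ d e → (d + e + d) * (d + e + d) ≡ e * e + 4 * (d * (d + e))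
      l₃ = solve-∀
  step : FourFactors x y r s → ⊥
  step (four a b c d refl refl refl refl a⊥b a⊥c a⊥d b⊥c b⊥d c⊥d) = by-order (<-cmp d a)
    where
    ne : a * d * (b * c) ≢ 0
    ne e = xy≢0 (trans (l a b c d) e)
      where
      l : ∀ a b c d → a * b * (c * d) ≡ a * d * (b * c)
      l = solve-∀
    v⊥w : Coprime (a * d) (b * c)
    v⊥w = coprime-*ˡ (coprime-*ʳ a⊥b a⊥c) (coprime-*ʳ (Coprimality.sym b⊥d) (Coprimality.sym c⊥d))
    by-order : Tri (d < a) (d ≡ a) (a < d) → ⊥
    by-order (tri< d<a _ _) = unequal a b c d d<a ne a⊥d (Coprimality.sym b⊥c) v⊥w (trans (l a b c d) eq)
      where
      l : ∀ a b c d → a * b * (a * b) + c * d * (c * d) + a * d * (b * c) ≡ a * b * (a * b) + c * d * (c * d) +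
          a * b * (c * d)
      l = solve-∀
    by-order (tri≈ _ refl _) = xy≢0 (+-cancelˡ-≡ (a * b * (a * b) + c * a * (c * a)) _ 0 (trans eq (l a b c)))
      where
      l : ∀ a b c → a * c * (a * c) + b * a * (b * a) ≡ a * b * (a * b) + c * a * (c * a) + 0
      l = solve-∀
    by-order (tri> _ _ a<d) = unequal d c b a a<d (ne ∘ trans (l₁ a b c d)) (Coprimality.sym a⊥d) b⊥c
        (subst₂ Coprime (*-comm a d) (*-comm b c) v⊥w)
        (trans (l₂ a b c d) (trans eq (l₃ a b c d)))
      where
      l₁ : ∀ a b c d → a * d * (b * c) ≡ d * a * (c * b)
      l₁ = solve-∀
      l₂ : ∀ a b c d → d * c * (d * c) + b * a * (b * a) + d * a * (c * b) ≡ a * b * (a * b) + c * d * (c * d) +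
          a * b * (c * d)
      l₂ = solve-∀
      l₃ : ∀ a b c d → a * c * (a * c) + b * d * (b * d) ≡ d * b * (d * b) + c * a * (c * a)
      l₃ = solve-∀

difference : ∀ m n → ∃ λ k → m ≡ n + k ⊎ n ≡ m + k
difference m n with ≤-total m n
... | inj₁ m≤n = n ∸ m , inj₂ (sym (m+[n∸m]≡n m≤n))
... | inj₂ n≤m = m ∸ n , inj₁ (sym (m+[n∸m]≡n n≤m))

-- With v = a d and w = b c, one has (b² + c²)² = v² + 4 w² and w² = 4 v² + (a² - d²)².
no-sums-17 : ∀ {a b c d} → a * d * (b * c) ≢ 0 → Coprime a d → Coprime b c → Coprime (a * d) (b * c) →
  a * a + d * d ≡ b * c → b * b ≡ c * c + a * d → ⊥
no-sums-17 {a} {b} {c} {d} ne a⊥d b⊥c v⊥w sum diff = go (difference (a * a) (d * d))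
  where
  v = a * d
  w = b * c
  p = b * b + c * c
  p² : p * p ≡ v * v + 4 * (w * w)
  p² = trans (cong (λ B → (B + c * c) * (B + c * c)) diff)
      (trans (l₁ (c * c) v) (trans (cong (λ B → v * v + 4 * (B * (c * c))) (sym diff)) (l₂ v b c)))
    where
    l₁ : ∀ c f → (c + f + c) * (c + f + c) ≡ f * f + 4 * ((c + f) * c)
    l₁ = solve-∀
    l₂ : ∀ v b c → v * v + 4 * (b * b * (c * c)) ≡ v * v + 4 * (b * c * (b * c))
    l₂ = solve-∀
  go : (∃ λ q → a * a ≡ d * d + q ⊎ d * d ≡ a * a + q) → ⊥
  go (q , q±) = by-parity (even-or-odd v)
    where
    w² : w * w ≡ q * q + 4 * (v * v)
    w² = trans (cong₂ _*_ (sym sum) (sym sum)) (square q±)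
      where
      l₁ : ∀ d q → (d + q + d) * (d + q + d) ≡ q * q + 4 * ((d + q) * d)
      l₁ = solve-∀
      l₂ : ∀ q a d → q * q + 4 * (a * a * (d * d)) ≡ q * q + 4 * (a * d * (a * d))
      l₂ = solve-∀
      l₃ : ∀ a q → (a + (a + q)) * (a + (a + q)) ≡ q * q + 4 * (a * (a + q))
      l₃ = solve-∀
      square : a * a ≡ d * d + q ⊎ d * d ≡ a * a + q → (a * a + d * d) * (a * a + d * d) ≡ q * q + 4 * (v * v)
      square (inj₁ e) = trans (cong (λ A → (A + d * d) * (A + d * d)) e)
          (trans (l₁ (d * d) q) (trans (cong (λ A → q * q + 4 * (A * (d * d))) (sym e)) (l₂ q a d)))
      square (inj₂ e) = trans (cong (λ D → (a * a + D) * (a * a + D)) e)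
          (trans (l₃ (a * a) q) (trans (cong (λ D → q * q + 4 * (a * a * D)) (sym e)) (l₂ q a d)))
    by-parity : Odd v ⊎ (∃ λ t → v ≡ 2 * t) → ⊥
    by-parity (inj₂ (t , v≡)) = even (halve-square {p} {w * w + t * t}
        (trans p² (trans (cong (λ v → v * v + 4 * (w * w)) v≡) (l t w))))
      where
      l : ∀ t w → 2 * t * (2 * t) + 4 * (w * w) ≡ 4 * (w * w + t * t)
      l = solve-∀
      l′ : ∀ q t → q * q + 4 * (2 * t * (2 * t)) ≡ q * q + 16 * (t * t)
      l′ = solve-∀
      t≢0 : t ≢ 0
      t≢0 refl = ne (cong (_* w) v≡)
      w-odd : Odd w
      w-odd = subst Odd sum (Mod8.valid 3 ((isOdd zero ∨ isOdd (suc zero)) ⇒ v0 ⊛ v1 ≐ # 2 ⊛ v2 ⇒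
        (v0 ⊛ v0 ⊞ v1 ⊛ v1) ⊛ (v0 ⊛ v0 ⊞ v1 ⊛ v1) ≐ # 1) (a ∷ d ∷ t ∷ []) (coprime-odd a⊥d) (cong (_% 8) v≡))
      even : (∃ λ r → p ≡ 2 * r × r * r ≡ w * w + t * t) → ⊥
      even (r , _ , r²) = no-legs-17 (<-wellFounded t) {w} {r} {q} t≢0 w-odd (coprime-∣ v⊥w (divides 2 v≡) ∣-refl) r²
        (trans w² (trans (cong (λ v → q * q + 4 * (v * v)) v≡) (l′ q t)))
    -- For odd v, p² = 4 q² + 17 v², and p - 2 q is 1 modulo 8 as a coprime factor of 17 v². Since 8
    -- divides q, p is 1 modulo 8. But p = b² + c² is odd and b c = a² + d² is 2 modulo 8, which
    -- makes p equal to 5 modulo 8.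
    by-parity (inj₁ v-odd) = contrast (excess (2 * q) p²′)
      where
      p²′ : p * p ≡ 2 * q * (2 * q) + 17 * (v * v)
      p²′ = trans p² (trans (cong (λ W → v * v + 4 * W) w²) (l v q))
        where
        l : ∀ v q → v * v + 4 * (q * q + 4 * (v * v)) ≡ 2 * q * (2 * q) + 17 * (v * v)
        l = solve-∀
      a-odd = odd-*ˡ a d v-odd
      d-odd = odd-*ʳ a d v-odd
      v≢0 : v ≢ 0
      v≢0 e = ne (cong (_* w) e)
      p-odd : Odd p
      p-odd = Mod8.valid 3 (isOdd (suc (suc zero)) ⇒ v0 ⊛ v0 ≐ v1 ⊛ v1 ⊞ v2 ⇒ (v0 ⊛ v0 ⊞ v1 ⊛ v1) ⊛
          (v0 ⊛ v0 ⊞ v1 ⊛ v1) ≐ # 1)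
        (b ∷ c ∷ v ∷ []) v-odd (cong (_% 8) diff)
      p≡5 : p % 8 ≡ 5
      p≡5 = Mod8.valid 4 (isOdd (suc (suc zero)) ⇒ isOdd (suc (suc (suc zero))) ⇒ v2 ⊛ v2 ⊞ v3 ⊛ v3 ≐ v0 ⊛ v1 ⇒ 
          (v0 ⊛ v0 ⊞ v1 ⊛ v1) ⊛ (v0 ⊛ v0 ⊞ v1 ⊛ v1) ≐ # 1 ⇒ v0 ⊛ v0 ⊞ v1 ⊛ v1 ≐ # 5)
        (b ∷ c ∷ a ∷ d ∷ []) a-odd d-odd (cong (_% 8) sum) p-odd
      q≡0 : q % 8 ≡ 0
      q≡0 = residue q±
        where
        residue : a * a ≡ d * d + q ⊎ d * d ≡ a * a + q → q % 8 ≡ 0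
        residue (inj₁ e) = Mod8.valid 3 (isOdd zero ⇒ isOdd (suc zero) ⇒ v0 ⊛ v0 ≐ v1 ⊛ v1 ⊞ v2 ⇒ v2 ≐ # 0)
          (a ∷ d ∷ q ∷ []) a-odd d-odd (cong (_% 8) e)
        residue (inj₂ e) = Mod8.valid 3 (isOdd zero ⇒ isOdd (suc zero) ⇒ v0 ⊛ v0 ≐ v1 ⊛ v1 ⊞ v2 ⇒ v2 ≐ # 0)
          (d ∷ a ∷ q ∷ []) d-odd a-odd (cong (_% 8) e)
      p⊥4 : Coprime p 4
      p⊥4 = Coprimality.sym (odd⇒coprime-4 p-odd)
      p⊥v : Coprime p v
      p⊥v {i} (i∣p , i∣v) = coprime-*ʳ {m = 4} (coprime-∣ p⊥4 i∣p ∣-refl) (coprime-*ʳ i⊥w i⊥w)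
          (∣-refl , ∣m+n∣m⇒∣n (subst (i ∣_) p² (∣m⇒∣m*n p i∣p)) (∣m⇒∣m*n v i∣v))
        where
        i⊥w : Coprime i w
        i⊥w = coprime-∣ v⊥w i∣v ∣-refl
      contrast : (∃ λ e → p ≡ 2 * q + e × e * (2 * (2 * q) + e) ≡ 17 * (v * v)) → ⊥
      contrast (e , p≡ , e-eq) = contradiction (trans (sym p≡5) p≡1) λ ()
        where
        e-odd : Odd e
        e-odd = Mod8.valid 3 (isOdd zero ⇒ v0 ≐ # 2 ⊛ v1 ⊞ v2 ⇒ v1 ≐ # 0 ⇒ isOdd (suc (suc zero)))
            (p ∷ q ∷ e ∷ []) p-odd (cong (_% 8) p≡) q≡0
        e⊥q : Coprime e q
        -- A common divisor i also divides p, so it is coprime to v, while i² divides p² - 4 q² = 17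
        -- v².
        e⊥q {i} (i∣e , i∣q) = root (divisor-check 17 (λ k → (k ≟ 1) ⊎-dec (k ≟ 17)) i²∣17)
          where
          i∣p : i ∣ p
          i∣p = subst (i ∣_) (sym p≡) (∣m∣n⇒∣m+n (∣n⇒∣m*n 2 i∣q) i∣e)
          i²∣17 : i * i ∣ 17
          i²∣17 = coprime-divisor {n = v * v} (coprime-sq (coprime-∣ p⊥v i∣p ∣-refl)) (∣m+n∣m⇒∣n
            (subst (i * i ∣_) (trans p²′ (cong (2 * q * (2 * q) +_) (*-comm 17 (v * v)))) (*-pres-∣ i∣p i∣p))
                (*-pres-∣ (∣n⇒∣m*n 2 i∣q) (∣n⇒∣m*n 2 i∣q)))
          root : i * i ≡ 1 ⊎ i * i ≡ 17 → i ≡ 1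
          root (inj₁ h) = m*n≡1⇒m≡1 i i h
          root (inj₂ h) = ⊥-elim (Mod3.valid 1 (v0 ⊛ v0 ≐ # 17 ⇒ false) (i ∷ []) (cong (_% 3) h))
        e⊥2 : Coprime e 2
        e⊥2 = coprime-∣ (Coprimality.sym (odd⇒coprime-4 e-odd)) ∣-refl (divides 2 refl)
        e≡1 : e % 8 ≡ 1
        e≡1 = odd-split-17 v≢0 e-odd (λ {i} (i∣e , i∣) → coprime-*ʳ {m = 2} e⊥2 (coprime-*ʳ {m = 2} e⊥2 e⊥q)
          (i∣e , ∣m+n∣m⇒∣n (subst (i ∣_) (+-comm (2 * (2 * q)) e) i∣) i∣e)) e-eq
        p≡1 : p % 8 ≡ 1
        p≡1 = Mod8.valid 3 (v0 ≐ # 2 ⊛ v1 ⊞ v2 ⇒ v1 ≐ # 0 ⇒ v2 ≐ # 1 ⇒ v0 ≐ # 1) (p ∷ q ∷ e ∷ [])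
            (cong (_% 8) p≡) q≡0 e≡1

-- Here δ is |x² - x y - y²|. Parametrising the triple gives a second factorisation x y = m n, and
-- the four factors turn the equation into (a² + d²) (b² - c²) = (a d) (b c). By `exchange`, a² + d²
-- = b c and b² - c² = a d, which `no-sums-17` refutes.
no-quartic-17 : ∀ {x y δ z} → x * y ≢ 0 → Coprime x y →
  x * x ≡ y * y + x * y + δ ⊎ x * x + δ ≡ y * y + x * y → z * z ≡ δ * δ + 4 * (x * y * (x * y)) → ⊥
no-quartic-17 {x} {y} {δ} {z} xy≢0 x⊥y δ± z² = solve (pythagorean-triple δ-odd xy≢0 (δ⊥xy δ±) z²)
  where
  δ-odd : Odd δ
  δ-odd = residue δ±
    where
    residue : x * x ≡ y * y + x * y + δ ⊎ x * x + δ ≡ y * y + x * y → Odd δ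
    residue (inj₁ e) = Mod8.valid 3 ((isOdd zero ∨ isOdd (suc zero)) ⇒ v0 ⊛ v0 ≐ v1 ⊛ v1 ⊞ v0 ⊛ v1 ⊞ v2 ⇒ isOdd
        (suc (suc zero)))
      (x ∷ y ∷ δ ∷ []) (coprime-odd x⊥y) (cong (_% 8) e)
    residue (inj₂ e) = Mod8.valid 3 ((isOdd zero ∨ isOdd (suc zero)) ⇒ v0 ⊛ v0 ⊞ v2 ≐ v1 ⊛ v1 ⊞ v0 ⊛ v1 ⇒ isOdd
        (suc (suc zero)))
      (x ∷ y ∷ δ ∷ []) (coprime-odd x⊥y) (cong (_% 8) e)
  l₁ : ∀ x y δ → y * y + x * y + δ ≡ x * y + δ + y * y
  l₁ = solve-∀
  l₂ : ∀ x y → y * y + x * y ≡ x * y + y * y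
  l₂ = solve-∀
  δ⊥xy : x * x ≡ y * y + x * y + δ ⊎ x * x + δ ≡ y * y + x * y → Coprime δ (x * y)
  δ⊥xy (inj₁ e) = coprime-*ʳ
    (λ {i} (i∣δ , i∣x) → coprime-*ʳ x⊥y x⊥y (i∣x , ∣m+n∣m⇒∣n (subst (i ∣_) (trans e (l₁ x y δ)) (∣m⇒∣m*n x i∣x))
        (∣m∣n⇒∣m+n (∣m⇒∣m*n y i∣x) i∣δ)))
    (λ {i} (i∣δ , i∣y) → coprime-*ˡ x⊥y x⊥y
        (subst (i ∣_) (sym e) (∣m∣n⇒∣m+n (∣m∣n⇒∣m+n (∣m⇒∣m*n y i∣y) (∣n⇒∣m*n x i∣y)) i∣δ) , i∣y))
  δ⊥xy (inj₂ e) = coprime-*ʳ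
    (λ {i} (i∣δ , i∣x) → coprime-*ʳ x⊥y x⊥y (i∣x , ∣m+n∣m⇒∣n (subst (i ∣_) (trans e (l₂ x y))
        (∣m∣n⇒∣m+n (∣m⇒∣m*n x i∣x) i∣δ)) (∣m⇒∣m*n y i∣x)))
    (λ {i} (i∣δ , i∣y) → coprime-*ˡ x⊥y x⊥y (∣m+n∣m⇒∣n (subst (i ∣_) (trans (sym e) (+-comm (x * x) δ))
        (∣m∣n⇒∣m+n (∣m⇒∣m*n y i∣y) (∣n⇒∣m*n x i∣y))) i∣δ , i∣y))
  -- The Pythagorean legs are δ = |m² - n²| and 2 x y = 2 m n.
  factor : ∀ {m n} → Coprime m n → x * y ≡ m * n → x * x + n * n ≡ y * y + x * y + m * m → ⊥
  factor {m} {n} m⊥n xy≡mn eq = step (four-factors {x} {y} {m} {n}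
      (λ m≡0 → xy≢0 (trans xy≡mn (cong (_* n) m≡0))) xy≡mn x⊥y m⊥n)
    where
    step : FourFactors x y m n → ⊥
    step (four a b c d refl refl refl refl a⊥b a⊥c a⊥d b⊥c b⊥d c⊥d) =
      finish (exchange {a * a + d * d} {f} {a * d} {b * c} w≢0 sf (coprime-sum a⊥d) (coprime-difference b² b⊥c))
      where
      ne : a * d * (b * c) ≢ 0
      ne e = xy≢0 (trans (l a b c d) e)
        where
        l : ∀ a b c d → a * b * (c * d) ≡ a * d * (b * c)
        l = solve-∀
      w≢0 : b * c ≢ 0
      w≢0 e = ne (trans (cong (a * d *_) e) (*-zeroʳ (a * d)))
      s = a * a + d * d
      s≢0 : s ≢ 0
      s≢0 e = ne (cong (λ a → a * d * (b * c)) (reduce (m*n≡0⇒m≡0∨n≡0 a (m+n≡0⇒m≡0 (a * a) e))))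
      instance
        s-nonZero : NonZero s
        s-nonZero = ≢-nonZero s≢0
      eq′ : s * (b * b) ≡ s * (c * c) + a * d * (b * c)
      eq′ = trans (l₃ a b d) (trans eq (l₄ a b c d))
        where
        l₃ : ∀ a b d → (a * a + d * d) * (b * b) ≡ a * b * (a * b) + b * d * (b * d)
        l₃ = solve-∀
        l₄ : ∀ a b c d → c * d * (c * d) + a * b * (c * d) + a * c * (a * c) ≡ (a * a + d * d) * (c * c) + a * d
            * (b * c)
        l₄ = solve-∀
      f = b * b ∸ c * c
      b² : b * b ≡ c * c + f
      b² = sym (m+[n∸m]≡n (*-cancelˡ-≤ s (subst (s * (c * c) ≤_) (sym eq′) (m≤m+n _ _))))
      sf : s * f ≡ a * d * (b * c)
      sf = +-cancelˡ-≡ (s * (c * c)) _ _ (trans (sym (*-distribˡ-+ s _ f)) (trans (cong (s *_) (sym b²)) eq′))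
      finish : s ≡ b * c × f ≡ a * d → ⊥
      finish (s≡ , f≡) = no-sums-17 {a} {b} {c} {d} ne a⊥d b⊥c
        (coprime-*ˡ (coprime-*ʳ a⊥b a⊥c) (coprime-*ʳ (Coprimality.sym b⊥d) (Coprimality.sym c⊥d)))
        s≡ (trans b² (cong (c * c +_) f≡))
  solve : (∃ λ m → ∃ λ n → x * y ≡ m * n × z ≡ m * m + n * n × Coprime m n × δ + m * m ≡ n * n) → ⊥
  solve (m , n , xy≡ , _ , m⊥n , δ≡) = orient δ±
    where
    orient : x * x ≡ y * y + x * y + δ ⊎ x * x + δ ≡ y * y + x * y → ⊥
    orient (inj₁ e) = factor {n} {m} (Coprimality.sym m⊥n) (trans xy≡ (*-comm m n))
      (trans (cong (_+ m * m) e) (trans (+-assoc (y * y + x * y) δ (m * m)) (cong (y * y + x * y +_) δ≡)))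
    orient (inj₂ e) = factor {m} {n} m⊥n xy≡
      (trans (cong (x * x +_) (sym δ≡)) (trans (sym (+-assoc (x * x) δ (m * m))) (cong (_+ m * m) e)))

open import Data.Integer.Base using (ℤ; +_; -[1+_]; +[1+_]; ∣_∣)


-- Integer points.

valueℤ : ∀ {n} → Poly n → Vec ℕ n → ℤ
valueℤ ($ i) ρ = + lookup ρ i
valueℤ (# c) ρ = + c
valueℤ (e ⊞ f) ρ = valueℤ e ρ Z.+ valueℤ f ρ
valueℤ (e ⊛ f) ρ = valueℤ e ρ Z.* valueℤ f ρ

value-pos : ∀ {n} (e : Poly n) ρ → + value e ρ ≡ valueℤ e ρ
value-pos ($ i) ρ = refl
value-pos (# c) ρ = refl
value-pos (e ⊞ f) ρ = trans (Z.pos-+ (value e ρ) _) (cong₂ Z._+_ (value-pos e ρ) (value-pos f ρ))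
value-pos (e ⊛ f) ρ = trans (Z.pos-* (value e ρ) _) (cong₂ Z._*_ (value-pos e ρ) (value-pos f ρ))

-- The passage from signed identities, where subtraction is available, to ℕ, where the descents
-- live.
natural : ∀ {n} (e f : Poly n) ρ → valueℤ e ρ ≡ valueℤ f ρ → value e ρ ≡ value f ρ
natural e f ρ h = Z.+-injective (trans (value-pos e ρ) (trans h (sym (value-pos f ρ))))

square-abs : ∀ i → i Z.* i ≡ + ∣ i ∣ Z.* + ∣ i ∣
square-abs (+ n) = refl
square-abs -[1+ n ] = refl

product-sign : ∀ i j → i Z.* j ≡ + ∣ i ∣ Z.* + ∣ j ∣ ⊎ i Z.* j ≡ Z.- (+ ∣ i ∣ Z.* + ∣ j ∣)
product-sign (+ m) (+ n) = inj₁ refl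
product-sign (+ m) -[1+ n ] = inj₂ (sym (Z.neg-distribʳ-* (+ m) +[1+ n ]))
product-sign -[1+ m ] (+ n) = inj₂ (sym (Z.neg-distribˡ-* +[1+ m ] (+ n)))
product-sign -[1+ m ] -[1+ n ] = inj₁ refl

abs-sign : ∀ i → i ≡ + ∣ i ∣ ⊎ i ≡ Z.- (+ ∣ i ∣)
abs-sign (+ n) = inj₁ refl
abs-sign -[1+ n ] = inj₂ refl

4*-nonneg : ∀ i {k} → + 4 Z.* i ≡ + k → i ≡ + ∣ i ∣
4*-nonneg (+ n) _ = refl

cofactor-nonneg : ∀ {n} j {k} → n ≢ 0 → + n Z.* j ≡ + k → j ≡ + ∣ j ∣
cofactor-nonneg (+ m) _ _ = refl
cofactor-nonneg {zero} -[1+ m ] n≢0 _ = ⊥-elim (n≢0 refl)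

-- F₁ and F₂ are the homogeneous forms of f₁ and f₋₁. The factors N and M come from F₁ = (X² - X Y +
-- Y²)² - (2 X Y)².
N M F₁ F₂ : ℤ → ℤ → ℤ
N X Y = X Z.* X Z.+ X Z.* Y Z.+ Y Z.* Y
M X Y = X Z.* X Z.- + 3 Z.* (X Z.* Y) Z.+ Y Z.* Y
F₁ X Y = N X Y Z.* M X Y
F₂ X Y = X Z.* X Z.* X Z.* X Z.- + 2 Z.* (X Z.* X Z.* X Z.* Y) Z.+ + 3 Z.* (X Z.* X Z.* Y Z.* Y) Z.+ + 2 Z.*
    (X Z.* Y Z.* Y Z.* Y) Z.+ Y Z.* Y Z.* Y Z.* Y

-- The absolute values of N and M in terms of x = |X| and y = |Y|, for X Y ≥ 0 and X Y ≤ 0 respectively.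
data AbsForms (x y n m : ℕ) : Set where
  same     : n ≡ x * x + y * y + x * y → m + 3 * (x * y) ≡ x * x + y * y → AbsForms x y n m
  opposite : n + x * y ≡ x * x + y * y → m ≡ x * x + y * y + 3 * (x * y) → AbsForms x y n m

module Forms (X Y : ℤ) (X≢0 : ∣ X ∣ ≢ 0) (Y≢0 : ∣ Y ∣ ≢ 0) (X⊥Y : Coprime ∣ X ∣ ∣ Y ∣) {k : ℕ}
    (F₁≥0 : F₁ X Y ≡ + k) where
  x = ∣ X ∣
  y = ∣ Y ∣
  n = ∣ N X Y ∣
  m = ∣ M X Y ∣

  xy≢0 : x * y ≢ 0
  xy≢0 e with m*n≡0⇒m≡0∨n≡0 x e
  ... | inj₁ z = X≢0 z
  ... | inj₂ z = Y≢0 z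

  N≡ : N X Y ≡ + n
  N≡ = 4*-nonneg (N X Y) {t * t + 3 * (y * y)}
      (trans (l X Y) (trans (cong₂ (λ a b → a Z.+ + 3 Z.* b) (square-abs T) (square-abs Y))
      (sym (value-pos (v0 ⊛ v0 ⊞ # 3 ⊛ (v1 ⊛ v1)) (t ∷ y ∷ [])))))
    where
    T = + 2 Z.* X Z.+ Y
    t = ∣ T ∣
    l : ∀ X Y → + 4 Z.* (X Z.* X Z.+ X Z.* Y Z.+ Y Z.* Y) ≡ (+ 2 Z.* X Z.+ Y) Z.* (+ 2 Z.* X Z.+ Y) Z.+ + 3 Z.*
        (Y Z.* Y)
    l = ℤ-Solver.solve-∀

  private
    X² = + x Z.* + x
    Y² = + y Z.* + y
    XY = + x Z.* + y

    squares : ∀ c P → P ≡ X Z.* Y → X Z.* X Z.+ c Z.* (X Z.* Y) Z.+ Y Z.* Y ≡ X² Z.+ c Z.* P Z.+ Y²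
    squares c P e = cong₂ Z._+_ (cong₂ (λ a b → a Z.+ c Z.* b) (square-abs X) (sym e)) (square-abs Y)

  N-shape : n ≡ x * x + y * y + x * y ⊎ n + x * y ≡ x * x + y * y
  N-shape with product-sign X Y
  ... | inj₁ e = inj₁ (natural v0 (v1 ⊛ v1 ⊞ v2 ⊛ v2 ⊞ v1 ⊛ v2) (n ∷ x ∷ y ∷ [])
    (trans (sym N≡) (trans (l₀ X Y) (trans (squares (+ 1) XY (sym e)) (l X² XY Y²)))))
    where
    l₀ : ∀ X Y → X Z.* X Z.+ X Z.* Y Z.+ Y Z.* Y ≡ X Z.* X Z.+ + 1 Z.* (X Z.* Y) Z.+ Y Z.* Y
    l₀ = ℤ-Solver.solve-∀
    l : ∀ a b c → a Z.+ + 1 Z.* b Z.+ c ≡ a Z.+ c Z.+ b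
    l = ℤ-Solver.solve-∀
  ... | inj₂ e = inj₂ (natural (v0 ⊞ v1 ⊛ v2) (v1 ⊛ v1 ⊞ v2 ⊛ v2) (n ∷ x ∷ y ∷ [])
    (trans (cong (Z._+ XY) (trans (sym N≡) (trans (l₀ X Y) (squares (+ 1) (Z.- XY) (sym e))))) (l X² XY Y²)))
    where
    l₀ : ∀ X Y → X Z.* X Z.+ X Z.* Y Z.+ Y Z.* Y ≡ X Z.* X Z.+ + 1 Z.* (X Z.* Y) Z.+ Y Z.* Y
    l₀ = ℤ-Solver.solve-∀
    l : ∀ a b c → a Z.+ + 1 Z.* Z.- b Z.+ c Z.+ b ≡ a Z.+ c
    l = ℤ-Solver.solve-∀

  n-odd : Odd n
  n-odd with N-shape
  ... | inj₁ e = Mod8.valid 3 ((isOdd zero ∨ isOdd (suc zero)) ⇒ v2 ≐ v0 ⊛ v0 ⊞ v1 ⊛ v1 ⊞ v0 ⊛ v1 ⇒ isOdd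
      (suc (suc zero)))
    (x ∷ y ∷ n ∷ []) (coprime-odd X⊥Y) (cong (_% 8) e)
  ... | inj₂ e = Mod8.valid 3 ((isOdd zero ∨ isOdd (suc zero)) ⇒ v2 ⊞ v0 ⊛ v1 ≐ v0 ⊛ v0 ⊞ v1 ⊛ v1 ⇒ isOdd
      (suc (suc zero)))
    (x ∷ y ∷ n ∷ []) (coprime-odd X⊥Y) (cong (_% 8) e)

  odd⇒≢0 : ∀ {n} → Odd n → n ≢ 0
  odd⇒≢0 () refl

  -- M is an indefinite form; only the nonnegative value of N M and the positivity of N settle its
  -- sign.
  M≡ : M X Y ≡ + m
  M≡ = cofactor-nonneg {n} (M X Y) (odd⇒≢0 {n} n-odd) (trans (cong (Z._* M X Y) (sym N≡)) F₁≥0)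

  nm≡k : n * m ≡ k
  nm≡k = Z.+-injective (trans (Z.pos-* n m) (trans (cong₂ Z._*_ (sym N≡) (sym M≡)) F₁≥0))

  abs-forms : AbsForms x y n m
  abs-forms with product-sign X Y
  ... | inj₁ e = same
    (natural v0 (v1 ⊛ v1 ⊞ v2 ⊛ v2 ⊞ v1 ⊛ v2) (n ∷ x ∷ y ∷ [])
      (trans (sym N≡) (trans (l₀ X Y) (trans (squares (+ 1) XY (sym e)) (l X² XY Y²)))))
    (natural (v0 ⊞ # 3 ⊛ (v1 ⊛ v2)) (v1 ⊛ v1 ⊞ v2 ⊛ v2) (m ∷ x ∷ y ∷ [])
      (trans (cong (Z._+ + 3 Z.* XY) (trans (sym M≡) (trans (l₁ X Y) (squares (Z.- + 3) XY (sym e))))) (l₂ X² XY Y²)))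
    where
    l₀ : ∀ X Y → X Z.* X Z.+ X Z.* Y Z.+ Y Z.* Y ≡ X Z.* X Z.+ + 1 Z.* (X Z.* Y) Z.+ Y Z.* Y
    l₀ = ℤ-Solver.solve-∀
    l : ∀ a b c → a Z.+ + 1 Z.* b Z.+ c ≡ a Z.+ c Z.+ b
    l = ℤ-Solver.solve-∀
    l₁ : ∀ X Y → X Z.* X Z.- + 3 Z.* (X Z.* Y) Z.+ Y Z.* Y ≡ X Z.* X Z.+ Z.- + 3 Z.* (X Z.* Y) Z.+ Y Z.* Y
    l₁ = ℤ-Solver.solve-∀
    l₂ : ∀ a b c → a Z.+ Z.- + 3 Z.* b Z.+ c Z.+ + 3 Z.* b ≡ a Z.+ c
    l₂ = ℤ-Solver.solve-∀
  ... | inj₂ e = opposite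
    (natural (v0 ⊞ v1 ⊛ v2) (v1 ⊛ v1 ⊞ v2 ⊛ v2) (n ∷ x ∷ y ∷ [])
      (trans (cong (Z._+ XY) (trans (sym N≡) (trans (l₀ X Y) (squares (+ 1) (Z.- XY) (sym e))))) (l X² XY Y²)))
    (natural v0 (v1 ⊛ v1 ⊞ v2 ⊛ v2 ⊞ # 3 ⊛ (v1 ⊛ v2)) (m ∷ x ∷ y ∷ [])
      (trans (sym M≡) (trans (l₁ X Y) (trans (squares (Z.- + 3) (Z.- XY) (sym e)) (l₂ X² XY Y²)))))
    where
    l₀ : ∀ X Y → X Z.* X Z.+ X Z.* Y Z.+ Y Z.* Y ≡ X Z.* X Z.+ + 1 Z.* (X Z.* Y) Z.+ Y Z.* Y
    l₀ = ℤ-Solver.solve-∀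
    l : ∀ a b c → a Z.+ + 1 Z.* Z.- b Z.+ c Z.+ b ≡ a Z.+ c
    l = ℤ-Solver.solve-∀
    l₁ : ∀ X Y → X Z.* X Z.- + 3 Z.* (X Z.* Y) Z.+ Y Z.* Y ≡ X Z.* X Z.+ Z.- + 3 Z.* (X Z.* Y) Z.+ Y Z.* Y
    l₁ = ℤ-Solver.solve-∀
    l₂ : ∀ a b c → a Z.+ Z.- + 3 Z.* Z.- b Z.+ c ≡ a Z.+ c Z.+ + 3 Z.* b
    l₂ = ℤ-Solver.solve-∀

  s = ∣ X Z.+ Y ∣
  q = ∣ X Z.- Y ∣

  -- This and `q-eq` carry the twist by 5: s vanishes precisely at t = -1, and for n = a² and m = 5
  -- b² the two relations become the legs of the third descent.
  s-eq : 5 * n ≡ m + 4 * (s * s)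
  s-eq = natural (# 5 ⊛ v0) (v1 ⊞ # 4 ⊛ (v2 ⊛ v2)) (n ∷ m ∷ s ∷ [])
    (trans (cong (+ 5 Z.*_) (sym N≡)) (trans (l X Y) (cong₂ (λ a b → a Z.+ + 4 Z.* b) M≡ (square-abs (X Z.+ Y)))))
    where
    l : ∀ X Y → + 5 Z.* (X Z.* X Z.+ X Z.* Y Z.+ Y Z.* Y) ≡ X Z.* X Z.- + 3 Z.* (X Z.* Y) Z.+ Y Z.* Y Z.+ + 4
        Z.* ((X Z.+ Y) Z.* (X Z.+ Y))
    l = ℤ-Solver.solve-∀

  q-eq : n + 3 * m ≡ 4 * (q * q)
  q-eq = natural (v0 ⊞ # 3 ⊛ v1) (# 4 ⊛ (v2 ⊛ v2)) (n ∷ m ∷ q ∷ [])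
    (trans (cong₂ (λ a b → a Z.+ + 3 Z.* b) (sym N≡) (sym M≡))
        (trans (l X Y) (cong (+ 4 Z.*_) (square-abs (X Z.- Y)))))
    where
    l : ∀ X Y → X Z.* X Z.+ X Z.* Y Z.+ Y Z.* Y Z.+ + 3 Z.* (X Z.* X Z.- + 3 Z.* (X Z.* Y) Z.+ Y Z.* Y) ≡ + 4
        Z.* ((X Z.- Y) Z.* (X Z.- Y))
    l = ℤ-Solver.solve-∀

  m-odd : Odd m
  m-odd = Mod8.valid 3 (isOdd zero ⇒ # 5 ⊛ v0 ≐ v1 ⊞ # 4 ⊛ v2 ⇒ isOdd (suc zero)) (n ∷ m ∷ s * s ∷ []) n-odd
      (cong (_% 8) s-eq)

  n⊥4 : Coprime n 4
  n⊥4 = Coprimality.sym (odd⇒coprime-4 n-odd)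

  m⊥4 : Coprime m 4
  m⊥4 = Coprimality.sym (odd⇒coprime-4 m-odd)

  n⊥xy : Coprime n (x * y)
  n⊥xy {j} (j∣n , j∣xy) = coprime-sum X⊥Y (j∣sum abs-forms , j∣xy)
    where
    j∣sum : AbsForms x y n m → j ∣ x * x + y * y
    j∣sum (same e _) = ∣m+n∣m⇒∣n (subst (j ∣_) (trans e (+-comm _ (x * y))) j∣n) j∣xy
    j∣sum (opposite e _) = subst (j ∣_) e (∣m∣n⇒∣m+n j∣n j∣xy)

  m⊥xy : Coprime m (x * y)
  m⊥xy {j} (j∣m , j∣xy) = coprime-sum X⊥Y (j∣sum abs-forms , j∣xy)
    where
    j∣sum : AbsForms x y n m → j ∣ x * x + y * y
    j∣sum (same _ e) = subst (j ∣_) e (∣m∣n⇒∣m+n j∣m (∣n⇒∣m*n 3 j∣xy))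
    j∣sum (opposite _ e) = ∣m+n∣m⇒∣n (subst (j ∣_) (trans e (+-comm _ (3 * (x * y)))) j∣m) (∣n⇒∣m*n 3 j∣xy)

  n⊥m : Coprime n m
  n⊥m {i} (i∣n , i∣m) = coprime-*ʳ {m = 4} n⊥4 n⊥xy (i∣n , i∣4xy abs-forms)
    where
    i∣4xy : AbsForms x y n m → i ∣ 4 * (x * y)
    i∣4xy (same e f) = ∣m+n∣m⇒∣n (subst (i ∣_) (trans e (trans (cong (_+ x * y) (sym f)) (l m (x * y)))) i∣n) i∣m
      where
      l : ∀ m k → m + 3 * k + k ≡ m + 4 * k
      l = solve-∀
    i∣4xy (opposite e f) = ∣m+n∣m⇒∣n
        (subst (i ∣_) (trans f (trans (cong (_+ 3 * (x * y)) (sym e)) (l n (x * y)))) i∣m) i∣n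
      where
      l : ∀ n k → n + k + 3 * k ≡ n + 4 * k
      l = solve-∀

-- r = (z + u)/2 and s = (z - u)/2.
half-sum : ∀ {z u k} → z * z ≡ u * u + 4 * k → ∃ λ r → ∃ λ s → k ≡ r * s × r * r + s * s ≡ u * u + 2 * k
half-sum {z} {u} {k} eq = go (excess u eq)
  where
  go : (∃ λ e → z ≡ u + e × e * (2 * u + e) ≡ 4 * k) → _
  go (e , _ , e-eq) = by-parity (even-or-odd e)
    where
    by-parity : Odd e ⊎ (∃ λ s → e ≡ 2 * s) → ∃ λ r → ∃ λ s → k ≡ r * s × r * r + s * s ≡ u * u + 2 * k
    by-parity (inj₁ o) = ⊥-elim (Mod8.valid 3 (isOdd zero ⇒ v0 ⊛ (# 2 ⊛ v1 ⊞ v0) ≐ # 4 ⊛ v2 ⇒ false)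
        (e ∷ u ∷ k ∷ []) o (cong (_% 8) e-eq))
    by-parity (inj₂ (s , refl)) = u + s , s , k≡ , trans (l₂ u s) (cong (λ k → u * u + 2 * k) (sym k≡))
      where
      l₁ : ∀ u s → 4 * ((u + s) * s) ≡ 2 * s * (2 * u + 2 * s)
      l₁ = solve-∀
      l₂ : ∀ u s → (u + s) * (u + s) + s * s ≡ u * u + 2 * ((u + s) * s)
      l₂ = solve-∀
      k≡ : k ≡ (u + s) * s
      k≡ = *-cancelˡ-≡ _ _ 4 (trans (sym e-eq) (sym (l₁ u s)))

-- The coprime factors n and m are squares a² and b² that differ by 4 |X Y|. So the half sum r and
-- half difference s of a and b satisfy r s = |X Y|, and the pairs (r, s) and (|X|, |Y|) solve the
-- equation of `no-quartic-15`. The sign of X Y decides which pair takes which role.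
F₁-not-square : ∀ X Y {z} → ∣ X ∣ ≢ 0 → ∣ Y ∣ ≢ 0 → Coprime ∣ X ∣ ∣ Y ∣ → F₁ X Y ≢ + (z * z)
F₁-not-square X Y {z} X≢0 Y≢0 X⊥Y eq = go (square-split z≢0 n⊥m nm≡k)
  where
  open Forms X Y X≢0 Y≢0 X⊥Y {z * z} eq
  z≢0 : z ≢ 0
  z≢0 refl with m*n≡0⇒m≡0∨n≡0 n nm≡k
  ... | inj₁ e = odd⇒≢0 n-odd e
  ... | inj₂ e = odd⇒≢0 m-odd e
  k′ = x * y
  r⊥s : ∀ {r s} → k′ ≡ r * s → r * r + s * s ≡ x * x + y * y + k′ ⊎ r * r + s * s + k′ ≡ x * x + y * y → Coprime r s
  r⊥s {r} {s} k≡ e {i} (i∣r , i∣s) = coprime-sum X⊥Y (i∣sum e , i∣k)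
    where
    i∣k : i ∣ k′
    i∣k = subst (i ∣_) (sym k≡) (∣m⇒∣m*n s i∣r)
    i∣rs : i ∣ r * r + s * s
    i∣rs = ∣m∣n⇒∣m+n (∣m⇒∣m*n r i∣r) (∣m⇒∣m*n s i∣s)
    i∣sum : r * r + s * s ≡ x * x + y * y + k′ ⊎ r * r + s * s + k′ ≡ x * x + y * y → i ∣ x * x + y * y
    i∣sum (inj₁ e) = ∣m+n∣m⇒∣n (subst (i ∣_) (trans e (+-comm _ k′)) i∣rs) i∣k
    i∣sum (inj₂ e) = subst (i ∣_) e (∣m∣n⇒∣m+n i∣rs i∣k)
  go : (∃ λ a → ∃ λ b → n ≡ a * a × m ≡ b * b × z ≡ a * b) → ⊥
  go (a , b , n≡ , m≡ , _) = by-sign abs-forms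
    where
    l : ∀ m k → m + 2 * k + k ≡ m + 3 * k
    l = solve-∀
    by-sign : AbsForms x y n m → ⊥
    by-sign (same e f) = finish (half-sum {a} {b} {k′} (trans (sym n≡) (trans n≡m (cong (_+ 4 * k′) m≡))))
      where
      l₁ : ∀ m k → m + 3 * k + k ≡ m + 4 * k
      l₁ = solve-∀
      n≡m : n ≡ m + 4 * k′
      n≡m = trans e (trans (cong (_+ k′) (sym f)) (l₁ m k′))
      finish : (∃ λ r → ∃ λ s → k′ ≡ r * s × r * r + s * s ≡ b * b + 2 * k′) → ⊥
      finish (r , s , k≡ , rs) = no-quartic-15 {r} {s} {x} {y} (xy≢0 ∘ trans k≡) (r⊥s {r} {s} k≡ (inj₂ rsk)) X⊥Y
          (sym k≡)
        (trans (cong (λ h → r * r + s * s + h) (sym k≡)) rsk)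
        where
        rsk : r * r + s * s + k′ ≡ x * x + y * y
        rsk = trans (cong (_+ k′) (trans rs (cong (_+ 2 * k′) (sym m≡)))) (trans (l m k′) f)
    by-sign (opposite e f) = finish (half-sum {b} {a} {k′} (trans (sym m≡) (trans m≡n (cong (_+ 4 * k′) n≡))))
      where
      l₁ : ∀ n k → n + k + 3 * k ≡ n + 4 * k
      l₁ = solve-∀
      m≡n : m ≡ n + 4 * k′
      m≡n = trans f (trans (cong (_+ 3 * k′) (sym e)) (l₁ n k′))
      finish : (∃ λ r → ∃ λ s → k′ ≡ r * s × r * r + s * s ≡ a * a + 2 * k′) → ⊥
      finish (r , s , k≡ , rs) = no-quartic-15 {x} {y} {r} {s} xy≢0 X⊥Y (r⊥s {r} {s} k≡ (inj₁ rsk)) k≡ (sym rsk)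
        where
        l₂ : ∀ n k → n + 2 * k ≡ n + k + k
        l₂ = solve-∀
        rsk : r * r + s * s ≡ x * x + y * y + k′
        rsk = trans rs (trans (cong (_+ 2 * k′) (sym n≡)) (trans (l₂ n k′) (cong (_+ k′) e)))

module Pythagoras (X Y : ℤ) where
  Δ = X Z.* X Z.- X Z.* Y Z.- Y Z.* Y
  δ = ∣ Δ ∣
  xy = ∣ X ∣ * ∣ Y ∣

  F₂≡ : F₂ X Y ≡ + (δ * δ + 4 * (xy * xy))
  F₂≡ = trans (l X Y) (trans (cong₂ (λ a b → a Z.+ + 4 Z.* b) (square-abs Δ) (trans (square-abs (X Z.* Y))
      (cong (λ k → + k Z.* + k) (Z.abs-* X Y)))) (sym (value-pos (v0 ⊛ v0 ⊞ # 4 ⊛ (v1 ⊛ v1)) (δ ∷ xy ∷ []))))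
    where
    l : ∀ X Y → X Z.* X Z.* X Z.* X Z.- + 2 Z.* (X Z.* X Z.* X Z.* Y) Z.+ + 3 Z.* (X Z.* X Z.* Y Z.* Y) Z.+ + 2
        Z.* (X Z.* Y Z.* Y Z.* Y) Z.+ Y Z.* Y Z.* Y Z.* Y
      ≡ (X Z.* X Z.- X Z.* Y Z.- Y Z.* Y) Z.* (X Z.* X Z.- X Z.* Y Z.- Y Z.* Y) Z.+ + 4 Z.* (X Z.* Y Z.* (X Z.* Y))
    l = ℤ-Solver.solve-∀

-- For X Y < 0, Δ = x² + x y - y² is the negative of y² - x y - x², so x and y exchange roles in
-- `no-quartic-17`.
F₂-not-square : ∀ X Y {z} → ∣ X ∣ ≢ 0 → ∣ Y ∣ ≢ 0 → Coprime ∣ X ∣ ∣ Y ∣ → F₂ X Y ≢ + (z * z)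
F₂-not-square X Y {z} X≢0 Y≢0 X⊥Y eq = by-signs (product-sign X Y) (abs-sign Δ)
  where
  open Pythagoras X Y
  x = ∣ X ∣
  y = ∣ Y ∣
  z² : z * z ≡ δ * δ + 4 * (x * y * (x * y))
  z² = Z.+-injective (trans (sym eq) F₂≡)
  xy≢0 : x * y ≢ 0
  xy≢0 e with m*n≡0⇒m≡0∨n≡0 x e
  ... | inj₁ z = X≢0 z
  ... | inj₂ z = Y≢0 z
  X² = + x Z.* + x
  Y² = + y Z.* + y
  XY = + x Z.* + y
  Δ≡ : ∀ {P} → X Z.* Y ≡ P → Δ ≡ X² Z.- P Z.- Y²
  Δ≡ e = cong₂ Z._-_ (cong₂ Z._-_ (square-abs X) e) (square-abs Y)
  by-signs : X Z.* Y ≡ XY ⊎ X Z.* Y ≡ Z.- XY → Δ ≡ + δ ⊎ Δ ≡ Z.- (+ δ) → ⊥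
  by-signs (inj₁ e) (inj₁ f) = no-quartic-17 {x} {y} {δ} {z} xy≢0 X⊥Y
    (inj₁ (natural (v0 ⊛ v0) (v1 ⊛ v1 ⊞ v0 ⊛ v1 ⊞ v2) (x ∷ y ∷ δ ∷ [])
        (trans (l X² Y² XY) (cong (λ h → Y² Z.+ XY Z.+ h) (trans (sym (Δ≡ e)) f))))) z²
    where
    l : ∀ a b c → a ≡ b Z.+ c Z.+ (a Z.- c Z.- b)
    l = ℤ-Solver.solve-∀
  by-signs (inj₁ e) (inj₂ f) = no-quartic-17 {x} {y} {δ} {z} xy≢0 X⊥Y
    (inj₂ (natural (v0 ⊛ v0 ⊞ v2) (v1 ⊛ v1 ⊞ v0 ⊛ v1) (x ∷ y ∷ δ ∷ [])
        (trans (cong (λ h → X² Z.+ h) (trans (sym (Z.neg-involutive (+ δ))) (cong Z.-_ (trans (sym f) (Δ≡ e)))))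
        (l X² Y² XY)))) z²
    where
    l : ∀ a b c → a Z.+ Z.- (a Z.- c Z.- b) ≡ b Z.+ c
    l = ℤ-Solver.solve-∀
  by-signs (inj₂ e) (inj₂ f) = no-quartic-17 {y} {x} {δ} {z} (xy≢0 ∘ trans (*-comm x y)) (Coprimality.sym X⊥Y)
    (inj₁ (natural (v1 ⊛ v1) (v0 ⊛ v0 ⊞ v1 ⊛ v0 ⊞ v2) (x ∷ y ∷ δ ∷ [])
      (trans (l X² Y² XY) (cong₂ (λ c d → X² Z.+ c Z.+ d) (Z.*-comm (+ x) (+ y))
          (trans (cong Z.-_ (trans (sym (Δ≡ e)) f)) (Z.neg-involutive (+ δ)))))))
    (trans z² (l′ δ x y))
    where
    l : ∀ a b c → b ≡ a Z.+ c Z.+ Z.- (a Z.- Z.- c Z.- b)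
    l = ℤ-Solver.solve-∀
    l′ : ∀ δ x y → δ * δ + 4 * (x * y * (x * y)) ≡ δ * δ + 4 * (y * x * (y * x))
    l′ = solve-∀
  by-signs (inj₂ e) (inj₁ f) = no-quartic-17 {y} {x} {δ} {z} (xy≢0 ∘ trans (*-comm x y)) (Coprimality.sym X⊥Y)
    (inj₂ (natural (v1 ⊛ v1 ⊞ v2) (v0 ⊛ v0 ⊞ v1 ⊛ v0) (x ∷ y ∷ δ ∷ [])
      (trans (cong (λ h → Y² Z.+ h) (trans (sym f) (Δ≡ e)))
          (trans (l X² Y² XY) (cong (λ h → X² Z.+ h) (Z.*-comm (+ x) (+ y)))))))
    (trans z² (l′ δ x y))
    where
    l : ∀ a b c → b Z.+ (a Z.- Z.- c Z.- b) ≡ a Z.+ c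
    l = ℤ-Solver.solve-∀
    l′ : ∀ δ x y → δ * δ + 4 * (x * y * (x * y)) ≡ δ * δ + 4 * (y * x * (y * x))
    l′ = solve-∀

-- The twists by d.

prime-factor : ∀ n → n ≢ 0 → n ≢ 1 → ∃ λ p → Prime p × p ∣ n
prime-factor n n≢0 n≢1 with factorise n {{≢-nonZero n≢0}}
... | record { factors = [] ; isFactorisation = e } = ⊥-elim (n≢1 e)
... | record { factors = p ∷ ps ; isFactorisation = e ; factorsPrime = pp All.∷ _ } = p , pp , subst (p ∣_)
    (sym e) (m∣m*n _)

-- A cofactor other than 1 would have a prime factor, again q, and q² would divide d.
squarefree-prime-power : ∀ {d q} → SquareFree d → ∣ d ∣ ≢ 0 → ∣ d ∣ ≢ 1 → Prime q → (∀ {p} → Prime p → p ∣ ∣ d ∣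
    → p ≡ q) → ∣ d ∣ ≡ q
squarefree-prime-power {d} {q} sf d≢0 d≢1 pq only = go (prime-factor ∣ d ∣ d≢0 d≢1)
  where
  go : (∃ λ p → Prime p × p ∣ ∣ d ∣) → ∣ d ∣ ≡ q
  go (p , pp , p∣d) = go′ (subst (_∣ ∣ d ∣) (only pp p∣d) p∣d)
    where
    go′ : q ∣ ∣ d ∣ → ∣ d ∣ ≡ q
    go′ (divides c d≡) with c ≟ 1
    ... | yes refl = trans d≡ (*-identityˡ q)
    ... | no c≢1 = ⊥-elim (again (prime-factor c (λ { refl → d≢0 d≡ }) c≢1))
      where
      again : (∃ λ p → Prime p × p ∣ c) → ⊥
      again (p , pp , p∣c) = sf q pq (subst (q * q ∣_) (sym d≡) (*-monoˡ-∣ q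
        (subst (_∣ c) (only pp (subst (p ∣_) (sym d≡) (∣m⇒∣m*n q p∣c))) p∣c)))

-- Since 5 divides s = 5 p, the first relation becomes a² = b² + 20 p², and p is even modulo 8. For
-- p = 2 ψ it reads a² = b² + 80 ψ², and the second becomes q² = 4 (b² + 5 ψ²). This is the
-- situation of `no-legs-5`.
no-square-and-5-square : ∀ {a b n m s q} → s ≢ 0 → n ≡ a * a → m ≡ 5 * (b * b) → Odd n → Odd m → Coprime n m →
  5 * n ≡ m + 4 * (s * s) → n + 3 * m ≡ 4 * (q * q) → ⊥
no-square-and-5-square {a} {b} {n} {m} {s} {q} s≢0 refl refl n-odd m-odd n⊥m s-eq q-eq = go 5∣s
  where
  5∣s : 5 ∣ s
  5∣s = ∣-square s 5-prime (coprime-divisor {5} {4} {s * s} (prime-coprime 4 5-prime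
      (λ h → contradiction (∣⇒≤ h) λ { (s≤s (s≤s (s≤s (s≤s ())))) }))
    (∣m+n∣m⇒∣n (subst (5 ∣_) s-eq (m∣m*n (a * a))) (m∣m*n (b * b))))
  go : 5 ∣ s → ⊥
  go (divides p refl) = by-parity (even-or-odd p)
    where
    a² : a * a ≡ b * b + 20 * (p * p)
    a² = *-cancelˡ-≡ _ _ 5 (trans s-eq (l b p))
      where
      l : ∀ b p → 5 * (b * b) + 4 * (p * 5 * (p * 5)) ≡ 5 * (b * b + 20 * (p * p))
      l = solve-∀
    a-odd = odd-*ˡ a a n-odd
    b-odd = odd-*ˡ b b (odd-*ʳ 5 (b * b) m-odd)
    by-parity : Odd p ⊎ (∃ λ ψ → p ≡ 2 * ψ) → ⊥
    by-parity (inj₁ p-odd) = Mod8.valid 3 (isOdd zero ⇒ isOdd (suc zero) ⇒ isOdd (suc (suc zero)) ⇒ v0 ⊛ v0 ≐ v1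
        ⊛ v1 ⊞ # 20 ⊛ (v2 ⊛ v2) ⇒ false)
      (a ∷ b ∷ p ∷ []) a-odd b-odd p-odd (cong (_% 8) a²)
    by-parity (inj₂ (ψ , refl)) = conclude (halve-square {q} {b * b + 5 * (ψ * ψ)} q²)
      where
      a²′ : a * a ≡ b * b + 80 * (ψ * ψ)
      a²′ = trans a² (l b ψ)
        where
        l : ∀ b ψ → b * b + 20 * (2 * ψ * (2 * ψ)) ≡ b * b + 80 * (ψ * ψ)
        l = solve-∀
      q² : q * q ≡ 4 * (b * b + 5 * (ψ * ψ))
      q² = *-cancelˡ-≡ _ _ 4 (trans (sym q-eq) (trans (cong (_+ 3 * (5 * (b * b))) a²′) (l b ψ)))
        where
        l : ∀ b ψ → b * b + 80 * (ψ * ψ) + 3 * (5 * (b * b)) ≡ 4 * (4 * (b * b + 5 * (ψ * ψ)))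
        l = solve-∀
      b∣m : ∀ {i} → i ∣ b → i ∣ 5 * (b * b)
      b∣m i∣b = ∣n⇒∣m*n 5 (∣m⇒∣m*n b i∣b)
      ψ⊥b : Coprime ψ b
      ψ⊥b {i} (i∣ψ , i∣b) = n⊥m (subst (i ∣_) (sym a²′) (∣m∣n⇒∣m+n (∣m⇒∣m*n b i∣b) (∣n⇒∣m*n 80 (∣m⇒∣m*n ψ i∣ψ)))
          , b∣m i∣b)
      5∤b : ¬ 5 ∣ b
      5∤b 5∣b = contradiction (n⊥m (subst (5 ∣_) (sym a²′) (∣m∣n⇒∣m+n (∣m⇒∣m*n b 5∣b)
          (∣m⇒∣m*n (ψ * ψ) (divides {5} {80} 16 refl))) , b∣m 5∣b)) λ ()
      conclude : (∃ λ r → q ≡ 2 * r × r * r ≡ b * b + 5 * (ψ * ψ)) → ⊥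
      conclude (r , _ , r²) = no-legs-5 (<-wellFounded ψ) {b} {r} {a} (λ { refl → s≢0 refl }) b-odd ψ⊥b 5∤b r² a²′

module Twisted {d : ℤ} (sf : SquareFree d) (d≢1 : d ≢ + 1) (X Y w v : ℤ)
  (X≢0 : ∣ X ∣ ≢ 0) (Y≢0 : ∣ Y ∣ ≢ 0) (X⊥Y : Coprime ∣ X ∣ ∣ Y ∣)
  (dw² : d Z.* (w Z.* w) ≡ F₁ X Y) (dv² : d Z.* (v Z.* v) ≡ F₂ X Y) where

  open Pythagoras X Y using (δ; xy; F₂≡)

  d′ w′ v′ : ℕ
  d′ = ∣ d ∣
  w′ = ∣ w ∣
  v′ = ∣ v ∣

  dv²′ : + (v′ * v′) Z.* d ≡ + (δ * δ + 4 * (xy * xy))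
  dv²′ = trans (Z.*-comm (+ (v′ * v′)) d) (trans (cong (d Z.*_) (trans (Z.pos-* v′ v′) (sym (square-abs v))))
      (trans dv² F₂≡))

  F₂≢0 : δ * δ + 4 * (xy * xy) ≢ 0
  F₂≢0 e = case-⊥ (m*n≡0⇒m≡0∨n≡0 ∣ X ∣ (reduce (m*n≡0⇒m≡0∨n≡0 xy xy²≡0)))
    where
    case-⊥ : ∣ X ∣ ≡ 0 ⊎ ∣ Y ∣ ≡ 0 → ⊥
    case-⊥ (inj₁ z) = X≢0 z
    case-⊥ (inj₂ z) = Y≢0 z
    xy²≡0 : xy * xy ≡ 0
    xy²≡0 = m*n≡0⇒m≡0 (xy * xy) 4 (trans (*-comm (xy * xy) 4) (m+n≡0⇒n≡0 (δ * δ) e))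

  v′²≢0 : v′ * v′ ≢ 0
  v′²≢0 e = F₂≢0 (Z.+-injective (trans (sym dv²′) (cong (λ k → + k Z.* d) e)))

  -- F₂ is a sum of squares and positive, so d is positive.
  d≡ : d ≡ + d′
  d≡ = cofactor-nonneg {v′ * v′} d v′²≢0 dv²′

  F₁≡ : F₁ X Y ≡ + (d′ * (w′ * w′))
  F₁≡ = trans (sym dw²) (trans (cong₂ Z._*_ d≡ (square-abs w)) (sym (value-pos (v0 ⊛ (v1 ⊛ v1)) (d′ ∷ w′ ∷ []))))

  open Forms X Y X≢0 Y≢0 X⊥Y {d′ * (w′ * w′)} F₁≡

  d′≢0 : d′ ≢ 0
  d′≢0 e = F₂≢0 (Z.+-injective (trans (sym dv²′) (trans (cong (+ (v′ * v′) Z.*_) (trans d≡ (cong +_ e)))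
      (Z.*-zeroʳ (+ (v′ * v′))))))

  d′≢1 : d′ ≢ 1
  d′≢1 e = d≢1 (trans d≡ (cong +_ e))

  -- Modulo a common prime factor of F₂ and K, where K is N or M, the point (X : Y) is (1 : -1).
  resultant : ∀ {p} K R T c → p ∣ d′ → Coprime p (2 * xy) → p ∣ ∣ K ∣ →
    F₂ X Y ≡ K Z.* R Z.+ + 2 Z.* (X Z.* Y) Z.* T → T Z.+ K ≡ + 2 Z.* Y Z.* (X Z.+ Y) →
    (X Z.+ Y) Z.* (X Z.+ Y) ≡ K Z.+ + c Z.* (X Z.* Y) → p ∣ c
  resultant {p} K R T c p∣d p⊥ p∣K F₂-eq T-eq K-eq = coprime-divisor {n = xy} (coprime-∣ p⊥ ∣-refl (n∣m*n 2))
      (subst (p ∣_) (*-comm c xy) (subst (p ∣_) (trans (Z.abs-* (+ c) (X Z.* Y)) (cong (c *_) (Z.abs-* X Y)))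
          (ℤ∣.∣⇒∣ᵤ p∣cXY)))
    where
    p∣ᵢK : + p ℤ∣.∣ K
    p∣ᵢK = ℤ∣.∣ᵤ⇒∣ p∣K
    p∣2xyT : + p ℤ∣.∣ + 2 Z.* (X Z.* Y) Z.* T
    p∣2xyT = ℤ∣.∣m+n∣m⇒∣n (subst (+ p ℤ∣.∣_) (trans dv² F₂-eq) (ℤ∣.∣m⇒∣m*n {+ p} {d} (v Z.* v) (ℤ∣.∣ᵤ⇒∣ p∣d)))
        (ℤ∣.∣m⇒∣m*n {+ p} {K} R p∣ᵢK)
    p∣T : p ∣ ∣ T ∣
    p∣T = coprime-divisor p⊥ (subst (p ∣_) (trans (Z.abs-* (+ 2 Z.* (X Z.* Y)) T)
        (cong (_* ∣ T ∣) (trans (Z.abs-* (+ 2) (X Z.* Y)) (cong (2 *_) (Z.abs-* X Y)))))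
      (ℤ∣.∣⇒∣ᵤ p∣2xyT))
    p∣2ys : p ∣ 2 * ∣ Y ∣ * s
    p∣2ys = subst (p ∣_) (trans (cong ∣_∣ T-eq) (trans (Z.abs-* (+ 2 Z.* Y) (X Z.+ Y))
        (cong (_* s) (Z.abs-* (+ 2) Y))))
      (ℤ∣.∣⇒∣ᵤ (ℤ∣.∣m∣n⇒∣m+n (ℤ∣.∣ᵤ⇒∣ {+ p} {T} p∣T) p∣ᵢK))
    p∣s : p ∣ s
    p∣s = coprime-divisor (coprime-∣ p⊥ ∣-refl (divides ∣ X ∣ (l ∣ X ∣ ∣ Y ∣))) p∣2ys
      where
      l : ∀ x y → 2 * (x * y) ≡ x * (2 * y)
      l = solve-∀
    p∣cXY : + p ℤ∣.∣ + c Z.* (X Z.* Y)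
    p∣cXY = ℤ∣.∣m+n∣m⇒∣n (subst (+ p ℤ∣.∣_) K-eq (ℤ∣.∣m⇒∣m*n {+ p} {X Z.+ Y} (X Z.+ Y) (ℤ∣.∣ᵤ⇒∣ p∣s))) p∣ᵢK

  half⊥ : ∀ {k} → Coprime k 4 → Coprime k 2
  half⊥ c = coprime-∣ c ∣-refl (divides 2 refl)

  p∤n : ∀ {p} → Prime p → p ∣ d′ → ¬ p ∣ n
  p∤n {p} pp p∣d p∣n = ¬prime[1] (subst Prime (∣1⇒≡1 p∣1) pp)
    where
    p∣1 : p ∣ 1
    p∣1 = resultant (N X Y) (X Z.* X Z.- X Z.* Y Z.+ Y Z.* Y) (X Z.* Y Z.- X Z.* X Z.+ Y Z.* Y) 1 p∣d
        (coprime-∣ (coprime-*ʳ {m = 2} (half⊥ n⊥4) n⊥xy) p∣n ∣-refl) p∣n (l₁ X Y) (l₂ X Y) (l₃ X Y)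
      where
      l₁ : ∀ X Y → X Z.* X Z.* X Z.* X Z.- + 2 Z.* (X Z.* X Z.* X Z.* Y) Z.+ + 3 Z.* (X Z.* X Z.* Y Z.* Y) Z.+ +
          2 Z.* (X Z.* Y Z.* Y Z.* Y) Z.+ Y Z.* Y Z.* Y Z.* Y
        ≡ (X Z.* X Z.+ X Z.* Y Z.+ Y Z.* Y) Z.* (X Z.* X Z.- X Z.* Y Z.+ Y Z.* Y) Z.+ + 2 Z.* (X Z.* Y) Z.*
            (X Z.* Y Z.- X Z.* X Z.+ Y Z.* Y)
      l₁ = ℤ-Solver.solve-∀
      l₂ : ∀ X Y → X Z.* Y Z.- X Z.* X Z.+ Y Z.* Y Z.+ (X Z.* X Z.+ X Z.* Y Z.+ Y Z.* Y) ≡ + 2 Z.* Y Z.* (X Z.+ Y)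
      l₂ = ℤ-Solver.solve-∀
      l₃ : ∀ X Y → (X Z.+ Y) Z.* (X Z.+ Y) ≡ X Z.* X Z.+ X Z.* Y Z.+ Y Z.* Y Z.+ + 1 Z.* (X Z.* Y)
      l₃ = ℤ-Solver.solve-∀

  p∣m⇒p≡5 : ∀ {p} → Prime p → p ∣ d′ → p ∣ m → p ≡ 5
  p∣m⇒p≡5 {p} pp p∣d p∣m = one-or-five (prime⇒irreducible 5-prime p∣5)
    where
    one-or-five : p ≡ 1 ⊎ p ≡ 5 → p ≡ 5
    one-or-five (inj₁ refl) = ⊥-elim (¬prime[1] pp)
    one-or-five (inj₂ e) = e
    p∣5 : p ∣ 5
    p∣5 = resultant (M X Y) (X Z.* X Z.+ + 3 Z.* (X Z.* Y) Z.+ Y Z.* Y) (+ 5 Z.* (X Z.* Y) Z.- X Z.* X Z.+ Y Z.*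
        Y) 5 p∣d
        (coprime-∣ (coprime-*ʳ {m = 2} (half⊥ m⊥4) m⊥xy) p∣m ∣-refl) p∣m (l₁ X Y) (l₂ X Y) (l₃ X Y)
      where
      l₁ : ∀ X Y → X Z.* X Z.* X Z.* X Z.- + 2 Z.* (X Z.* X Z.* X Z.* Y) Z.+ + 3 Z.* (X Z.* X Z.* Y Z.* Y) Z.+ +
          2 Z.* (X Z.* Y Z.* Y Z.* Y) Z.+ Y Z.* Y Z.* Y Z.* Y
        ≡ (X Z.* X Z.- + 3 Z.* (X Z.* Y) Z.+ Y Z.* Y) Z.* (X Z.* X Z.+ + 3 Z.* (X Z.* Y) Z.+ Y Z.* Y) Z.+ + 2
            Z.* (X Z.* Y) Z.* (+ 5 Z.* (X Z.* Y) Z.- X Z.* X Z.+ Y Z.* Y)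
      l₁ = ℤ-Solver.solve-∀
      l₂ : ∀ X Y → + 5 Z.* (X Z.* Y) Z.- X Z.* X Z.+ Y Z.* Y Z.+ (X Z.* X Z.- + 3 Z.* (X Z.* Y) Z.+ Y Z.* Y) ≡ +
          2 Z.* Y Z.* (X Z.+ Y)
      l₂ = ℤ-Solver.solve-∀
      l₃ : ∀ X Y → (X Z.+ Y) Z.* (X Z.+ Y) ≡ X Z.* X Z.- + 3 Z.* (X Z.* Y) Z.+ Y Z.* Y Z.+ + 5 Z.* (X Z.* Y)
      l₃ = ℤ-Solver.solve-∀

  d′≡5 : d′ ≡ 5
  d′≡5 = squarefree-prime-power {d} sf d′≢0 d′≢1 5-prime λ {p} pp p∣d → only pp p∣d
      (euclidsLemma n m pp (subst (p ∣_) (sym nm≡k) (∣m⇒∣m*n (w′ * w′) p∣d)))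
    where
    only : ∀ {p} → Prime p → p ∣ d′ → (p ∣ n) ⊎ (p ∣ m) → p ≡ 5
    only pp p∣d (inj₁ p∣n) = ⊥-elim (p∤n pp p∣d p∣n)
    only pp p∣d (inj₂ p∣m) = p∣m⇒p≡5 pp p∣d p∣m

  w′≢0 : w′ ≢ 0
  w′≢0 e = absurd (m*n≡0⇒m≡0∨n≡0 n (trans nm≡k (trans (cong (λ w → d′ * (w * w)) e) (*-zeroʳ d′))))
    where
    absurd : n ≡ 0 ⊎ m ≡ 0 → ⊥
    absurd (inj₁ z) = odd⇒≢0 n-odd z
    absurd (inj₂ z) = odd⇒≢0 m-odd z

  -- As n m = 5 w² with coprime factors, 5 sits in n or in m. `p∤n` excludes the former, and
  -- `no-square-and-5-square` excludes the latter as long as s is nonzero.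
  s≡0 : s ≡ 0
  s≡0 = decidable-stable (s ≟ 0) λ s≢0 → go s≢0 (prime-split (inj₂ 5-prime) w′≢0 n⊥m
      (trans nm≡k (cong (_* (w′ * w′)) d′≡5)))
    where
    go : s ≢ 0 → Split 5 n m w′ → ⊥
    go s≢0 (left i j _ n≡ _) = p∤n 5-prime (subst (5 ∣_) (sym d′≡5) ∣-refl) (subst (5 ∣_) (sym n≡) (m∣m*n (i * i)))
    go s≢0 (right i j _ n≡ m≡) = no-square-and-5-square {j} {i} {n} {m} {s} {q} s≢0 n≡ m≡ n-odd m-odd n⊥m s-eq q-eq

-- Rational points.

module P = ℚ-Solver.+-*-Solver
open P using (Polynomial; con; _:+_; _:*_; _:-_; :-_; _:=_)

ι : ℤ → ℚ
ι i = i ℚ./ 1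

ι-toℚᵘ : ∀ i → ℚ.toℚᵘ (ι i) ℚᵘ.≃ mkℚᵘ i 0
ι-toℚᵘ i = ℚ.toℚᵘ-fromℚᵘ (mkℚᵘ i 0)

ι-injective : ∀ {i j} → ι i ≡ ι j → i ≡ j
ι-injective {i} {j} e = unscale (ℚᵘ.≃-trans (ℚᵘ.≃-sym (ι-toℚᵘ i)) (ℚᵘ.≃-trans (ℚᵘ.≃-reflexive (cong ℚ.toℚᵘ e))
    (ι-toℚᵘ j)))
  where
  unscale : mkℚᵘ i 0 ℚᵘ.≃ mkℚᵘ j 0 → i ≡ j
  unscale (*≡* h) = trans (sym (Z.*-identityʳ i)) (trans h (Z.*-identityʳ j))

ι-* : ∀ i j → ι (i Z.* j) ≡ ι i ℚ.* ι j
ι-* i j = ℚ.toℚᵘ-injective (ℚᵘ.≃-trans (ι-toℚᵘ (i Z.* j)) (ℚᵘ.≃-sym (ℚᵘ.≃-trans (ℚ.toℚᵘ-homo-* (ι i) (ι j))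
  (ℚᵘ.*-cong (ι-toℚᵘ i) (ι-toℚᵘ j)))))

ι-+ : ∀ i j → ι (i Z.+ j) ≡ ι i ℚ.+ ι j
ι-+ i j = ℚ.toℚᵘ-injective (ℚᵘ.≃-trans (ι-toℚᵘ (i Z.+ j)) (ℚᵘ.≃-sym (ℚᵘ.≃-trans (ℚ.toℚᵘ-homo-+ (ι i) (ι j))
  (ℚᵘ.≃-trans (ℚᵘ.+-cong (ι-toℚᵘ i) (ι-toℚᵘ j)) (*≡* (l i j))))))
  where
  l : ∀ i j → (i Z.* + 1 Z.+ j Z.* + 1) Z.* + 1 ≡ (i Z.+ j) Z.* + 1
  l = ℤ-Solver.solve-∀

ι-neg : ∀ i → ι (Z.- i) ≡ ℚ.- ι i
ι-neg i = ℚ.toℚᵘ-injective (ℚᵘ.≃-trans (ι-toℚᵘ (Z.- i))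
    (ℚᵘ.≃-sym (ℚᵘ.≃-trans (ℚ.toℚᵘ-homo‿- (ι i)) (ℚᵘ.-‿cong (ι-toℚᵘ i)))))

ι-- : ∀ i j → ι (i Z.- j) ≡ ι i ℚ.- ι j
ι-- i j = trans (ι-+ i (Z.- j)) (cong (λ h → ι i ℚ.+ h) (ι-neg j))

*-denominator : ∀ p → p ℚ.* ι (↧ p) ≡ ι (↥ p)
*-denominator p@(mkℚ n d-1 _) = ℚ.toℚᵘ-injective (ℚᵘ.≃-trans (ℚ.toℚᵘ-homo-* p (ι (↧ p))) (ℚᵘ.≃-trans
  (ℚᵘ.*-cong (ℚᵘ.≃-refl {ℚ.toℚᵘ p}) (ι-toℚᵘ (↧ p))) (ℚᵘ.≃-sym (ℚᵘ.≃-trans (ι-toℚᵘ (↥ p))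
    (*≡* (trans (cong (λ d → n Z.* + d) (*-identityʳ (suc d-1))) (sym (Z.*-identityʳ (n Z.* + suc d-1)))))))))

ℚ-cancel : ∀ {p q} → p ≢ 0ℚ → p ℚ.* q ≡ 0ℚ → q ≡ 0ℚ
ℚ-cancel {p} {q} p≢0 e = begin
  q                      ≡⟨ ℚ.*-identityˡ q ⟨
  1ℚ ℚ.* q               ≡⟨ cong (ℚ._* q) (ℚ.*-inverseˡ p) ⟨
  (ℚ.1/ p) ℚ.* p ℚ.* q   ≡⟨ ℚ.*-assoc (ℚ.1/ p) p q ⟩
  (ℚ.1/ p) ℚ.* (p ℚ.* q) ≡⟨ cong ((ℚ.1/ p) ℚ.*_) e ⟩
  (ℚ.1/ p) ℚ.* 0ℚ        ≡⟨ ℚ.*-zeroʳ (ℚ.1/ p) ⟩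
  0ℚ ∎
  where
  open ≡-Reasoning
  instance
    p-nonZero : ℚ.NonZero p
    p-nonZero = ℚ.≢-nonZero p≢0

squarefree-1 : SquareFree (+ 1)
squarefree-1 p pp h = ¬prime[1] (subst Prime (m*n≡1⇒m≡1 p p (∣1⇒≡1 h)) pp)

-- The square of the denominator of g is coprime to the numerator, so it divides the squarefree d,
-- and the denominator is 1.
integral-square : ∀ {d} → SquareFree d → ∀ F g → ι d ℚ.* (g ℚ.* g) ≡ ι F → ∃ λ n → d Z.* (n Z.* n) ≡ F
integral-square {d} sf F g@(mkℚ n m-1 c) eq = n , trans cleared (trans (cong (λ m → F Z.* (+ m Z.* + m)) m≡1)
    (Z.*-identityʳ F))
  where
  m = suc m-1
  cleared : d Z.* (n Z.* n) ≡ F Z.* (+ m Z.* + m)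
  cleared = ι-injective (trans (trans (ι-* d (n Z.* n))
      (cong (ι d ℚ.*_) (trans (ι-* n n) (cong₂ ℚ._*_ (sym (*-denominator g)) (sym (*-denominator g))))))
    (trans (P.solve 3 (λ d g m → d :* (g :* m :* (g :* m)) := d :* (g :* g) :* (m :* m)) refl (ι d) g (ι (+ m)))
      (trans (cong (ℚ._* (ι (+ m) ℚ.* ι (+ m))) eq)
          (sym (trans (ι-* F (+ m Z.* + m)) (cong (ι F ℚ.*_) (ι-* (+ m) (+ m))))))))
  m²∣d : m * m ∣ ∣ d ∣
  m²∣d = coprime-divisor {n = ∣ n ∣ * ∣ n ∣} (coprime-sq (Coprimality.sym (Coprimality.recompute c)))
    (divides ∣ F ∣ (trans (*-comm _ ∣ d ∣) (trans (cong (∣ d ∣ *_) (sym (Z.abs-* n n)))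
        (trans (sym (Z.abs-* d _)) (trans (cong ∣_∣ cleared) (Z.abs-* F _))))))
  m≡1 : m ≡ 1
  m≡1 = decidable-stable (m ≟ 1) λ m≢1 → absurd (prime-factor m (λ ()) m≢1)
    where
    absurd : (∃ λ p → Prime p × p ∣ m) → ⊥
    absurd (p , pp , p∣m) = sf p pp (∣-trans (*-pres-∣ p∣m p∣m) m²∣d)

not-square : ∀ {d} → SquareFree d → d ≢ + 1 → ∀ x → x ℚ.* x ≢ ι d
not-square {d} sf d≢1 x eq = go (integral-square {+ 1} squarefree-1 d x (trans (ℚ.*-identityˡ _) eq))
  where
  go : (∃ λ n → + 1 Z.* (n Z.* n) ≡ d) → ⊥
  go (n , e) = by-size (∣ n ∣ ≟ 0) (∣ n ∣ ≟ 1)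
    where
    d≡ : d ≡ + (∣ n ∣ * ∣ n ∣)
    d≡ = trans (sym e) (trans (Z.*-identityˡ _) (trans (square-abs n) (sym (Z.pos-* ∣ n ∣ ∣ n ∣))))
    by-size : Dec (∣ n ∣ ≡ 0) → Dec (∣ n ∣ ≡ 1) → ⊥
    -- `SquareFree` excludes d = 0, since 4 divides 0.
    by-size (yes z) _ = sf 2 prime[2] (subst (4 ∣_) (sym (trans (cong ∣_∣ d≡) (cong (λ k → k * k) z))) (4 ∣0))
    by-size _ (yes o) = d≢1 (trans d≡ (cong (λ k → + (k * k)) o))
    by-size (no z) (no o) = absurd (prime-factor ∣ n ∣ z o)
      where
      absurd : (∃ λ p → Prime p × p ∣ ∣ n ∣) → ⊥
      absurd (p , pp , p∣n) = sf p pp (subst (p * p ∣_) (sym (cong ∣_∣ d≡)) (*-pres-∣ p∣n p∣n))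

-- The quartics over ℚ and their homogeneous forms.

two : ℚ
two = ι (+ 2)

quartic : ℚ → ℚ → ℚ
quartic ε t = t ℚ.* t ℚ.* t ℚ.* t ℚ.- two ℚ.* (t ℚ.* t ℚ.* t) ℚ.+ (1ℚ ℚ.- two ℚ.* ε) ℚ.* (t ℚ.* t) ℚ.- two ℚ.* ε
    ℚ.* t ℚ.+ 1ℚ

:quartic : ∀ {n} → Polynomial n → Polynomial n → Polynomial n
:quartic ε t = t :* t :* t :* t :- con two :* (t :* t :* t) :+ (con 1ℚ :- con two :* ε) :* (t :* t) :- con two
    :* ε :* t :+ con 1ℚ

-- One syntax with three readings, in ℤ, in ℚ and among solver polynomials, so that a form is
-- written once and transported along `ι`.
data Form : Set where
  X̂ Ŷ : Form
  const : ℤ → Form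
  _⊹_ _∙_ _∸̂_ : Form → Form → Form

infixl 7 _∙_
infixl 6 _⊹_ _∸̂_

evalℤ : Form → ℤ → ℤ → ℤ
evalℤ X̂ X Y = X
evalℤ Ŷ X Y = Y
evalℤ (const c) X Y = c
evalℤ (e ⊹ f) X Y = evalℤ e X Y Z.+ evalℤ f X Y
evalℤ (e ∙ f) X Y = evalℤ e X Y Z.* evalℤ f X Y
evalℤ (e ∸̂ f) X Y = evalℤ e X Y Z.- evalℤ f X Y

evalℚ : Form → ℚ → ℚ → ℚ
evalℚ X̂ x y = x
evalℚ Ŷ x y = y
evalℚ (const c) x y = ι c
evalℚ (e ⊹ f) x y = evalℚ e x y ℚ.+ evalℚ f x y
evalℚ (e ∙ f) x y = evalℚ e x y ℚ.* evalℚ f x y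
evalℚ (e ∸̂ f) x y = evalℚ e x y ℚ.- evalℚ f x y

:eval : ∀ {n} → Form → Polynomial n → Polynomial n → Polynomial n
:eval X̂ x y = x
:eval Ŷ x y = y
:eval (const c) x y = con (ι c)
:eval (e ⊹ f) x y = :eval e x y :+ :eval f x y
:eval (e ∙ f) x y = :eval e x y :* :eval f x y
:eval (e ∸̂ f) x y = :eval e x y :- :eval f x y

ι-eval : ∀ e X Y → ι (evalℤ e X Y) ≡ evalℚ e (ι X) (ι Y)
ι-eval X̂ X Y = refl
ι-eval Ŷ X Y = refl
ι-eval (const c) X Y = refl
ι-eval (e ⊹ f) X Y = trans (ι-+ (evalℤ e X Y) (evalℤ f X Y)) (cong₂ ℚ._+_ (ι-eval e X Y) (ι-eval f X Y))
ι-eval (e ∙ f) X Y = trans (ι-* (evalℤ e X Y) (evalℤ f X Y)) (cong₂ ℚ._*_ (ι-eval e X Y) (ι-eval f X Y))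
ι-eval (e ∸̂ f) X Y = trans (ι-- (evalℤ e X Y) (evalℤ f X Y)) (cong₂ ℚ._-_ (ι-eval e X Y) (ι-eval f X Y))

form₁ form₂ : Form
form₁ = (X̂ ∙ X̂ ⊹ X̂ ∙ Ŷ ⊹ Ŷ ∙ Ŷ) ∙ (X̂ ∙ X̂ ∸̂ const (+ 3) ∙ (X̂ ∙ Ŷ) ⊹ Ŷ ∙ Ŷ)
form₂ = X̂ ∙ X̂ ∙ X̂ ∙ X̂ ∸̂ const (+ 2) ∙ (X̂ ∙ X̂ ∙ X̂ ∙ Ŷ) ⊹ const (+ 3) ∙ (X̂ ∙ X̂ ∙ Ŷ ∙ Ŷ) ⊹ const (+ 2) ∙
    (X̂ ∙ Ŷ ∙ Ŷ ∙ Ŷ) ⊹ Ŷ ∙ Ŷ ∙ Ŷ ∙ Ŷ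

-- Multiplication by the fourth power of the denominator Y of t makes the right side an integer, and
-- then y Y² is an integer by `integral-square`.
homogenise : ∀ {d} → SquareFree d → ∀ e t y q → ι d ℚ.* (y ℚ.* y) ≡ q →
  (∀ Y → q ℚ.* (Y ℚ.* Y ℚ.* Y ℚ.* Y) ≡ evalℚ e (t ℚ.* Y) Y) → ∃ λ n → d Z.* (n Z.* n) ≡ evalℤ e (↥ t) (↧ t)
homogenise {d} sf e t y q eq hom = integral-square {d} sf (evalℤ e (↥ t) (↧ t)) (y ℚ.* (Y ℚ.* Y))
  (trans (P.solve 3 (λ d y Y → d :* (y :* (Y :* Y) :* (y :* (Y :* Y))) := d :* (y :* y) :* (Y :* Y :* Y :* Y))
      refl (ι d) y Y)
    (trans (cong (ℚ._* (Y ℚ.* Y ℚ.* Y ℚ.* Y)) eq) (trans (hom Y)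
      (trans (cong (λ X → evalℚ e X Y) (*-denominator t)) (sym (ι-eval e (↥ t) (↧ t)))))))
  where
  Y = ι (↧ t)

homogenise₁ : ∀ {d} → SquareFree d → ∀ t y → ι d ℚ.* (y ℚ.* y) ≡ quartic 1ℚ t → ∃ λ n → d Z.* (n Z.* n) ≡ F₁
    (↥ t) (↧ t)
homogenise₁ {d} sf t y eq = homogenise {d} sf form₁ t y (quartic 1ℚ t) eq
  λ Y → P.solve 2 (λ t Y → :quartic (con 1ℚ) t :* (Y :* Y :* Y :* Y) := :eval form₁ (t :* Y) Y) refl t Y

homogenise₂ : ∀ {d} → SquareFree d → ∀ t y → ι d ℚ.* (y ℚ.* y) ≡ quartic (ℚ.- 1ℚ) t → ∃ λ n → d Z.* (n Z.* n) ≡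
    F₂ (↥ t) (↧ t)
homogenise₂ {d} sf t y eq = homogenise {d} sf form₂ t y (quartic (ℚ.- 1ℚ) t) eq
  λ Y → P.solve 2 (λ t Y → :quartic (con (ℚ.- 1ℚ)) t :* (Y :* Y :* Y :* Y) := :eval form₂ (t :* Y) Y) refl t Y

↥≢0 : ∀ {t} → t ≢ 0ℚ → ∣ ↥ t ∣ ≢ 0
↥≢0 {t} t≢0 e = t≢0 (ℚ.↥p≡0⇒p≡0 t (Z.∣i∣≡0⇒i≡0 e))

↧≢0 : ∀ t → ∣ ↧ t ∣ ≢ 0
↧≢0 (mkℚ _ _ _) ()

coprime-fraction : ∀ t → Coprime ∣ ↥ t ∣ ∣ ↧ t ∣
coprime-fraction (mkℚ _ _ c) = Coprimality.recompute c

only-square-0 : ∀ ε → ε ≡ 1ℚ ⊎ ε ≡ ℚ.- 1ℚ → ∀ t y → y ℚ.* y ≡ quartic ε t → t ≡ 0ℚ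
only-square-0 ε ε± t y eq = decidable-stable (t ℚ.≟ 0ℚ) (by-ε ε±)
  where
  natural-square : ∀ {F} → (∃ λ n → + 1 Z.* (n Z.* n) ≡ F) → ∃ λ z → F ≡ + (z * z)
  natural-square (n , e) = ∣ n ∣ , trans (sym e) (trans (Z.*-identityˡ _)
      (trans (square-abs n) (sym (Z.pos-* ∣ n ∣ ∣ n ∣))))
  by-ε : ε ≡ 1ℚ ⊎ ε ≡ ℚ.- 1ℚ → t ≢ 0ℚ → ⊥
  by-ε (inj₁ refl) t≢0 =
    let z , e = natural-square (homogenise₁ {+ 1} squarefree-1 t y (trans (ℚ.*-identityˡ _) eq)) in
    F₁-not-square (↥ t) (↧ t) {z} (↥≢0 t≢0) (↧≢0 t) (coprime-fraction t) e
  by-ε (inj₂ refl) t≢0 =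
    let z , e = natural-square (homogenise₂ {+ 1} squarefree-1 t y (trans (ℚ.*-identityˡ _) eq)) in
    F₂-not-square (↥ t) (↧ t) {z} (↥≢0 t≢0) (↧≢0 t) (coprime-fraction t) e

only-twist-−1 : ∀ {d} → SquareFree d → d ≢ + 1 → ∀ t y z → t ≢ 0ℚ →
  ι d ℚ.* (y ℚ.* y) ≡ quartic 1ℚ t → ι d ℚ.* (z ℚ.* z) ≡ quartic (ℚ.- 1ℚ) t → t ℚ.+ 1ℚ ≡ 0ℚ
only-twist-−1 {d} sf d≢1 t y z t≢0 ey ez = go (homogenise₁ {d} sf t y ey) (homogenise₂ {d} sf t z ez)
  where
  Y = ι (↧ t)
  Y≢0 : Y ≢ 0ℚ
  Y≢0 e = ↧≢0 t (cong ∣_∣ (ι-injective {↧ t} {+ 0} e))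
  go : (∃ λ n → d Z.* (n Z.* n) ≡ F₁ (↥ t) (↧ t)) → (∃ λ n → d Z.* (n Z.* n) ≡ F₂ (↥ t) (↧ t)) → t ℚ.+ 1ℚ ≡ 0ℚ
  go (w , ew) (v , ev) = ℚ-cancel Y≢0 (trans (P.solve 2 (λ t Y → Y :* (t :+ con 1ℚ) := t :* Y :+ Y) refl t Y)
    (trans (cong (ℚ._+ Y) (*-denominator t)) (trans (sym (ι-+ (↥ t) (↧ t))) (cong ι (Z.∣i∣≡0⇒i≡0 {↥ t Z.+ ↧ t}
      (Twisted.s≡0 {d} sf d≢1 (↥ t) (↧ t) w v (↥≢0 t≢0) (↧≢0 t) (coprime-fraction t) ew ev))))))

-- Quadratic points outside ℚ.

ℚ-difference : ∀ {p q} → p ℚ.- q ≡ 0ℚ → p ≡ q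
ℚ-difference = x∙y⁻¹≈ε⇒x≈y ℚ.+-0-group _ _

two≢0 : two ≢ 0ℚ
two≢0 ()

-- If y = -(t² + a t + b), where t has trace A and norm B, then hP = hQ = 0, because
-- (T² + a T + b)² - quartic ε T is the cubic (T² - A T + B) (2 (a + 1) T + e) + hP T + hQ. Its third root
-- -e / (2 (a + 1)) is a rational point of the curve y² = quartic ε t, hence 0, unless a = -1.
e hP hQ : ℚ → ℚ → ℚ → ℚ → ℚ → ℚ
e ε a b A B = a ℚ.* a ℚ.+ two ℚ.* b ℚ.- 1ℚ ℚ.+ two ℚ.* ε ℚ.+ two ℚ.* (a ℚ.+ 1ℚ) ℚ.* A
hP ε a b A B = A ℚ.* e ε a b A B ℚ.- two ℚ.* (a ℚ.+ 1ℚ) ℚ.* B ℚ.+ two ℚ.* (a ℚ.* b ℚ.+ ε)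
hQ ε a b A B = b ℚ.* b ℚ.- 1ℚ ℚ.- B ℚ.* e ε a b A B

:e :hP :hQ : ∀ {n} → (ε a b A B : Polynomial n) → Polynomial n
:e ε a b A B = a :* a :+ con two :* b :- con 1ℚ :+ con two :* ε :+ con two :* (a :+ con 1ℚ) :* A
:hP ε a b A B = A :* :e ε a b A B :- con two :* (a :+ con 1ℚ) :* B :+ con two :* (a :* b :+ ε)
:hQ ε a b A B = b :* b :- con 1ℚ :- B :* :e ε a b A B

module Trace (ε : ℚ) (ε± : ε ≡ 1ℚ ⊎ ε ≡ ℚ.- 1ℚ) where

  ε²-1 : 1ℚ ℚ.- ε ℚ.* ε ≡ 0ℚ
  ε²-1 = by-ε ε±
    where
    by-ε : ε ≡ 1ℚ ⊎ ε ≡ ℚ.- 1ℚ → 1ℚ ℚ.- ε ℚ.* ε ≡ 0ℚ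
    by-ε (inj₁ refl) = refl
    by-ε (inj₂ refl) = refl

  ε≢0 : ε ≢ 0ℚ
  ε≢0 refl = contradiction ε²-1 λ ()

  Conclusion : ℚ → ℚ → Set
  Conclusion A B = B ≡ ε ⊎ A ℚ.* (B ℚ.+ ε) ≡ B

  quadruple : ∀ {p q} → two ℚ.* two ℚ.* (p ℚ.- q) ≡ 0ℚ → p ≡ q
  quadruple h = ℚ-difference (ℚ-cancel {two ℚ.* two} (λ ()) h)

  -- For a = -1 the cubic loses its leading term, that is, the third intersection lies at infinity.
  -- Because ε² = 1, `hQ` is then (b + ε) (b - ε - 2 B). The first factor is nonzero, since
  -- otherwise `hP` would equal 4 ε; so b = ε + 2 B, and `hP` becomes the second relation.
  at-infinity : ∀ b A B → hP ε (ℚ.- 1ℚ) b A B ≡ 0ℚ → hQ ε (ℚ.- 1ℚ) b A B ≡ 0ℚ → Conclusion A B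
  at-infinity b A B p q = inj₂ (quadruple (trans
      (P.solve 4 (λ ε b A B → con two :* con two :* (A :* (B :+ ε) :- B) :=
        :hP ε (con (ℚ.- 1ℚ)) b A B :+ (con two :- con two :* A) :* (b :- ε :- con two :* B)) refl ε b A B)
      (trans (cong₂ (λ x y → x ℚ.+ (two ℚ.- two ℚ.* A) ℚ.* y) p root)
          (P.solve 1 (λ k → con 0ℚ :+ k :* con 0ℚ := con 0ℚ) refl (two ℚ.- two ℚ.* A)))))
    where
    b+ε≢0 : b ℚ.+ ε ≢ 0ℚ
    b+ε≢0 h = ε≢0 (ℚ-cancel {two ℚ.* two} (λ ()) (trans
      (P.solve 4 (λ ε b A B → con two :* con two :* ε := :hP ε (con (ℚ.- 1ℚ)) b A B :+ (con two :- con two :* A)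
          :* (b :+ ε)) refl ε b A B)
      (trans (cong₂ (λ x y → x ℚ.+ (two ℚ.- two ℚ.* A) ℚ.* y) p h)
          (P.solve 1 (λ k → con 0ℚ :+ k :* con 0ℚ := con 0ℚ) refl (two ℚ.- two ℚ.* A)))))
    root : b ℚ.- ε ℚ.- two ℚ.* B ≡ 0ℚ
    root = ℚ-cancel b+ε≢0 (trans
      (P.solve 4 (λ ε b A B → (b :+ ε) :* (b :- ε :- con two :* B) := :hQ ε (con (ℚ.- 1ℚ)) b A B :+
          (con 1ℚ :- ε :* ε)) refl ε b A B)
      (cong₂ ℚ._+_ q ε²-1))

  -- The third root is 0, so e = 0 and `hQ` gives b² = 1 = ε². The two signs of b are the two points
  -- of the curve over 0: b = ε leads to B = ε, while b = -ε leads to a = 1 - 2 A and to the second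
  -- relation.
  finite : ∀ a b A B → a ℚ.+ 1ℚ ≢ 0ℚ → hP ε a b A B ≡ 0ℚ → hQ ε a b A B ≡ 0ℚ → Conclusion A B
  finite a b A B a+1≢0 p q = by-sign (b ℚ.- ε ℚ.≟ 0ℚ)
    where
    c = two ℚ.* (a ℚ.+ 1ℚ)
    E = e ε a b A B
    c≢0 : c ≢ 0ℚ
    c≢0 h = a+1≢0 (ℚ-cancel {two} (λ ()) h)
    instance
      c-nonZero : ℚ.NonZero c
      c-nonZero = ℚ.≢-nonZero c≢0
    T = ℚ.- (ℚ.1/ c ℚ.* E)
    cT : c ℚ.* T ℚ.+ E ≡ 0ℚ
    cT = trans (P.solve 3 (λ c i E → c :* (:- (i :* E)) :+ E := (con 1ℚ :- c :* i) :* E) refl c (ℚ.1/ c) E)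
      (trans (cong (λ x → (1ℚ ℚ.- x) ℚ.* E) (ℚ.*-inverseʳ c)) (ℚ.*-zeroˡ E))
    Y = T ℚ.* T ℚ.+ a ℚ.* T ℚ.+ b
    T≡0 : T ≡ 0ℚ
    T≡0 = only-square-0 ε ε± T Y (ℚ-difference (trans
      (P.solve 6 (λ ε a b A B T → (T :* T :+ a :* T :+ b) :* (T :* T :+ a :* T :+ b) :- :quartic ε T :=
        (T :* T :- A :* T :+ B) :* (con two :* (a :+ con 1ℚ) :* T :+ :e ε a b A B) :+ :hP ε a b A B :* T :+ :hQ
            ε a b A B) refl ε a b A B T)
      (trans (cong₂ ℚ._+_ (cong₂ (λ x y → (T ℚ.* T ℚ.- A ℚ.* T ℚ.+ B) ℚ.* x ℚ.+ y ℚ.* T) cT p) q)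
        (P.solve 2 (λ k T → k :* con 0ℚ :+ con 0ℚ :* T :+ con 0ℚ := con 0ℚ) refl (T ℚ.* T ℚ.- A ℚ.* T ℚ.+ B) T))))
    E≡0 : E ≡ 0ℚ
    E≡0 = trans (trans (sym (ℚ.+-identityˡ E)) (cong (ℚ._+ E) (sym (trans (cong (c ℚ.*_) T≡0) (ℚ.*-zeroʳ c))))) cT
    by-sign : Dec (b ℚ.- ε ≡ 0ℚ) → Conclusion A B
    by-sign (yes h) = inj₁ (sym (ℚ-difference (ℚ-cancel c≢0 (trans
      (P.solve 5 (λ ε a b A B → con two :* (a :+ con 1ℚ) :* (ε :- B) := :hP ε a b A B :- A :* :e ε a b A B :-
          con two :* a :* (b :- ε)) refl ε a b A B)
      (trans (cong₂ (λ x y → x ℚ.- two ℚ.* a ℚ.* y) (cong₂ (λ x y → x ℚ.- A ℚ.* y) p E≡0) h)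
        (P.solve 2 (λ A a → con 0ℚ :- A :* con 0ℚ :- con two :* a :* con 0ℚ := con 0ℚ) refl A a))))))
    by-sign (no h) = inj₂ (quadruple (trans
      (P.solve 5 (λ ε a b A B → con two :* con two :* (A :* (B :+ ε) :- B) :=
        :hP ε a b A B :- A :* :e ε a b A B :- con two :* a :* (b :+ ε) :+ con two :* (B :+ ε) :*
            (a :- con 1ℚ :+ con two :* A)) refl ε a b A B)
      (trans (cong₂ (λ x y → x ℚ.+ two ℚ.* (B ℚ.+ ε) ℚ.* y) (cong₂ (λ x y → x ℚ.- two ℚ.* a ℚ.* y)
          (cong₂ (λ x y → x ℚ.- A ℚ.* y) p E≡0) b+ε) a-1+2A)
        (P.solve 3 (λ A a k → con 0ℚ :- A :* con 0ℚ :- con two :* a :* con 0ℚ :+ k :* con 0ℚ := con 0ℚ) refl A a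
            (two ℚ.* (B ℚ.+ ε))))))
      where
      b+ε : b ℚ.+ ε ≡ 0ℚ
      b+ε = ℚ-cancel h (trans
        (P.solve 5 (λ ε a b A B → (b :- ε) :* (b :+ ε) := :hQ ε a b A B :+ B :* :e ε a b A B :+
            (con 1ℚ :- ε :* ε)) refl ε a b A B)
        (trans (cong₂ ℚ._+_ (cong₂ (λ x y → x ℚ.+ B ℚ.* y) q E≡0) ε²-1)
            (P.solve 1 (λ B → con 0ℚ :+ B :* con 0ℚ :+ con 0ℚ := con 0ℚ) refl B)))
      a-1+2A : a ℚ.- 1ℚ ℚ.+ two ℚ.* A ≡ 0ℚ
      a-1+2A = ℚ-cancel a+1≢0 (trans
        (P.solve 5 (λ ε a b A B → (a :+ con 1ℚ) :* (a :- con 1ℚ :+ con two :* A) := :e ε a b A B :- con two :*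
            (b :+ ε)) refl ε a b A B)
        (cong₂ (λ x y → x ℚ.- two ℚ.* y) E≡0 b+ε))

  trace-norm : ∀ a b A B → hP ε a b A B ≡ 0ℚ → hQ ε a b A B ≡ 0ℚ → Conclusion A B
  trace-norm a b A B p q = by-pole (a ℚ.+ 1ℚ ℚ.≟ 0ℚ)
    where
    by-pole : Dec (a ℚ.+ 1ℚ ≡ 0ℚ) → Conclusion A B
    by-pole (no h) = finite a b A B h p q
    by-pole (yes h) = at-infinity b A B (trans (cong (λ a → hP ε a b A B) (sym a≡)) p)
        (trans (cong (λ a → hQ ε a b A B) (sym a≡)) q)
      where
      a≡ : a ≡ ℚ.- 1ℚ
      a≡ = ℚ-difference h

-- The quadratic field.

module Field {d : ℤ} where

  κ : ℚ → QF d
  κ q = mk q 0ℚ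

  ⊖_ : QF d → QF d
  ⊖ mk a b = mk (ℚ.- a) (ℚ.- b)

  :mul : ∀ {n} → Polynomial n → (x y : Polynomial n × Polynomial n) → Polynomial n × Polynomial n
  :mul D (a , b) (a′ , b′) = a :* a′ :+ D :* (b :* b′) , a :* b′ :+ b :* a′

  ⊗-assoc : (x y z : QF d) → (x ⊗ y) ⊗ z ≡ x ⊗ (y ⊗ z)
  ⊗-assoc (mk a b) (mk a′ b′) (mk a″ b″) = cong₂ mk
    (P.solve 7 (λ D a b c d e f → proj₁ (:mul D (:mul D (a , b) (c , d)) (e , f)) := proj₁
        (:mul D (a , b) (:mul D (c , d) (e , f)))) refl (ι d) a b a′ b′ a″ b″)
    (P.solve 7 (λ D a b c d e f → proj₂ (:mul D (:mul D (a , b) (c , d)) (e , f)) := proj₂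
        (:mul D (a , b) (:mul D (c , d) (e , f)))) refl (ι d) a b a′ b′ a″ b″)

  ⊗-comm : (x y : QF d) → x ⊗ y ≡ y ⊗ x
  ⊗-comm (mk a b) (mk a′ b′) = cong₂ mk
    (P.solve 5 (λ D a b c d → proj₁ (:mul D (a , b) (c , d)) := proj₁ (:mul D (c , d) (a , b))) refl (ι d) a b a′ b′)
    (P.solve 5 (λ D a b c d → proj₂ (:mul D (a , b) (c , d)) := proj₂ (:mul D (c , d) (a , b))) refl (ι d) a b a′ b′)

  ⊗-identityˡ : (x : QF d) → κ 1ℚ ⊗ x ≡ x
  ⊗-identityˡ (mk a b) = cong₂ mk
    (P.solve 3 (λ D a b → con 1ℚ :* a :+ D :* (con 0ℚ :* b) := a) refl (ι d) a b)
    (P.solve 2 (λ a b → con 1ℚ :* b :+ con 0ℚ :* a := b) refl a b)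

  ⊗-distribˡ : (x y z : QF d) → x ⊗ (y ⊕ z) ≡ (x ⊗ y) ⊕ (x ⊗ z)
  ⊗-distribˡ (mk a b) (mk a′ b′) (mk a″ b″) = cong₂ mk
    (P.solve 7 (λ D a b c d e f → a :* (c :+ e) :+ D :* (b :* (d :+ f)) := a :* c :+ D :* (b :* d) :+
        (a :* e :+ D :* (b :* f))) refl (ι d) a b a′ b′ a″ b″)
    (P.solve 6 (λ a b c d e f → a :* (d :+ f) :+ b :* (c :+ e) := a :* d :+ b :* c :+ (a :* f :+ b :* e)) refl a
        b a′ b′ a″ b″)

  isCommutativeRing : IsCommutativeRing _≡_ (_⊕_ {d}) _⊗_ ⊖_ (κ 0ℚ) (κ 1ℚ)
  isCommutativeRing = record
    { isRing = record
      { +-isAbelianGroup = record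
        { isGroup = record
          { isMonoid = record
            { isSemigroup = record
              { isMagma = record { isEquivalence = isEquivalence ; ∙-cong = cong₂ _⊕_ }
              ; assoc = λ x y z → cong₂ mk (ℚ.+-assoc (re x) (re y) (re z)) (ℚ.+-assoc (im x) (im y) (im z)) }
            ; identity = (λ x → cong₂ mk (ℚ.+-identityˡ (re x)) (ℚ.+-identityˡ (im x)))
                       , (λ x → cong₂ mk (ℚ.+-identityʳ (re x)) (ℚ.+-identityʳ (im x))) }
          ; inverse = (λ x → cong₂ mk (ℚ.+-inverseˡ (re x)) (ℚ.+-inverseˡ (im x)))
                    , (λ x → cong₂ mk (ℚ.+-inverseʳ (re x)) (ℚ.+-inverseʳ (im x)))
          ; ⁻¹-cong = cong ⊖_ }
        ; comm = λ x y → cong₂ mk (ℚ.+-comm (re x) (re y)) (ℚ.+-comm (im x) (im y)) }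
      ; *-cong = cong₂ _⊗_
      ; *-assoc = ⊗-assoc
      ; *-identity = ⊗-identityˡ , λ x → trans (⊗-comm x (κ 1ℚ)) (⊗-identityˡ x)
      ; distrib = ⊗-distribˡ , λ x y z → trans (⊗-comm (y ⊕ z) x) (trans (⊗-distribˡ x y z)
          (cong₂ _⊕_ (⊗-comm x y) (⊗-comm x z))) }
    ; *-comm = ⊗-comm }

  ring : CommutativeRing 0ℓ 0ℓ
  ring = record { isCommutativeRing = isCommutativeRing }

  κ-homomorphism : CommutativeRing.rawRing ℚ.+-*-commutativeRing -Raw-AlmostCommutative⟶ fromCommutativeRing ring
  κ-homomorphism = record
    { ⟦_⟧ = κ
    ; +-homo = λ p q → refl
    ; *-homo = λ p q → cong₂ mk
        (P.solve 3 (λ D p q → p :* q := p :* q :+ D :* (con 0ℚ :* con 0ℚ)) refl (ι d) p q)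
        (P.solve 2 (λ p q → con 0ℚ := p :* con 0ℚ :+ con 0ℚ :* q) refl p q)
    ; -‿homo = λ p → refl
    ; 0-homo = refl
    ; 1-homo = refl }

  module K = RingSolver (CommutativeRing.rawRing ℚ.+-*-commutativeRing) (fromCommutativeRing ring) κ-homomorphism
    (λ p q → Maybe.map (cong κ) (dec⇒maybe (p ℚ.≟ q)))

  difference-zero : ∀ {x y : QF d} → x ⊕ (⊖ y) ≡ κ 0ℚ → x ≡ y
  difference-zero = x∙y⁻¹≈ε⇒x≈y (CommutativeRing.+-group ring) _ _

  quarticK : ℚ → QF d → QF d
  quarticK ε t = (((((t ⊗ t) ⊗ (t ⊗ t)) ⊕ (κ (ℚ.- two) ⊗ ((t ⊗ t) ⊗ t))) ⊕ (κ (1ℚ ℚ.- two ℚ.* ε) ⊗ (t ⊗ t))) ⊕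
      (κ (ℚ.- (two ℚ.* ε)) ⊗ t)) ⊕ κ 1ℚ

  :quarticK : ∀ {n} → (D ε : Polynomial n) → Polynomial n × Polynomial n → Polynomial n × Polynomial n
  :quarticK {n} D ε t = (((((t ⊗′ t) ⊗′ (t ⊗′ t)) ⊕′ (:κ (con (ℚ.- two)) ⊗′ ((t ⊗′ t) ⊗′ t))) ⊕′
      (:κ (con 1ℚ :- con two :* ε) ⊗′ (t ⊗′ t))) ⊕′ (:κ (:- (con two :* ε)) ⊗′ t)) ⊕′ :κ (con 1ℚ)
    where
    :κ : Polynomial n → Polynomial n × Polynomial n
    :κ q = q , con 0ℚ
    _⊗′_ _⊕′_ : Polynomial n × Polynomial n → Polynomial n × Polynomial n → Polynomial n × Polynomial n
    _⊗′_ = :mul D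
    (a , b) ⊕′ (a′ , b′) = a :+ a′ , b :+ b′

  module Coordinates (ε t₀ t₁ a b : ℚ) where
    D = ι d
    A = two ℚ.* t₀
    B = t₀ ℚ.* t₀ ℚ.- D ℚ.* (t₁ ℚ.* t₁)
    t y : QF d
    t = mk t₀ t₁
    y = mk (ℚ.- (t₀ ℚ.* t₀ ℚ.+ D ℚ.* (t₁ ℚ.* t₁) ℚ.+ a ℚ.* t₀ ℚ.+ b)) (ℚ.- (two ℚ.* t₀ ℚ.* t₁ ℚ.+ a ℚ.* t₁))

    :A : ∀ {n} → Polynomial n → Polynomial n
    :A t₀ = con two :* t₀
    :B : ∀ {n} → (D t₀ t₁ : Polynomial n) → Polynomial n
    :B D t₀ t₁ = t₀ :* t₀ :- D :* (t₁ :* t₁)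
    :y : ∀ {n} → (D t₀ t₁ a b : Polynomial n) → Polynomial n × Polynomial n
    :y D t₀ t₁ a b = :- (t₀ :* t₀ :+ D :* (t₁ :* t₁) :+ a :* t₀ :+ b) , :- (con two :* t₀ :* t₁ :+ a :* t₁)

    -- Since t² - A t + B = 0, the difference y² - quartic is hP t + hQ; this and `real` are its two
    -- coordinates.
    imaginary : t₁ ℚ.* hP ε a b A B ≡ im (y ⊗ y) ℚ.- im (quarticK ε t)
    imaginary = P.solve 6 (λ D ε t₀ t₁ a b → t₁ :* :hP ε a b (:A t₀) (:B D t₀ t₁) :=
      proj₂ (:mul D (:y D t₀ t₁ a b) (:y D t₀ t₁ a b)) :- proj₂ (:quarticK D ε (t₀ , t₁))) refl D ε t₀ t₁ a b

    real : t₀ ℚ.* hP ε a b A B ℚ.+ hQ ε a b A B ≡ re (y ⊗ y) ℚ.- re (quarticK ε t)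
    real = P.solve 6 (λ D ε t₀ t₁ a b → t₀ :* :hP ε a b (:A t₀) (:B D t₀ t₁) :+ :hQ ε a b (:A t₀) (:B D t₀ t₁) :=
      proj₁ (:mul D (:y D t₀ t₁ a b) (:y D t₀ t₁ a b)) :- proj₁ (:quarticK D ε (t₀ , t₁))) refl D ε t₀ t₁ a b

-- Quadratic points on both quartics.

module Points {d : ℤ} (sf : SquareFree d) (d≢1 : d ≢ + 1) where
  open Field {d}

  D = ι d

  norm : QF d → ℚ
  norm t = re t ℚ.* re t ℚ.- D ℚ.* (im t ℚ.* im t)

  ℚ-square-zero : ∀ q → q ℚ.* q ≡ 0ℚ → q ≡ 0ℚ
  ℚ-square-zero q h = decidable-stable (q ℚ.≟ 0ℚ) λ q≢0 → q≢0 (ℚ-cancel q≢0 h)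

  -- Otherwise the quotient of the two coordinates would be a rational square root of d.
  norm-zero : ∀ t → norm t ≡ 0ℚ → t ≡ κ 0ℚ
  norm-zero (mk t₀ t₁) h = by-im (t₁ ℚ.≟ 0ℚ)
    where
    by-im : Dec (t₁ ≡ 0ℚ) → mk t₀ t₁ ≡ κ 0ℚ
    by-im (yes refl) = cong₂ mk (ℚ-square-zero t₀
        (trans (P.solve 2 (λ D t₀ → t₀ :* t₀ := t₀ :* t₀ :- D :* (con 0ℚ :* con 0ℚ)) refl D t₀) h)) refl
    by-im (no t₁≢0) = ⊥-elim (not-square {d} sf d≢1 (t₀ ℚ.* i) (ℚ-difference (trans
        (P.solve 4 (λ D t₀ t₁ i → t₀ :* i :* (t₀ :* i) :- D := i :* i :* (t₀ :* t₀ :- D :* (t₁ :* t₁)) :+ D :*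
            (i :* t₁ :+ con 1ℚ) :* (i :* t₁ :- con 1ℚ)) refl D t₀ t₁ i)
        (trans (cong₂ (λ x y → i ℚ.* i ℚ.* x ℚ.+ D ℚ.* (y ℚ.+ 1ℚ) ℚ.* (y ℚ.- 1ℚ)) h (ℚ.*-inverseˡ t₁))
          (P.solve 2 (λ D i → i :* i :* con 0ℚ :+ D :* (con 1ℚ :+ con 1ℚ) :* (con 1ℚ :- con 1ℚ) := con 0ℚ) refl
              D i)))))
      where
      instance
        t₁-nonZero : ℚ.NonZero t₁
        t₁-nonZero = ℚ.≢-nonZero t₁≢0
      i = ℚ.1/ t₁

  -- Multiplication by the conjugate of x replaces x by its nonzero norm.
  K-cancel : ∀ x y → x ≢ κ 0ℚ → x ⊗ y ≡ κ 0ℚ → y ≡ κ 0ℚ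
  K-cancel x@(mk a b) (mk a′ b′) x≢0 h = cong₂ mk
    (ℚ-cancel N≢0 (trans (P.solve 5 (λ D a b c d → (a :* a :- D :* (b :* b)) :* c := a :*
        (a :* c :+ D :* (b :* d)) :- D :* b :* (a :* d :+ b :* c)) refl D a b a′ b′)
      (trans (cong₂ (λ u v → a ℚ.* u ℚ.- D ℚ.* b ℚ.* v) (cong re h) (cong im h))
          (P.solve 2 (λ k l → k :* con 0ℚ :- l :* con 0ℚ := con 0ℚ) refl a (D ℚ.* b)))))
    (ℚ-cancel N≢0 (trans (P.solve 5 (λ D a b c d → (a :* a :- D :* (b :* b)) :* d := a :* (a :* d :+ b :* c) :-
        b :* (a :* c :+ D :* (b :* d))) refl D a b a′ b′)
      (trans (cong₂ (λ u v → a ℚ.* v ℚ.- b ℚ.* u) (cong re h) (cong im h))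
          (P.solve 2 (λ k l → k :* con 0ℚ :- l :* con 0ℚ := con 0ℚ) refl a b))))
    where
    N≢0 : norm x ≢ 0ℚ
    N≢0 e = x≢0 (norm-zero x e)

  trace-norm-relation : ∀ ε (ε± : ε ≡ 1ℚ ⊎ ε ≡ ℚ.- 1ℚ) t y → im t ≢ 0ℚ → y ⊗ y ≡ quarticK ε t →
    Trace.Conclusion ε ε± (two ℚ.* re t) (norm t)
  trace-norm-relation ε ε± t@(mk t₀ t₁) y@(mk y₀ y₁) t₁≢0 eq = Trace.trace-norm ε ε± a b (two ℚ.* t₀) (norm t)
      hP≡0 hQ≡0
    where
    instance
      t₁-nonZero : ℚ.NonZero t₁
      t₁-nonZero = ℚ.≢-nonZero t₁≢0
    i = ℚ.1/ t₁
    -- The solution of y = -(t² + a t + b) in rational a and b: the irrational coordinate determines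
    -- a because t₁ is nonzero, and then the rational coordinate determines b.
    a = ℚ.- (i ℚ.* (y₁ ℚ.+ two ℚ.* t₀ ℚ.* t₁))
    b = ℚ.- (y₀ ℚ.+ t₀ ℚ.* t₀ ℚ.+ D ℚ.* (t₁ ℚ.* t₁) ℚ.+ a ℚ.* t₀)
    module C = Coordinates ε t₀ t₁ a b
    y≡ : y ≡ C.y
    y≡ = cong₂ mk
      (P.solve 5 (λ D t₀ t₁ a y₀ → y₀ := :- (t₀ :* t₀ :+ D :* (t₁ :* t₁) :+ a :* t₀ :+ :-
          (y₀ :+ t₀ :* t₀ :+ D :* (t₁ :* t₁) :+ a :* t₀))) refl D t₀ t₁ a y₀)
      (sym (trans (P.solve 4 (λ t₀ t₁ i y₁ → :- (con two :* t₀ :* t₁ :+ :- (i :* (y₁ :+ con two :* t₀ :* t₁)) :*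
          t₁) :=
          :- (con two :* t₀ :* t₁) :+ i :* t₁ :* (y₁ :+ con two :* t₀ :* t₁)) refl t₀ t₁ i y₁)
        (trans (cong (λ u → ℚ.- (two ℚ.* t₀ ℚ.* t₁) ℚ.+ u ℚ.* (y₁ ℚ.+ two ℚ.* t₀ ℚ.* t₁)) (ℚ.*-inverseˡ t₁))
          (P.solve 3 (λ t₀ t₁ y₁ → :- (con two :* t₀ :* t₁) :+ con 1ℚ :* (y₁ :+ con two :* t₀ :* t₁) := y₁) refl
              t₀ t₁ y₁))))
    eq′ : C.y ⊗ C.y ≡ quarticK ε t
    eq′ = trans (cong₂ _⊗_ (sym y≡) (sym y≡)) eq
    difference-≡ : ∀ {p q} → p ≡ q → p ℚ.- q ≡ 0ℚ
    difference-≡ {p} refl = ℚ.+-inverseʳ p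
    hP≡0 : hP ε a b (two ℚ.* t₀) (norm t) ≡ 0ℚ
    hP≡0 = ℚ-cancel t₁≢0 (trans C.imaginary (difference-≡ (cong im eq′)))
    hQ≡0 : hQ ε a b (two ℚ.* t₀) (norm t) ≡ 0ℚ
    hQ≡0 = trans (sym (trans (cong (λ u → t₀ ℚ.* u ℚ.+ hQ ε a b (two ℚ.* t₀) (norm t)) hP≡0)
      (P.solve 2 (λ t h → t :* con 0ℚ :+ h := h) refl t₀ (hQ ε a b (two ℚ.* t₀) (norm t)))))
          (trans C.real (difference-≡ (cong re eq′)))

  -- The norm B is nonzero. If B is 1 or -1, both relations for the opposite ε fail. Otherwise A (B
  -- + 1) = B = A (B - 1), so A = 0 and B = 0.
  no-irrational : ∀ t y z → im t ≢ 0ℚ → y ⊗ y ≡ quarticK 1ℚ t → z ⊗ z ≡ quarticK (ℚ.- 1ℚ) t → ⊥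
  no-irrational t y z t₁≢0 ey ez = combine (trace-norm-relation 1ℚ (inj₁ refl) t y t₁≢0 ey)
      (trace-norm-relation (ℚ.- 1ℚ) (inj₂ refl) t z t₁≢0 ez)
    where
    A = two ℚ.* re t
    B = norm t
    B≢0 : B ≢ 0ℚ
    B≢0 h = t₁≢0 (cong im (norm-zero t h))
    combine : B ≡ 1ℚ ⊎ A ℚ.* (B ℚ.+ 1ℚ) ≡ B → B ≡ ℚ.- 1ℚ ⊎ A ℚ.* (B ℚ.+ ℚ.- 1ℚ) ≡ B → ⊥
    combine (inj₁ e) (inj₁ f) = contradiction (trans (sym e) f) λ ()
    combine (inj₁ e) (inj₂ f) = B≢0 (trans (sym f) (trans (cong (λ B → A ℚ.* (B ℚ.+ ℚ.- 1ℚ)) e) (ℚ.*-zeroʳ A)))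
    combine (inj₂ e) (inj₁ f) = B≢0 (trans (sym e) (trans (cong (λ B → A ℚ.* (B ℚ.+ 1ℚ)) f) (ℚ.*-zeroʳ A)))
    combine (inj₂ e) (inj₂ f) = B≢0 (trans (sym e) (trans (cong (ℚ._* (B ℚ.+ 1ℚ)) A≡0) (ℚ.*-zeroˡ (B ℚ.+ 1ℚ))))
      where
      A≡0 : A ≡ 0ℚ
      A≡0 = ℚ-cancel {two} two≢0 (trans (P.solve 2 (λ A B → con two :* A := A :* (B :+ con 1ℚ) :- A :*
          (B :+ con (ℚ.- 1ℚ))) refl A B)
        (trans (cong₂ ℚ._-_ e f) (ℚ.+-inverseʳ B)))

  -- The square of y is rational, so one coordinate of y vanishes. A nonzero rational coordinate
  -- would make (t₀, y) a rational point, which forces t₀ = 0. So y, and likewise z, is a rational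
  -- multiple of √d.
  no-rational : ∀ t₀ y z → t₀ ≢ 0ℚ → t₀ ℚ.+ 1ℚ ≢ 0ℚ → y ⊗ y ≡ quarticK 1ℚ (κ t₀) → z ⊗ z ≡ quarticK (ℚ.- 1ℚ)
      (κ t₀) → ⊥
  no-rational t₀ y z t₀≢0 t₀≢-1 ey ez = t₀≢-1 (only-twist-−1 {d} sf d≢1 t₀ (im y) (im z) t₀≢0
      (pure 1ℚ (inj₁ refl) y ey) (pure (ℚ.- 1ℚ) (inj₂ refl) z ez))
    where
    re-quartic : ∀ ε → re (quarticK ε (κ t₀)) ≡ quartic ε t₀
    re-quartic ε = P.solve 3 (λ D ε t → proj₁ (:quarticK D ε (t , con 0ℚ)) := :quartic ε t) refl D ε t₀
    im-quartic : ∀ ε → im (quarticK ε (κ t₀)) ≡ 0ℚ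
    im-quartic ε = P.solve 3 (λ D ε t → proj₂ (:quarticK D ε (t , con 0ℚ)) := con 0ℚ) refl D ε t₀
    pure : ∀ ε → ε ≡ 1ℚ ⊎ ε ≡ ℚ.- 1ℚ → ∀ y → y ⊗ y ≡ quarticK ε (κ t₀) → D ℚ.* (im y ℚ.* im y) ≡ quartic ε t₀
    pure ε ε± (mk y₀ y₁) e = by-re (y₀ ℚ.≟ 0ℚ)
      where
      re-eq : y₀ ℚ.* y₀ ℚ.+ D ℚ.* (y₁ ℚ.* y₁) ≡ quartic ε t₀
      re-eq = trans (cong re e) (re-quartic ε)
      by-re : Dec (y₀ ≡ 0ℚ) → D ℚ.* (y₁ ℚ.* y₁) ≡ quartic ε t₀
      by-re (yes refl) = trans (P.solve 2 (λ D y₁ → D :* (y₁ :* y₁) := con 0ℚ :* con 0ℚ :+ D :* (y₁ :* y₁)) refl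
          D y₁) re-eq
      by-re (no y₀≢0) = ⊥-elim (t₀≢0 (only-square-0 ε ε± t₀ y₀ (trans (trans
          (P.solve 2 (λ D y₀ → y₀ :* y₀ := y₀ :* y₀ :+ D :* (con 0ℚ :* con 0ℚ)) refl D y₀)
              (cong (λ y₁ → y₀ ℚ.* y₀ ℚ.+ D ℚ.* (y₁ ℚ.* y₁)) (sym y₁≡0))) re-eq)))
        where
        y₁≡0 : y₁ ≡ 0ℚ
        y₁≡0 = ℚ-cancel y₀≢0 (ℚ-cancel {two} two≢0
            (trans (P.solve 2 (λ y₀ y₁ → con two :* (y₀ :* y₁) := y₀ :* y₁ :+ y₁ :* y₀) refl y₀ y₁)
          (trans (cong im e) (im-quartic ε))))

  no-point : ∀ t y z → t ≢ κ 0ℚ → t ⊕ κ 1ℚ ≢ κ 0ℚ → y ⊗ y ≡ quarticK 1ℚ t → z ⊗ z ≡ quarticK (ℚ.- 1ℚ) t → ⊥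
  no-point t@(mk t₀ t₁) y z t≢0 t≢-1 ey ez = by-im (t₁ ℚ.≟ 0ℚ)
    where
    by-im : Dec (t₁ ≡ 0ℚ) → ⊥
    by-im (no t₁≢0) = no-irrational t y z t₁≢0 ey ez
    by-im (yes refl) = no-rational t₀ y z (t≢0 ∘ cong κ) (t≢-1 ∘ cong κ) ey ez

  -- From the graph to a point on both quartics.

  open K using () renaming (Polynomial to KPolynomial; _:+_ to _:⊕_; _:*_ to _:⊗_; :-_ to :⊖_; _:-_ to _:⊝_; con
      to :κ; _:=_ to _:≡_; solve to solveK)

  module _ {c : QF d} (φ : V6 → QF d) (injective : ∀ u v → φ u ≡ φ v → u ≡ v) (edge : ∀ u v → E6 u v → fc c
      (φ u) ≡ φ v) where

    a b s p q pb r t t′ : QF d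
    a = φ V6.a
    b = φ V6.b
    s = φ V6.s
    p = φ V6.p
    q = φ V6.q
    pb = φ V6.pb
    r = φ V6.r
    -- Writing a = 1/2 + ρ and p = -1/2 + σ, so that ρ² - σ² = 1, these are t = ρ + σ and t′ = ρ - σ.
    t = a ⊕ p
    t′ = (a ⊕ (⊖ p)) ⊕ κ (ℚ.- 1ℚ)

    _-K_ : QF d → QF d → QF d
    x -K y = x ⊕ (⊖ y)

    zero-difference : ∀ {x y} → x ≡ y → x -K y ≡ κ 0ℚ
    zero-difference {x} refl = CommutativeRing.-‿inverseʳ ring x

    distinct : ∀ u v → u ≢ v → φ u -K φ v ≢ κ 0ℚ
    distinct u v u≢v h = u≢v (injective u v (difference-zero h))

    siblings : ∀ u v w → E6 u w → E6 v w → u ≢ v → φ u ⊕ φ v ≡ κ 0ℚ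
    siblings u v w eu ev u≢v = K-cancel (φ u -K φ v) (φ u ⊕ φ v) (distinct u v u≢v) (trans
      (solveK 3 (λ x y c → (x :⊝ (y)) :⊗ (x :⊕ y) :≡ ((x :⊗ x) :⊕ c) :⊝ (((y :⊗ y) :⊕ c))) refl (φ u) (φ v) c)
      (zero-difference (trans (edge u w eu) (sym (edge v w ev)))))

    a+b : a ⊕ b ≡ κ 0ℚ
    a+b = siblings V6.a V6.b V6.a E6.a→a E6.b→a λ ()

    p+pb : p ⊕ pb ≡ κ 0ℚ
    p+pb = siblings V6.p V6.pb V6.q E6.p→q E6.pb→q λ ()

    fixed : fc c a -K a ≡ κ 0ℚ
    fixed = zero-difference (edge V6.a V6.a E6.a→a)

    p→q : fc c p -K q ≡ κ 0ℚ
    p→q = zero-difference (edge V6.p V6.q E6.p→q)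

    q→p : fc c q -K p ≡ κ 0ℚ
    q→p = zero-difference (edge V6.q V6.p E6.q→p)

    s→b : fc c s -K b ≡ κ 0ℚ
    s→b = zero-difference (edge V6.s V6.b E6.s→b)

    r→pb : fc c r -K pb ≡ κ 0ℚ
    r→pb = zero-difference (edge V6.r V6.pb E6.r→pb)

    -- Subtracting the two equations of the cycle gives (p - q) (p + q + 1) = 0.
    2-cycle : (p ⊕ q) ⊕ κ 1ℚ ≡ κ 0ℚ
    2-cycle = K-cancel (p -K q) _ (distinct V6.p V6.q λ ()) (trans
      (solveK 3 (λ p q c → (p :⊝ (q)) :⊗ ((p :⊕ q) :⊕ :κ 1ℚ) :≡
        (((p :⊗ p) :⊕ c) :⊝ (q)) :⊝ ((((q :⊗ q) :⊕ c) :⊝ (p)))) refl p q c)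
      (cong₂ _-K_ p→q q→p))

    -- This is ρ² - σ² = 1: the fixed point has ρ² = 1/4 - c, and the 2-cycle has σ² = -3/4 - c.
    tt′ : (t ⊗ t′) -K κ 1ℚ ≡ κ 0ℚ
    tt′ = trans (solveK 4 (λ a p q c → ((a :⊕ p) :⊗ ((a :⊝ (p)) :⊕ :κ (ℚ.- 1ℚ))) :⊝ (:κ 1ℚ) :≡
        ((((a :⊗ a) :⊕ c) :⊝ (a)) :⊝ ((((p :⊗ p) :⊕ c) :⊝ (q)))) :⊝ (((p :⊕ q) :⊕ :κ 1ℚ))) refl a p q c)
      (cong₂ _-K_ (cong₂ _-K_ fixed p→q) 2-cycle)

    t≢0 : t ≢ κ 0ℚ
    t≢0 h = contradiction (trans (sym tt′) (trans (cong (λ t → (t ⊗ t′) -K κ 1ℚ) h)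
      (solveK 1 (λ t′ → (:κ 0ℚ :⊗ t′) :⊝ (:κ 1ℚ) :≡ :κ (ℚ.- 1ℚ)) refl t′))) λ ()

    -- t = -1 means ρ = -1 and σ = 0, so that the 2-cycle degenerates.
    t≢-1 : t ⊕ κ 1ℚ ≢ κ 0ℚ
    t≢-1 h = distinct V6.p V6.q (λ ()) (trans
      (solveK 3 (λ a p q → p :⊝ (q) :≡
        ((((a :⊕ p) :⊕ :κ 1ℚ) :⊗ (:κ 1ℚ :⊝ (((a :⊝ (p)) :⊕ :κ (ℚ.- 1ℚ))))) :⊕
          (((a :⊕ p) :⊗ ((a :⊝ (p)) :⊕ :κ (ℚ.- 1ℚ))) :⊝ (:κ 1ℚ))) :⊝ (((p :⊕ q) :⊕ :κ 1ℚ))) refl a p q)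
      (trans (cong₂ _-K_ (cong₂ _⊕_ (cong (_⊗ (κ 1ℚ -K t′)) h) tt′) 2-cycle)
        (solveK 1 (λ x → ((:κ 0ℚ :⊗ x) :⊕ :κ 0ℚ) :⊝ (:κ 0ℚ) :≡ :κ 0ℚ) refl (κ 1ℚ -K t′))))

    vanishing : ∀ x y → (x ⊗ κ 0ℚ) ⊕ (κ 0ℚ ⊗ y) ≡ κ 0ℚ
    vanishing = solveK 2 (λ x y → (x :⊗ :κ 0ℚ) :⊕ (:κ 0ℚ :⊗ y) :≡ :κ 0ℚ) refl

    y z : QF d
    y = κ two ⊗ (t ⊗ s)
    z = κ two ⊗ (t ⊗ r)

    quarticP : ∀ {n} → ℚ → KPolynomial n → KPolynomial n
    quarticP ε t = (t :⊗ t) :⊗ (t :⊗ t) :⊕ :κ (ℚ.- two) :⊗ ((t :⊗ t) :⊗ t) :⊕ :κ (1ℚ ℚ.- two ℚ.* ε) :⊗ (t :⊗ t)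
        :⊕ :κ (ℚ.- (two ℚ.* ε)) :⊗ t :⊕ :κ 1ℚ

    -- With u = t t′, the squares of 2 t s and 2 t r are (t² + u - t)² - 4 t² and (t² - u - t)² + 4
    -- t². Subtracting their values at u = 1 leaves u - 1 times the cofactor `g₁` or `g₂`.
    4t² g₁ g₂ : QF d
    4t² = κ (two ℚ.* two) ⊗ (t ⊗ t)
    g₁ = (((κ two ⊗ (t ⊗ t)) ⊕ (t ⊗ t′)) ⊕ κ 1ℚ) ⊕ (κ (ℚ.- two) ⊗ t)
    g₂ = (((κ (ℚ.- two) ⊗ (t ⊗ t)) ⊕ (t ⊗ t′)) ⊕ κ 1ℚ) ⊕ (κ two ⊗ t)

    -- The point s enters through s² = b - c = a² - 2 a. The difference of the two sides is
    -- exhibited as a combination of the edge relations and t t′ - 1, all of which vanish.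
    y² : y ⊗ y ≡ quarticK 1ℚ t
    y² = difference-zero (trans
      (solveK 5 (λ a p c s b →
        let t = a :⊕ p ; t′ = (a :⊝ (p)) :⊕ :κ (ℚ.- 1ℚ) ; y = :κ two :⊗ (t :⊗ s) in
        (y :⊗ y) :⊝ ((quarticP 1ℚ t))
        :≡ ((:κ (two ℚ.* two) :⊗ (t :⊗ t)) :⊗ (((((s :⊗ s) :⊕ c) :⊝ (b)) :⊕ (a :⊕ b)) :⊝ ((((a :⊗ a) :⊕ c) :⊝ (a)))))
          :⊕ (((t :⊗ t′) :⊝ (:κ 1ℚ)) :⊗ (:κ two :⊗ (t :⊗ t) :⊕ t :⊗ t′ :⊕ :κ 1ℚ :⊕ :κ (ℚ.- two) :⊗ t))) refl a p
              c s b)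
      (trans (cong₂ (λ u v → (4t² ⊗ u) ⊕ (v ⊗ g₁)) (cong₂ _-K_ (cong₂ _⊕_ s→b a+b) fixed) tt′) (vanishing 4t² g₁)))

    -- The point r enters through r² = -p - c = p² + 1, where the 2-cycle eliminates c.
    z² : z ⊗ z ≡ quarticK (ℚ.- 1ℚ) t
    z² = difference-zero (trans
      (solveK 6 (λ a p q c r pb →
        let t = a :⊕ p ; t′ = (a :⊝ (p)) :⊕ :κ (ℚ.- 1ℚ) ; z = :κ two :⊗ (t :⊗ r) in
        (z :⊗ z) :⊝ ((quarticP (ℚ.- 1ℚ) t))
        :≡ ((:κ (two ℚ.* two) :⊗ (t :⊗ t)) :⊗
            ((((((r :⊗ r) :⊕ c) :⊝ (pb)) :⊕ (p :⊕ pb)) :⊝ ((((p :⊗ p) :⊕ c) :⊝ (q)))) :⊝ (((p :⊕ q) :⊕ :κ 1ℚ))))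
          :⊕ (((t :⊗ t′) :⊝ (:κ 1ℚ)) :⊗ (:κ (ℚ.- two) :⊗ (t :⊗ t) :⊕ t :⊗ t′ :⊕ :κ 1ℚ :⊕ :κ two :⊗ t))) refl a p
              q c r pb)
      (trans (cong₂ (λ u v → (4t² ⊗ u) ⊕ (v ⊗ g₂)) (cong₂ _-K_ (cong₂ _-K_ (cong₂ _⊕_ r→pb p+pb) p→q) 2-cycle)
          tt′) (vanishing 4t² g₂)))

    no-G6 : ⊥
    no-G6 = no-point t y z t≢0 t≢-1 y² z²

theorem5p16 : (d : ℤ) → SquareFree d → d ≢ ℤ.pos 1 → (c : QF d) → ¬ ContainsG6 c
theorem5p16 d sf d≢1 c (φ , injective , _ , edge) = Points.no-G6 sf d≢1 φ injective edge
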